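{- The semidefinite program $\mathrm{SDP}_2$ (the symmetry-reduced QAP relaxation of the traveling salesman problem defined in the context) is non-monotonic: there exist $N<N'$ and TSP instances $D\in\mathbb{R}^{N\times N}$ and $D'\in\mathbb{R}^{N'\times N'}$ (both symmetric and metric) such that $D$ is the principal submatrix $D'[S]$ of $D'$ on some set $S$ of $N$ vertices (up to relabeling of vertices), and $$\mathrm{OPT}_{\mathrm{SDP}_2}(D')<\mathrm{OPT}_{\mathrm{SDP}_2}(D).$$
   Context: TSP: an instance on $N\ge 3$ vertices is a symmetric matrix $D=(d_{ij})\in\mathbb{R}^{N\times N}$ with $d_{ij}\ge 0$, $d_{ii}=0$ and $d_{ij}\le d_{ik}+d_{kj}$ for all $i,j,k$ (distinct vertices may be at distance $0$). Non-monotonic means that adding vertices to an instance, in a way that keeps the edge costs symmetric and metric and leaves costs between the original vertices unchanged, can strictly decrease the optimal value. Notation: $[m]=\{1,\dots,m\}$; $I_m$, $J_m$ are the $m\times m$ identity and all-ones matrices; $E^{(m)}_{jj}$ is the $m\times m$ matrix with a single $1$ in position $(j,j)$; $\mathbb{S}^{m\times m}$ is the set of real symmetric $m\times m$ matrices; $M[S,T]$ is the submatrix of $M$ with rows in $S$ and columns in $T$, and $M[S]=M[S,S]$; $\mathrm{Diag}(x)$ is the diagonal matrix with diagonal $x$; $\mathrm{vec}(M)$ stacks the columns of $M$; $\otimes$ is the Kronecker product; $Y\ge 0$ is entrywise nonnegativity and $Y\succeq 0$ is positive semidefiniteness. $C^{(N)}_1$ is the adjacency matrix of the $N$-cycle on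 $[N]$ with edges $\{i,i+1\}$ and $\{N,1\}$. $\mathrm{SDP}_2$: for an $N$-vertex instance $D$, put $n=N-1$, fix $r,s\in[n+1]$, and let $\alpha=[n+1]\setminus\{r\}$, $\beta=[n+1]\setminus\{s\}$, $\bar c=\mathrm{vec}\big(C^{(n+1)}_1[\alpha,\{r\}]\,D[\{s\},\beta]\big)\in\mathbb{R}^{n^2}$. Then $\mathrm{OPT}_{\mathrm{SDP}_2}(D)$ is the minimum of $$\mathrm{trace}\Big(\big(D[\beta]\otimes \tfrac12 C^{(n+1)}_1[\alpha]+\mathrm{Diag}(\bar c)\big)Y\Big)$$ over $Y\in\mathbb{S}^{n^2\times n^2}$ with $Y\ge 0$, $Y\succeq 0$ and (i) $\mathrm{trace}((I_n\otimes E^{(n)}_{jj})Y)=1$ for $j=1,\dots,n$; (ii) $\mathrm{trace}((E^{(n)}_{jj}\otimes I_n)Y)=1$ for $j=1,\dots,n$; (iii) $\mathrm{trace}\big((I_n\otimes(J_n-I_n)+(J_n-I_n)\otimes I_n)Y\big)=0$; (iv) $\mathrm{trace}((J_n\otimes J_n)Y)=n^2$. The choice of $r,s$ for each $N$ is arbitrary but fixed (one may take $r=s=1$). -}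

module Defs where

open import Algebra.Bundles using (CommutativeMonoid)
import Algebra.Properties.CommutativeSemigroup as CommutativeSemigroup
open import Data.Bool.Base using (if_then_else_)
open import Data.Fin.Base using (Fin; toℕ; punchIn; quotient; remainder)
import Data.Fin.Properties as Fin
open import Data.Integer.Base using (+_)
open import Data.Nat.Base as ℕ using (ℕ; suc)
import Data.Nat.Properties as ℕ
open import Data.Product.Base using (∃-syntax; _×_; _,_)
open import Data.Rational.Base as ℚ using (ℚ; 0ℚ; 1ℚ; ½; ∣_∣; 1/_)
import Data.Rational.Properties as ℚ
open import Data.Sum.Base using (_⊎_)
open import Data.Vec.Functional using (Vector; foldr)
open import Relation.Binary.PropositionalEquality
  using (_≡_; refl; sym; trans; cong; cong₂; subst)
open import Relation.Nullary.Decidable using (Dec; does; _×-dec_; _⊎-dec_)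

------------------------------------------------------------------------
-- Cauchy's real numbers: Cauchy sequences of rationals, compared up to
-- the setoid equality _≈_.

record ℝ : Set where
  constructor mkℝ
  field
    seq    : ℕ → ℚ
    cauchy : ∀ ε → 0ℚ ℚ.< ε →
             ∃[ N ] ∀ m n → N ℕ.≤ m → N ℕ.≤ n → ∣ seq m ℚ.- seq n ∣ ℚ.≤ ε

open ℝ public

infix  4 _≈_ _≤_ _<_
infixl 6 _+_ _-_
infixl 7 _*_
infix  8 -_

_≈_ : ℝ → ℝ → Set
x ≈ y = ∀ ε → 0ℚ ℚ.< ε → ∃[ N ] ∀ n → N ℕ.≤ n → ∣ seq x n ℚ.- seq y n ∣ ℚ.≤ ε

_≤_ : ℝ → ℝ → Set
x ≤ y = ∀ ε → 0ℚ ℚ.< ε → ∃[ N ] ∀ n → N ℕ.≤ n → seq x n ℚ.≤ seq y n ℚ.+ ε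

_<_ : ℝ → ℝ → Set
x < y = ∃[ ε ] 0ℚ ℚ.< ε × (∃[ N ] ∀ n → N ℕ.≤ n → seq x n ℚ.+ ε ℚ.≤ seq y n)

private
  open CommutativeSemigroup
    (CommutativeMonoid.commutativeSemigroup ℚ.+-0-commutativeMonoid) using (interchange)

  half-pos : ∀ {ε} → 0ℚ ℚ.< ε → 0ℚ ℚ.< ½ ℚ.* ε
  half-pos {ε} ε>0 = subst (ℚ._< ½ ℚ.* ε) (ℚ.*-zeroʳ ½) (ℚ.*-monoʳ-<-pos ½ ε>0)

  halves : ∀ ε → ½ ℚ.* ε ℚ.+ ½ ℚ.* ε ≡ ε
  halves ε = trans (sym (ℚ.*-distribʳ-+ ε ½ ½)) (ℚ.*-identityˡ ε)

  diff-+ : ∀ a b c d → (a ℚ.+ b) ℚ.- (c ℚ.+ d) ≡ (a ℚ.- c) ℚ.+ (b ℚ.- d)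
  diff-+ a b c d = trans (cong ((a ℚ.+ b) ℚ.+_) (ℚ.neg-distrib-+ c d))
                         (interchange a b (ℚ.- c) (ℚ.- d))

  diff-neg : ∀ a c → (ℚ.- a) ℚ.- (ℚ.- c) ≡ ℚ.- (a ℚ.- c)
  diff-neg a c = sym (ℚ.neg-distrib-+ a (ℚ.- c))

  telescope : ∀ a b c → (a ℚ.- b) ℚ.+ (b ℚ.- c) ≡ a ℚ.- c
  telescope a b c = trans (ℚ.+-assoc a (ℚ.- b) (b ℚ.- c))
    (cong (a ℚ.+_) (trans (sym (ℚ.+-assoc (ℚ.- b) b (ℚ.- c)))
                   (trans (cong (ℚ._- c) (ℚ.+-inverseˡ b)) (ℚ.+-identityˡ (ℚ.- c)))))

  diff-* : ∀ a b c d →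
           a ℚ.* b ℚ.- c ℚ.* d ≡ a ℚ.* (b ℚ.- d) ℚ.+ (a ℚ.- c) ℚ.* d
  diff-* a b c d = sym (trans
    (cong₂ ℚ._+_
      (trans (ℚ.*-distribˡ-+ a b (ℚ.- d))
             (cong (a ℚ.* b ℚ.+_) (sym (ℚ.neg-distribʳ-* a d))))
      (trans (ℚ.*-distribʳ-+ d a (ℚ.- c))
             (cong (a ℚ.* d ℚ.+_) (sym (ℚ.neg-distribˡ-* c d)))))
    (telescope (a ℚ.* b) (a ℚ.* d) (c ℚ.* d)))

  split : ∀ a b → a ≡ b ℚ.+ (a ℚ.- b)
  split a b = sym (trans (ℚ.+-comm b (a ℚ.- b))
    (trans (ℚ.+-assoc a (ℚ.- b) b)
    (trans (cong (a ℚ.+_) (ℚ.+-inverseˡ b)) (ℚ.+-identityʳ a))))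

  0<1 : 0ℚ ℚ.< 1ℚ
  0<1 = ℚ.positive⁻¹ 1ℚ

  eventually-bounded : ∀ x →
    ∃[ B ] 0ℚ ℚ.< B × (∃[ N ] ∀ n → N ℕ.≤ n → ∣ seq x n ∣ ℚ.≤ B)
  eventually-bounded x with cauchy x 1ℚ 0<1
  ... | N , close =
    ∣ seq x N ∣ ℚ.+ 1ℚ , ℚ.+-mono-≤-< (ℚ.0≤∣p∣ (seq x N)) 0<1 , N , λ n N≤n →
    let open ℚ.≤-Reasoning in begin
    ∣ seq x n ∣                                ≡⟨ cong ∣_∣ (split (seq x n) (seq x N)) ⟩
    ∣ seq x N ℚ.+ (seq x n ℚ.- seq x N) ∣      ≤⟨ ℚ.∣p+q∣≤∣p∣+∣q∣ (seq x N) _ ⟩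
    ∣ seq x N ∣ ℚ.+ ∣ seq x n ℚ.- seq x N ∣    ≤⟨ ℚ.+-monoʳ-≤ ∣ seq x N ∣ (close n N N≤n ℕ.≤-refl) ⟩
    ∣ seq x N ∣ ℚ.+ 1ℚ                         ∎

  *-mono-≤ : ∀ {a b c d} → 0ℚ ℚ.≤ b → 0ℚ ℚ.≤ c →
             a ℚ.≤ b → c ℚ.≤ d → a ℚ.* c ℚ.≤ b ℚ.* d
  *-mono-≤ {_} {b} {c} 0≤b 0≤c a≤b c≤d = ℚ.≤-trans
    (ℚ.*-monoʳ-≤-nonNeg c {{ℚ.nonNegative 0≤c}} a≤b)
    (ℚ.*-monoˡ-≤-nonNeg b {{ℚ.nonNegative 0≤b}} c≤d)

fromℚ : ℚ → ℝ
fromℚ q .seq _ = q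
fromℚ q .cauchy ε ε>0 = 0 , λ _ _ _ _ →
  subst (λ z → ∣ z ∣ ℚ.≤ ε) (sym (ℚ.+-inverseʳ q)) (ℚ.<⇒≤ ε>0)

0ℝ 1ℝ : ℝ
0ℝ = fromℚ 0ℚ
1ℝ = fromℚ 1ℚ

_+_ : ℝ → ℝ → ℝ
(x + y) .seq n = seq x n ℚ.+ seq y n
(x + y) .cauchy ε ε>0 with cauchy x (½ ℚ.* ε) (half-pos ε>0) | cauchy y (½ ℚ.* ε) (half-pos ε>0)
... | M , close-x | N , close-y = M ℕ.⊔ N , λ m n M⊔N≤m M⊔N≤n →
  let a = seq x m ; b = seq y m ; c = seq x n ; d = seq y n
      open ℚ.≤-Reasoning in begin
  ∣ (a ℚ.+ b) ℚ.- (c ℚ.+ d) ∣        ≡⟨ cong ∣_∣ (diff-+ a b c d) ⟩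
  ∣ (a ℚ.- c) ℚ.+ (b ℚ.- d) ∣        ≤⟨ ℚ.∣p+q∣≤∣p∣+∣q∣ (a ℚ.- c) (b ℚ.- d) ⟩
  ∣ a ℚ.- c ∣ ℚ.+ ∣ b ℚ.- d ∣        ≤⟨ ℚ.+-mono-≤
                                          (close-x m n (ℕ.m⊔n≤o⇒m≤o M N M⊔N≤m) (ℕ.m⊔n≤o⇒m≤o M N M⊔N≤n))
                                          (close-y m n (ℕ.m⊔n≤o⇒n≤o M N M⊔N≤m) (ℕ.m⊔n≤o⇒n≤o M N M⊔N≤n)) ⟩
  ½ ℚ.* ε ℚ.+ ½ ℚ.* ε                ≡⟨ halves ε ⟩
  ε                                  ∎

-_ : ℝ → ℝ
(- x) .seq n = ℚ.- seq x n
(- x) .cauchy ε ε>0 with cauchy x ε ε>0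
... | N , close = N , λ m n N≤m N≤n →
  let a = seq x m ; c = seq x n in
  subst (ℚ._≤ ε)
    (sym (trans (cong ∣_∣ (diff-neg a c)) (ℚ.∣-p∣≡∣p∣ (a ℚ.- c))))
    (close m n N≤m N≤n)

_-_ : ℝ → ℝ → ℝ
x - y = x + (- y)

private
  module Product (x y : ℝ) {A B : ℚ} (A>0 : 0ℚ ℚ.< A) (B>0 : 0ℚ ℚ.< B) (K L : ℕ)
    (∣x∣≤A : ∀ n → K ℕ.≤ n → ∣ seq x n ∣ ℚ.≤ A)
    (∣y∣≤B : ∀ n → L ℕ.≤ n → ∣ seq y n ∣ ℚ.≤ B)
    (ε : ℚ) (ε>0 : 0ℚ ℚ.< ε) where

    A+B>0 : 0ℚ ℚ.< A ℚ.+ B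
    A+B>0 = ℚ.+-mono-< A>0 B>0

    instance
      A+B-pos : ℚ.Positive (A ℚ.+ B)
      A+B-pos = ℚ.positive A+B>0

      A+B-nonZero : ℚ.NonZero (A ℚ.+ B)
      A+B-nonZero = ℚ.pos⇒nonZero (A ℚ.+ B)

    δ : ℚ
    δ = 1/ (A ℚ.+ B) ℚ.* ε

    δ>0 : 0ℚ ℚ.< δ
    δ>0 = subst (ℚ._< δ) (ℚ.*-zeroʳ (1/ (A ℚ.+ B)))
            (ℚ.*-monoʳ-<-pos (1/ (A ℚ.+ B)) {{ℚ.1/pos⇒pos (A ℚ.+ B)}} ε>0)

    total : A ℚ.* δ ℚ.+ δ ℚ.* B ≡ ε
    total = trans (cong (A ℚ.* δ ℚ.+_) (ℚ.*-comm δ B))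
           (trans (sym (ℚ.*-distribʳ-+ δ A B))
           (trans (sym (ℚ.*-assoc (A ℚ.+ B) (1/ (A ℚ.+ B)) ε))
           (trans (cong (ℚ._* ε) (ℚ.*-inverseʳ (A ℚ.+ B)))
                  (ℚ.*-identityˡ ε))))

    close : ∃[ M ] (∀ m n → M ℕ.≤ m → M ℕ.≤ n → ∣ seq x m ℚ.- seq x n ∣ ℚ.≤ δ) →
            ∃[ M ] (∀ m n → M ℕ.≤ m → M ℕ.≤ n → ∣ seq y m ℚ.- seq y n ∣ ℚ.≤ δ) →
            ∃[ M ] (∀ m n → M ℕ.≤ m → M ℕ.≤ n →
                    ∣ seq x m ℚ.* seq y m ℚ.- seq x n ℚ.* seq y n ∣ ℚ.≤ ε)
    close (M , close-x) (N , close-y) = (K ℕ.⊔ L) ℕ.⊔ (M ℕ.⊔ N) , λ m n ≤m ≤n →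
      let a = seq x m ; b = seq y m ; c = seq x n ; d = seq y n
          KL≤m = ℕ.m⊔n≤o⇒m≤o (K ℕ.⊔ L) (M ℕ.⊔ N) ≤m
          KL≤n = ℕ.m⊔n≤o⇒m≤o (K ℕ.⊔ L) (M ℕ.⊔ N) ≤n
          MN≤m = ℕ.m⊔n≤o⇒n≤o (K ℕ.⊔ L) (M ℕ.⊔ N) ≤m
          MN≤n = ℕ.m⊔n≤o⇒n≤o (K ℕ.⊔ L) (M ℕ.⊔ N) ≤n
          open ℚ.≤-Reasoning in begin
      ∣ a ℚ.* b ℚ.- c ℚ.* d ∣
        ≡⟨ cong ∣_∣ (diff-* a b c d) ⟩
      ∣ a ℚ.* (b ℚ.- d) ℚ.+ (a ℚ.- c) ℚ.* d ∣
        ≤⟨ ℚ.∣p+q∣≤∣p∣+∣q∣ (a ℚ.* (b ℚ.- d)) ((a ℚ.- c) ℚ.* d) ⟩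
      ∣ a ℚ.* (b ℚ.- d) ∣ ℚ.+ ∣ (a ℚ.- c) ℚ.* d ∣
        ≡⟨ cong₂ ℚ._+_ (ℚ.∣p*q∣≡∣p∣*∣q∣ a (b ℚ.- d)) (ℚ.∣p*q∣≡∣p∣*∣q∣ (a ℚ.- c) d) ⟩
      ∣ a ∣ ℚ.* ∣ b ℚ.- d ∣ ℚ.+ ∣ a ℚ.- c ∣ ℚ.* ∣ d ∣
        ≤⟨ ℚ.+-mono-≤
             (*-mono-≤ (ℚ.<⇒≤ A>0) (ℚ.0≤∣p∣ (b ℚ.- d))
               (∣x∣≤A m (ℕ.m⊔n≤o⇒m≤o K L KL≤m))
               (close-y m n (ℕ.m⊔n≤o⇒n≤o M N MN≤m) (ℕ.m⊔n≤o⇒n≤o M N MN≤n)))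
             (*-mono-≤ (ℚ.<⇒≤ δ>0) (ℚ.0≤∣p∣ d)
               (close-x m n (ℕ.m⊔n≤o⇒m≤o M N MN≤m) (ℕ.m⊔n≤o⇒m≤o M N MN≤n))
               (∣y∣≤B n (ℕ.m⊔n≤o⇒n≤o K L KL≤n))) ⟩
      A ℚ.* δ ℚ.+ δ ℚ.* B
        ≡⟨ total ⟩
      ε ∎

  *-cauchy : ∀ x y ε → 0ℚ ℚ.< ε → ∃[ N ] (∀ m n → N ℕ.≤ m → N ℕ.≤ n →
             ∣ seq x m ℚ.* seq y m ℚ.- seq x n ℚ.* seq y n ∣ ℚ.≤ ε)
  *-cauchy x y ε ε>0 =
    let A , A>0 , K , ∣x∣≤A = eventually-bounded x
        B , B>0 , L , ∣y∣≤B = eventually-bounded y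
        open Product x y A>0 B>0 K L ∣x∣≤A ∣y∣≤B ε ε>0
    in close (cauchy x δ δ>0) (cauchy y δ δ>0)

_*_ : ℝ → ℝ → ℝ
(x * y) .seq n = seq x n ℚ.* seq y n
(x * y) .cauchy = *-cauchy x y

------------------------------------------------------------------------
-- Real matrices

Matrix : ℕ → ℕ → Set
Matrix m n = Fin m → Fin n → ℝ

sum : ∀ {n} → Vector ℝ n → ℝ
sum = foldr _+_ 0ℝ

infixl 6 _⊞_ _⊟_
infixl 7 _·_ _⊗_ _∙ₘ_

_⊞_ _⊟_ : ∀ {m n} → Matrix m n → Matrix m n → Matrix m n
(A ⊞ B) i j = A i j + B i j
(A ⊟ B) i j = A i j - B i j

_·_ : ∀ {m n} → ℝ → Matrix m n → Matrix m n
(c · A) i j = c * A i j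

_∙ₘ_ : ∀ {l m n} → Matrix l m → Matrix m n → Matrix l n
(A ∙ₘ B) i j = sum λ k → A i k * B k j

trace : ∀ {n} → Matrix n n → ℝ
trace A = sum λ i → A i i

Diag : ∀ {n} → Vector ℝ n → Matrix n n
Diag x i j = if does (i Fin.≟ j) then x i else 0ℝ

I J : ∀ n → Matrix n n
I n = Diag λ _ → 1ℝ
J n _ _ = 1ℝ

E : ∀ n → Fin n → Matrix n n
E n k i j = if does (i Fin.≟ k ×-dec j Fin.≟ k) then 1ℝ else 0ℝ

-- The index combine i k : Fin (m * p) stands for the pair (i , k), ordered
-- lexicographically; this is the block order of the Kronecker product, and
-- for vec it makes the column index the slow one.
_⊗_ : ∀ {m n p q} → Matrix m n → Matrix p q → Matrix (m ℕ.* p) (n ℕ.* q)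
_⊗_ {m} {n} {p} {q} A B a b =
  A (quotient p a) (quotient q b) * B (remainder {m} p a) (remainder {n} q b)

vec : ∀ {m n} → Matrix m n → Vector ℝ (n ℕ.* m)
vec {m} {n} M a = M (remainder {n} m a) (quotient m a)

-- M [ f , g ] is the submatrix of M on the rows enumerated by f and the
-- columns enumerated by g.
_[_,_] : ∀ {m n p q} → Matrix m n → (Fin p → Fin m) → (Fin q → Fin n) → Matrix p q
(M [ f , g ]) i j = M (f i) (g j)

Symmetric : ∀ {n} → Matrix n n → Set
Symmetric A = ∀ i j → A i j ≈ A j i

Nonnegative : ∀ {m n} → Matrix m n → Set
Nonnegative A = ∀ i j → 0ℝ ≤ A i j

-- For a symmetric A.
PositiveSemidefinite : ∀ {n} → Matrix n n → Set
PositiveSemidefinite {n} A =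
  ∀ (x : Vector ℝ n) → 0ℝ ≤ sum λ i → sum λ j → x i * A i j * x j

------------------------------------------------------------------------
-- The traveling salesman problem

record TSPInstance (N : ℕ) : Set where
  field
    size        : 3 ℕ.≤ N
    d           : Matrix N N
    symmetric   : Symmetric d
    nonnegative : Nonnegative d
    diagonal    : ∀ i → d i i ≈ 0ℝ
    triangle    : ∀ i j k → d i j ≤ d i k + d k j

open TSPInstance public

-- Vertices are numbered from 0, so the cycle has the edges {i, i+1} and
-- {N-1, 0}.
Next : ∀ {N} → Fin N → Fin N → Set
Next {N} i j = toℕ j ≡ suc (toℕ i) ⊎ (suc (toℕ i) ≡ N × toℕ j ≡ 0)

Adjacent : ∀ {N} → Fin N → Fin N → Set
Adjacent i j = Next i j ⊎ Next j i

next? : ∀ {N} (i j : Fin N) → Dec (Next i j)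
next? {N} i j =
  (toℕ j ℕ.≟ suc (toℕ i)) ⊎-dec ((suc (toℕ i) ℕ.≟ N) ×-dec (toℕ j ℕ.≟ 0))

adjacent? : ∀ {N} (i j : Fin N) → Dec (Adjacent i j)
adjacent? i j = next? i j ⊎-dec next? j i

C₁ : ∀ N → Matrix N N
C₁ N i j = if does (adjacent? i j) then 1ℝ else 0ℝ

------------------------------------------------------------------------
-- SDP₂ for an instance on suc n vertices. punchIn r enumerates the
-- complement of {r} in increasing order, and λ (_ : Fin 1) → r
-- enumerates {r}.

module SDP₂ {n : ℕ} (r s : Fin (suc n)) (D : Matrix (suc n) (suc n)) where

  α β : Fin n → Fin (suc n)
  α = punchIn r
  β = punchIn s

  ⟨r⟩ ⟨s⟩ : Fin 1 → Fin (suc n)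
  ⟨r⟩ _ = r
  ⟨s⟩ _ = s

  c̄ : Vector ℝ (n ℕ.* n)
  c̄ = vec (C₁ (suc n) [ α , ⟨r⟩ ] ∙ₘ D [ ⟨s⟩ , β ])

  cost : Matrix (n ℕ.* n) (n ℕ.* n)
  cost = (D [ β , β ]) ⊗ (fromℚ ½ · (C₁ (suc n) [ α , α ])) ⊞ Diag c̄

  objective : Matrix (n ℕ.* n) (n ℕ.* n) → ℝ
  objective Y = trace (cost ∙ₘ Y)

  record Feasible (Y : Matrix (n ℕ.* n) (n ℕ.* n)) : Set where
    field
      symm : Symmetric Y
      nonneg : Nonnegative Y
      psd : PositiveSemidefinite Y
      I⊗E : ∀ j → trace ((I n ⊗ E n j) ∙ₘ Y) ≈ 1ℝ
      E⊗I : ∀ j → trace ((E n j ⊗ I n) ∙ₘ Y) ≈ 1ℝ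
      off-diagonal : trace ((I n ⊗ (J n ⊟ I n) ⊞ (J n ⊟ I n) ⊗ I n) ∙ₘ Y) ≈ 0ℝ
      J⊗J : trace ((J n ⊗ J n) ∙ₘ Y) ≈ fromℚ (+ (n ℕ.* n) ℚ./ 1)

  -- v is the minimum (attained) of the semidefinite program.
  IsOPT : ℝ → Set
  IsOPT v = (∃[ Y ] Feasible Y × objective Y ≈ v)
          × (∀ Y → Feasible Y → v ≤ objective Y)

{-# OPTIONS --safe #-}
module Submission where

-- For a feasible Y, positive semidefiniteness and the trace constraints
-- force the sums of Y over the blocks of a vertex, and over those of a
-- position, to agree.  Hence, for an instance in which d is the cut metric of
-- a cluster A that does not contain s, summing Y over the vertices in A gives a
-- matrix X over positions that behaves like the matrix of second moments of the
-- indicator of the positions of A: it is positive semidefinite, satisfies the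
-- Boole inequalities, has row sums |A| X p p and trace |A|, and the objective
-- is 2|A| - ⟨C , X⟩, where C is the adjacency matrix of the path that remains
-- of the cycle after the removal of r.
--
-- For three vertices C + I = J, so the objective is constantly 2.  For a
-- cluster of three and one of four vertices the relaxation attains 7/4: an
-- integral matrix divided by 144 has this value, and a dual certificate with
-- integral multipliers shows that no value is smaller.

import Algebra.Consequences.Setoid as Consequences
open import Algebra.Bundles using (CommutativeRing)
import Algebra.Properties.Monoid.Sum
import Algebra.Properties.Ring
import Algebra.Properties.Semiring.Sum
import Algebra.Solver.Ring.NaturalCoefficients.Default
open import Data.Bool.Base using (Bool; if_then_else_; true; false; not; _xor_)
import Data.Bool.Properties as Bool
open import Data.Fin.Base as Fin
  using (Fin; zero; suc; toℕ; punchIn; combine; quotient; remainder; _↑ˡ_; _↑ʳ_)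
open import Data.Fin.Patterns
import Data.Fin.Properties as Fin
open import Data.Integer.Base as ℤ using (ℤ; +_; -[1+_]; 0ℤ; 1ℤ)
import Data.Integer.Properties as ℤ
open import Data.List.Base using (List; []; _∷_; _++_; map; concatMap)
open import Data.Nat.Base as ℕ using (ℕ; zero; suc)
open import Data.Nat.DivMod using (_mod_)
import Data.Nat.Properties as ℕ
open import Data.Product.Base using (Σ-syntax; ∃-syntax; _×_; _,_; map₂; proj₁; proj₂)
open import Data.Rational.Base as ℚ using (ℚ; 0ℚ; 1ℚ; ½; ∣_∣; 1/_)
import Data.Rational.Properties as ℚ
open import Data.Rational.Solver using (module +-*-Solver)
import Data.Rational.Unnormalised.Base as ℚᵘ
import Data.Rational.Unnormalised.Properties as ℚᵘ
open import Data.Sum.Base using (_⊎_; inj₁; inj₂; [_,_]′)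
open import Data.Vec.Base using (Vec; lookup; []; _∷_)
open import Data.Vec.Functional using (Vector; insertAt)
open import Data.Vec.Functional.Properties using (insertAt-lookup; insertAt-punchIn)
open import Function.Base using (_∘_)
open import Function.Definitions using (Injective)
open import Level using (0ℓ)
open import Relation.Binary.Bundles using (Setoid)
open import Relation.Binary.PropositionalEquality as ≡ using (_≡_; _≢_)
import Relation.Binary.Reasoning.Setoid
open import Relation.Binary.Structures using (IsEquivalence)
open import Relation.Nullary.Decidable
  using (does; yes; no; dec-true; dec-false; toWitness; ¬?; _×-dec_; _→-dec_)

open Algebra.Properties.Monoid.Sum ℤ.+-0-monoid using () renaming (sum to sumℤ)
open Algebra.Properties.Semiring.Sum ℤ.+-*-semiring using () renaming
  (*-distribˡ-sum to ℤ-*-distribˡ-sum)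

-- A tour crosses a cut at least twice, so 2 is the optimal tour length of both instances: the
-- relaxation is exact on three vertices and loses 1/4 on seven. The choices of `r` and `s` are
-- parameters, so both values have to be established for every choice. A change of `r` only rotates
-- the path of positions; one optimal matrix and one certificate, written in path order, are carried
-- to every `r` by `pathIndex`. As for `s`, a cut metric does not change when its two sides are
-- swapped, so the cluster can be taken away from `s`: the seven-vertex instance is built around
-- `s`, and on three vertices the cluster has one or two elements depending on `s`. Since `IsOPT`
-- asks for an attained minimum, the matrix of value 7/4 is accompanied by a matching lower bound.
-- Order and equality of Cauchy reals are not decidable, so the tables are integral and are checked
-- by evaluation; real numbers enter through the laws of an ordered ring.

ℤ-nonneg-* : ∀ {a b} → 0ℤ ℤ.≤ a → 0ℤ ℤ.≤ b → 0ℤ ℤ.≤ a ℤ.* b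
ℤ-nonneg-* {+ m} {+ n} _ _ = ≡.subst (0ℤ ℤ.≤_) (ℤ.pos-* m n) (ℤ.+≤+ ℕ.z≤n)

-- Integral matrices and sums of squares

diag : ∀ {n} → (Fin n → ℤ) → Fin n → Fin n → ℤ
diag d i j = if does (i Fin.≟ j) then d i else 0ℤ

rowSums : ∀ {n} → (Fin n → Fin n → ℤ) → Fin n → Fin n → ℤ
rowSums Λ = diag λ p → sumℤ (Λ p)

sumOfSquares : {A : Set} → List (ℕ × (A → ℤ)) → A → A → ℤ
sumOfSquares []            v w = 0ℤ
sumOfSquares ((c , u) ∷ L) v w = + c ℤ.* (u v ℤ.* u w) ℤ.+ sumOfSquares L v w

sumOfSquares-sym : {A : Set} (L : List (ℕ × (A → ℤ))) → ∀ v w →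
                   sumOfSquares L v w ≡ sumOfSquares L w v
sumOfSquares-sym []            v w = ≡.refl
sumOfSquares-sym ((c , u) ∷ L) v w =
  ≡.cong₂ ℤ._+_ (≡.cong (+ c ℤ.*_) (ℤ.*-comm (u v) (u w))) (sumOfSquares-sym L v w)

⟦_⟧ : Bool → ℤ
⟦ b ⟧ = if b then 1ℤ else 0ℤ

⟦⟧-nonneg : ∀ b → 0ℤ ℤ.≤ ⟦ b ⟧
⟦⟧-nonneg true  = ℤ.+≤+ ℕ.z≤n
⟦⟧-nonneg false = ℤ.+≤+ ℕ.z≤n

⟦⟧-idem : ∀ b → ⟦ b ⟧ ℤ.* ⟦ b ⟧ ≡ ⟦ b ⟧
⟦⟧-idem true  = ≡.refl
⟦⟧-idem false = ≡.refl

⟦⟧-not : ∀ b → ⟦ b ⟧ ℤ.+ ⟦ not b ⟧ ≡ 1ℤ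
⟦⟧-not true  = ≡.refl
⟦⟧-not false = ≡.refl

-- Linear algebra over an ordered commutative ring

record OrderedRing : Set₁ where
  infix 4 _≼_
  field
    commutativeRing : CommutativeRing 0ℓ 0ℓ
  open CommutativeRing commutativeRing public
  field
    _≼_         : Carrier → Carrier → Set
    ≼-reflexive : ∀ {x y} → x ≈ y → x ≼ y
    ≼-trans     : ∀ {x y z} → x ≼ y → y ≼ z → x ≼ z
    ≼-antisym   : ∀ {x y} → x ≼ y → y ≼ x → x ≈ y
    +-mono-≼    : ∀ {x y u v} → x ≼ y → u ≼ v → x + u ≼ y + v
    nonneg-²    : ∀ x → 0# ≼ x * x
    -- The Archimedean property, in the form in which it is applied to the values
    -- of a quadratic form on a line.
    vanishing   : ∀ {x c} → (∀ t → 0# ≼ t * (x + x) + c) → x ≈ 0#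
    fromℤ       : ℤ → Carrier
    fromℤ-1     : fromℤ 1ℤ ≈ 1#
    fromℤ-0     : fromℤ 0ℤ ≈ 0#
    fromℤ-+     : ∀ a b → fromℤ (a ℤ.+ b) ≈ fromℤ a + fromℤ b
    fromℤ-*     : ∀ a b → fromℤ (a ℤ.* b) ≈ fromℤ a * fromℤ b
    fromℤ-≼     : ∀ {a b} → a ℤ.≤ b → fromℤ a ≼ fromℤ b

-- What makes `Z` divided by `K` feasible, in a form that evaluation over finite index sets can
-- check; for positive semidefiniteness this takes an explicit list of squares.
record IntegralWitness (n : ℕ) (K : ℤ) (Z : (v w : Fin n × Fin n) → ℤ) : Set where
  field
    squares       : List (ℕ × (Fin n × Fin n → ℤ))
    sos           : ∀ v w → Z v w ≡ sumOfSquares squares v w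
    nonneg        : ∀ v w → 0ℤ ℤ.≤ Z v w
    vertex        : ∀ p → sumℤ (λ i → Z (i , p) (i , p)) ≡ K
    position      : ∀ i → sumℤ (λ p → Z (i , p) (i , p)) ≡ K
    same-vertex   : ∀ i p q → p ≢ q → Z (i , p) (i , q) ≡ 0ℤ
    same-position : ∀ i j p → i ≢ j → Z (i , p) (j , p) ≡ 0ℤ
    total         : (sumℤ λ i → sumℤ λ j → sumℤ λ p → sumℤ λ q → Z (i , p) (j , q))
      ≡ + (n ℕ.* n) ℤ.* K

module Theory (𝓡 : OrderedRing) where

  open OrderedRing 𝓡 hiding (zero)
  open Algebra.Properties.Semiring.Sum semiring
  open Algebra.Properties.Ring ring using (-1*x≈-x; -0#≈0#; -‿involutive)
  open Relation.Binary.Reasoning.Setoid setoid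
  open Algebra.Solver.Ring.NaturalCoefficients.Default commutativeSemiring
    using (solve; _:+_; _:*_; _:=_)

  ≼-refl : ∀ {x} → x ≼ x
  ≼-refl = ≼-reflexive refl

  ≼-respʳ : ∀ {x y z} → y ≈ z → x ≼ y → x ≼ z
  ≼-respʳ y≈z x≼y = ≼-trans x≼y (≼-reflexive y≈z)

  ≼-respˡ : ∀ {x y z} → x ≈ y → x ≼ z → y ≼ z
  ≼-respˡ x≈y x≼z = ≼-trans (≼-reflexive (sym x≈y)) x≼z

  nonneg-+ : ∀ {x y} → 0# ≼ x → 0# ≼ y → 0# ≼ x + y
  nonneg-+ x≽0 y≽0 = ≼-respˡ (+-identityˡ 0#) (+-mono-≼ x≽0 y≽0)

  +-cancelʳ-0 : ∀ {x} y → x + y ≈ y → x ≈ 0#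
  +-cancelʳ-0 {x} y eq = begin
    x               ≈⟨ +-identityʳ x ⟨
    x + 0#          ≈⟨ +-congˡ (-‿inverseʳ y) ⟨
    x + (y + - y)   ≈⟨ +-assoc x y (- y) ⟨
    x + y + - y     ≈⟨ +-congʳ eq ⟩
    y + - y         ≈⟨ -‿inverseʳ y ⟩
    0#              ∎

  sum-cong : ∀ {n} {f g : Fin n → Carrier} → (∀ i → f i ≈ g i) → sum f ≈ sum g
  sum-cong = sum-cong-≋

  sum-0 : ∀ {n} {f : Fin n → Carrier} → (∀ i → f i ≈ 0#) → sum f ≈ 0#
  sum-0 {n} f≈0 = trans (sum-cong f≈0) (sum-replicate-zero n)

  nonneg-sum : ∀ {n} {f : Fin n → Carrier} → (∀ i → 0# ≼ f i) → 0# ≼ sum f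
  nonneg-sum {zero}  f≽0 = ≼-refl
  nonneg-sum {suc n} f≽0 = nonneg-+ (f≽0 zero) (nonneg-sum (f≽0 ∘ suc))

  term≼sum : ∀ {n} {f : Fin n → Carrier} → (∀ i → 0# ≼ f i) → ∀ i → f i ≼ sum f
  term≼sum {f = f} f≽0 zero    = ≼-respˡ (+-identityʳ (f zero))
    (+-mono-≼ ≼-refl (nonneg-sum (f≽0 ∘ suc)))
  term≼sum {f = f} f≽0 (suc i) = ≼-respˡ (+-identityˡ (f (suc i)))
    (+-mono-≼ (f≽0 zero) (term≼sum (f≽0 ∘ suc) i))

  nonneg-sum-0 : ∀ {n} {f : Fin n → Carrier} → (∀ i → 0# ≼ f i) → sum f ≈ 0# → ∀ i → f i ≈ 0#
  nonneg-sum-0 f≽0 Σf≈0 i = ≼-antisym (≼-respʳ Σf≈0 (term≼sum f≽0 i)) (f≽0 i)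

  sum-↑ : ∀ m {n} (f : Fin (m ℕ.+ n) → Carrier) →
          sum f ≈ sum (λ i → f (i ↑ˡ n)) + sum (λ j → f (m ↑ʳ j))
  sum-↑ zero    f = sym (+-identityˡ (sum f))
  sum-↑ (suc m) f = trans (+-congˡ (sum-↑ m (f ∘ suc))) (sym (+-assoc _ _ _))

  sum-combine : ∀ m {n} (f : Fin (m ℕ.* n) → Carrier) →
                sum f ≈ sum {m} λ i → sum {n} λ p → f (combine i p)
  sum-combine zero        f = refl
  sum-combine (suc m) {n} f = trans (sum-↑ n f) (+-congˡ (sum-combine m λ a → f (n ↑ʳ a)))

  module _ {m n : ℕ} where

    ∑∑-+ : (f g : Fin m → Fin n → Carrier) →
           sum (λ i → sum λ j → f i j + g i j) ≈ sum (λ i → sum (f i)) + sum (λ i → sum (g i))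
    ∑∑-+ f g = trans (sum-cong λ i → ∑-distrib-+ (f i) (g i))
                     (∑-distrib-+ (λ i → sum (f i)) (λ i → sum (g i)))

    ∑∑-* : (c : Carrier) (f : Fin m → Fin n → Carrier) →
           c * sum (λ i → sum (f i)) ≈ sum λ i → sum λ j → c * f i j
    ∑∑-* c f = trans (*-distribˡ-sum c (λ i → sum (f i))) (sum-cong λ i → *-distribˡ-sum c (f i))

  δ : ∀ {n} → Fin n → Fin n → Carrier
  δ i j = if does (i Fin.≟ j) then 1# else 0#

  δ-refl : ∀ {n} (i : Fin n) → δ i i ≈ 1#
  δ-refl i rewrite dec-true (i Fin.≟ i) ≡.refl = refl

  δ-≢ : ∀ {n} {i j : Fin n} → i ≢ j → δ i j ≈ 0#
  δ-≢ {i = i} {j} i≢j rewrite dec-false (i Fin.≟ j) i≢j = refl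

  δ-suc : ∀ {n} (i j : Fin n) → δ (suc i) (suc j) ≈ δ i j
  δ-suc i j with i Fin.≟ j
  ... | yes _ = refl
  ... | no  _ = refl

  sum-δ : ∀ {n} (i : Fin n) (f : Fin n → Carrier) → sum (λ j → δ i j * f j) ≈ f i
  sum-δ zero    f = begin
    1# * f zero + sum (λ j → 0# * f (suc j))
      ≈⟨ +-cong (*-identityˡ _) (sum-0 (λ j → zeroˡ (f (suc j)))) ⟩
    f zero + 0#                               ≈⟨ +-identityʳ _ ⟩
    f zero                                    ∎
  sum-δ (suc i) f = begin
    0# * f zero + sum (λ j → δ (suc i) (suc j) * f (suc j))
      ≈⟨ +-cong (zeroˡ _) (sum-cong (λ j → *-congʳ (δ-suc i j))) ⟩
    0# + sum (λ j → δ i j * f (suc j))                       ≈⟨ +-identityˡ _ ⟩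
    sum (λ j → δ i j * f (suc j))                            ≈⟨ sum-δ i (f ∘ suc) ⟩
    f (suc i)                                                ∎

  δ-sym : ∀ {n} (i j : Fin n) → δ i j ≈ δ j i
  δ-sym i j with i Fin.≟ j
  ... | yes ≡.refl = sym (δ-refl i)
  ... | no  i≢j    = sym (δ-≢ (i≢j ∘ ≡.sym))

  -- Positive semidefinite bilinear forms

  module Form {m} (A : Fin m → Fin m → Carrier) (A-sym : ∀ a b → A a b ≈ A b a) where

    B : (Fin m → Carrier) → (Fin m → Carrier) → Carrier
    B u v = sum λ a → sum λ b → u a * A a b * v b

    B-sym : ∀ u v → B u v ≈ B v u
    B-sym u v = trans (∑-comm (λ a b → u a * A a b * v b))
      (sum-cong λ b → sum-cong λ a → trans (*-congʳ (*-congˡ (A-sym a b)))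
        (solve 3 (λ x y z → x :* y :* z := z :* y :* x) refl (u a) (A b a) (v b)))

    B-+ˡ : ∀ u u′ v → B (λ a → u a + u′ a) v ≈ B u v + B u′ v
    B-+ˡ u u′ v = trans
      (sum-cong λ a → trans
        (sum-cong λ b → solve 4 (λ x x′ y z → (x :+ x′) :* y :* z := x :* y :* z :+ x′ :* y :* z)
          refl
                          (u a) (u′ a) (A a b) (v b))
        (∑-distrib-+ (λ b → u a * A a b * v b) (λ b → u′ a * A a b * v b)))
      (∑-distrib-+ (λ a → sum λ b → u a * A a b * v b) (λ a → sum λ b → u′ a * A a b * v b))

    B-*ˡ : ∀ t u v → B (λ a → t * u a) v ≈ t * B u v
    B-*ˡ t u v = sym (trans (*-distribˡ-sum t (λ a → sum λ b → u a * A a b * v b))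
      (sum-cong λ a → trans (*-distribˡ-sum t (λ b → u a * A a b * v b))
        (sum-cong λ b → solve 4 (λ t x y z → t :* (x :* y :* z) := t :* x :* y :* z) refl
                          t (u a) (A a b) (v b))))

    B-linearˡ : ∀ t u v w → B (λ a → t * u a + v a) w ≈ t * B u w + B v w
    B-linearˡ t u v w = trans (B-+ˡ (λ a → t * u a) v w) (+-congʳ (B-*ˡ t u w))

    B-linearʳ : ∀ t u v w → B w (λ a → t * u a + v a) ≈ t * B w u + B w v
    B-linearʳ t u v w = begin
      B w (λ a → t * u a + v a)    ≈⟨ B-sym w (λ a → t * u a + v a) ⟩
      B (λ a → t * u a + v a) w    ≈⟨ B-linearˡ t u v w ⟩
      t * B u w + B v w            ≈⟨ +-cong (*-congˡ (B-sym u w)) (B-sym v w) ⟩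
      t * B w u + B w v            ∎

    B-square : ∀ t u v → B (λ a → t * u a + v a) (λ a → t * u a + v a) ≈
               t * t * B u u + (t * (B u v + B u v) + B v v)
    B-square t u v = begin
      B (λ a → t * u a + v a) (λ a → t * u a + v a)
        ≈⟨ B-linearˡ t u v (λ a → t * u a + v a) ⟩
      t * B u (λ a → t * u a + v a) + B v (λ a → t * u a + v a)
        ≈⟨ +-cong (*-congˡ (B-linearʳ t u v u))
          (trans (B-linearʳ t u v v) (+-congʳ (*-congˡ (B-sym v u)))) ⟩
      t * (t * B u u + B u v) + (t * B u v + B v v)
        ≈⟨ solve 4 (λ t x y z → t :* (t :* x :+ y) :+ (t :* y :+ z) := t :* t :* x :+
          (t :* (y :+ y) :+ z)) refl
             t (B u u) (B u v) (B v v) ⟩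
      t * t * B u u + (t * (B u v + B u v) + B v v)
        ∎

    module _ (A-psd : ∀ u → 0# ≼ B u u) where

      -- On the line `t w + v` the quadratic term vanishes, so the form is affine in `t`; an affine
      -- function that is nonnegative for every `t` has slope 0.
      null⇒orthogonal : ∀ w → B w w ≈ 0# → ∀ v → B w v ≈ 0#
      null⇒orthogonal w Bww≈0 v = vanishing {B w v} {B v v} λ t →
        ≼-respʳ (begin
          B (λ a → t * w a + v a) (λ a → t * w a + v a)    ≈⟨ B-square t w v ⟩
          t * t * B w w + (t * (B w v + B w v) + B v v)
            ≈⟨ +-congʳ (trans (*-congˡ Bww≈0) (zeroʳ (t * t))) ⟩
          0# + (t * (B w v + B w v) + B v v)               ≈⟨ +-identityˡ _ ⟩
          t * (B w v + B w v) + B v v                      ∎)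
        (A-psd (λ a → t * w a + v a))

      -- Vectors of norm 1 whose sum has the largest possible norm are equal.
      unit-family : ∀ {n} (w : Fin n → Fin m → Carrier) →
        (∀ i → B (w i) (w i) ≈ 1#) →
        sum (λ i → sum λ j → B (w i) (w j)) ≈ sum {n} (λ _ → sum {n} λ _ → 1#) →
        ∀ i j v → B (w i) v ≈ B (w j) v
      unit-family {n} w unit total i j v = begin
        B (w i) v                              ≈⟨ +-identityˡ _ ⟨
        0# + B (w i) v                         ≈⟨ +-congʳ (-‿inverseʳ (B (w j) v)) ⟨
        B (w j) v + - B (w j) v + B (w i) v    ≈⟨ +-assoc _ _ _ ⟩
        B (w j) v + (- B (w j) v + B (w i) v)
          ≈⟨ +-congˡ (trans (+-congʳ (sym (-1*x≈-x _))) (sym (B-linearˡ (- 1#) (w j) (w i) v))) ⟩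
        B (w j) v + B (diff j i) v
          ≈⟨ +-congˡ (null⇒orthogonal (diff j i) (null j i) v) ⟩
        B (w j) v + 0#                         ≈⟨ +-identityʳ _ ⟩
        B (w j) v                              ∎
        where
        diff : Fin n → Fin n → Fin m → Carrier
        diff i j a = - 1# * w i a + w j a

        S : Fin n → Fin n → Carrier
        S i j = B (diff i j) (diff i j)

        S-expand : ∀ i j → S i j + (B (w i) (w j) + B (w i) (w j)) ≈ 1# + 1#
        S-expand i j = begin
          S i j + (T + T)
            ≈⟨ +-congʳ (B-square (- 1#) (w i) (w j)) ⟩
          - 1# * - 1# * B (w i) (w i) + (- 1# * (T + T) + B (w j) (w j)) + (T + T)
            ≈⟨ +-congʳ (+-cong (trans (*-cong (trans (-1*x≈-x (- 1#)) (-‿involutive 1#)) (unit i))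
              (*-identityˡ 1#))
                               (+-cong (-1*x≈-x (T + T)) (unit j))) ⟩
          1# + (- (T + T) + 1#) + (T + T)
            ≈⟨ solve 3 (λ o x y → o :+ (x :+ o) :+ y := o :+ o :+ (x :+ y)) refl 1# (- (T + T))
              (T + T) ⟩
          1# + 1# + (- (T + T) + (T + T))                        ≈⟨ +-congˡ (-‿inverseˡ (T + T)) ⟩
          1# + 1# + 0#                                           ≈⟨ +-identityʳ _ ⟩
          1# + 1#                                                ∎
          where
          T = B (w i) (w j)

        ones : Carrier
        ones = sum {n} λ _ → sum {n} λ _ → 1#

        -- By `S-expand` the squared distance of `w i` and `w j` is 2 - 2 `B (w i) (w j)`. Summed
        -- over all pairs this is 0 by `total`, and a sum of nonnegative terms vanishes only
        -- termwise.
        S-total : sum (λ i → sum (S i)) ≈ 0#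
        S-total = +-cancelʳ-0 (ones + ones) (begin
          sum (λ i → sum (S i)) + (ones + ones)
            ≈⟨ +-congˡ (trans (∑∑-+ T T) (+-cong total total)) ⟨
          sum (λ i → sum (S i)) + sum (λ i → sum λ j → T i j + T i j)
            ≈⟨ ∑∑-+ S (λ i j → T i j + T i j) ⟨
          sum (λ i → sum λ j → S i j + (T i j + T i j))
            ≈⟨ sum-cong (λ i → sum-cong (S-expand i)) ⟩
          sum {n} (λ i → sum {n} λ j → 1# + 1#)
            ≈⟨ ∑∑-+ {n} {n} (λ _ _ → 1#) (λ _ _ → 1#) ⟩
          ones + ones
            ∎)
          where
          T : Fin n → Fin n → Carrier
          T i j = B (w i) (w j)

        null : ∀ i j → S i j ≈ 0#
        null i = nonneg-sum-0 (λ j → A-psd (diff i j))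
          (nonneg-sum-0 (λ i → nonneg-sum λ j → A-psd (diff i j)) S-total i)

      -- The sums over two blocks of a partition of the indices agree, once
      -- each block sums to 1 and the whole matrix to the number of pairs of blocks.
      block-sums : ∀ {n k} (e : Fin n → Fin k → Fin m) (ind : Fin n → Fin m → Carrier) →
        (∀ i f → sum (λ a → ind i a * f a) ≈ sum λ k → f (e i k)) →
        (∀ i → sum (λ k → sum λ l → A (e i k) (e i l)) ≈ 1#) →
        sum (λ i → sum λ j → sum λ k → sum λ l → A (e i k) (e j l))
          ≈ sum {n} (λ _ → sum {n} λ _ → 1#) →
        ∀ i j c → sum (λ k → A (e i k) c) ≈ sum λ k → A (e j k) c
      block-sums {n} e ind select block total i j c = begin
        sum (λ k → A (e i k) c)    ≈⟨ column i ⟨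
        -- The indicators of two blocks are different vectors, but they agree modulo the kernel of
        -- the form; pairing them with `δ c` reads off the column `c`.
        B (ind i) (δ c)            ≈⟨ unit-family ind (λ i → trans (blocks i i) (block i))
                                        (trans (sum-cong λ i → sum-cong λ j → blocks i j) total) i
                                          j (δ c) ⟩
        B (ind j) (δ c)            ≈⟨ column j ⟩
        sum (λ k → A (e j k) c)    ∎
        where
        B-ind : ∀ i v → B (ind i) v ≈ sum λ k → sum λ b → A (e i k) b * v b
        B-ind i v = trans
          (sum-cong λ a → trans (sum-cong λ b → *-assoc (ind i a) (A a b) (v b))
                                (sym (*-distribˡ-sum (ind i a) (λ b → A a b * v b))))
          (select i (λ a → sum λ b → A a b * v b))

        column : ∀ i → B (ind i) (δ c) ≈ sum λ k → A (e i k) c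
        column i = trans (B-ind i (δ c)) (sum-cong λ k →
          trans (sum-cong λ b → *-comm (A (e i k) b) (δ c b)) (sum-δ c (A (e i k))))

        blocks : ∀ i j → B (ind i) (ind j) ≈ sum λ k → sum λ l → A (e i k) (e j l)
        blocks i j = trans (B-ind i (ind j)) (sum-cong λ k →
          trans (sum-cong λ b → *-comm (A (e i k) b) (ind j b)) (select j (A (e i k))))

  -- Pairing integral matrices with matrices over the ring

  fromℤ-∑ : ∀ {n} (f : Fin n → ℤ) → fromℤ (sumℤ f) ≈ sum λ i → fromℤ (f i)
  fromℤ-∑ {zero}  f = fromℤ-0
  fromℤ-∑ {suc n} f = trans (fromℤ-+ (f zero) (sumℤ (f ∘ suc))) (+-congˡ (fromℤ-∑ (f ∘ suc)))

  -- The order is compatible with addition, so multiplication by a natural number is treated as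
  -- repeated addition.
  nonneg-scale : ∀ {c x} → 0ℤ ℤ.≤ c → 0# ≼ x → 0# ≼ fromℤ c * x
  nonneg-scale {+ zero}  {x} _   x≽0 = ≼-respʳ (sym (trans (*-congʳ fromℤ-0) (zeroˡ x))) ≼-refl
  nonneg-scale {+ suc c} {x} _   x≽0 = ≼-respʳ (begin
    x + fromℤ (+ c) * x
      ≈⟨ +-congʳ (trans (sym (*-identityˡ x)) (*-congʳ (sym fromℤ-1))) ⟩
    fromℤ 1ℤ * x + fromℤ (+ c) * x   ≈⟨ distribʳ x (fromℤ 1ℤ) (fromℤ (+ c)) ⟨
    (fromℤ 1ℤ + fromℤ (+ c)) * x     ≈⟨ *-congʳ (fromℤ-+ 1ℤ (+ c)) ⟨
    fromℤ (+ suc c) * x              ∎)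
    (nonneg-+ x≽0 (nonneg-scale {+ c} (ℤ.+≤+ ℕ.z≤n) x≽0))

  -- The coefficients stay in ℤ, where identities between them can be decided by evaluation.
  ⟪_,_⟫ : ∀ {m n} → (Fin m → Fin n → ℤ) → (Fin m → Fin n → Carrier) → Carrier
  ⟪ M , X ⟫ = sum λ i → sum λ j → fromℤ (M i j) * X i j

  module _ {m n : ℕ} where

    ⟪⟫-cong : {M M′ : Fin m → Fin n → ℤ} {X X′ : Fin m → Fin n → Carrier} →
              (∀ i j → M i j ≡ M′ i j) → (∀ i j → X i j ≈ X′ i j) → ⟪ M , X ⟫ ≈ ⟪ M′ , X′ ⟫
    ⟪⟫-cong M≡ X≈ = sum-cong λ i → sum-cong λ j →
      *-cong (reflexive (≡.cong fromℤ (M≡ i j))) (X≈ i j)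

    ⟪⟫-+ˡ : (M M′ : Fin m → Fin n → ℤ) (X : Fin m → Fin n → Carrier) →
            ⟪ (λ i j → M i j ℤ.+ M′ i j) , X ⟫ ≈ ⟪ M , X ⟫ + ⟪ M′ , X ⟫
    ⟪⟫-+ˡ M M′ X = trans
      (sum-cong λ i → sum-cong λ j →
        trans (*-congʳ (fromℤ-+ (M i j) (M′ i j)))
          (distribʳ (X i j) (fromℤ (M i j)) (fromℤ (M′ i j))))
      (∑∑-+ (λ i j → fromℤ (M i j) * X i j) (λ i j → fromℤ (M′ i j) * X i j))

    ⟪⟫-+ʳ : (M : Fin m → Fin n → ℤ) (X X′ : Fin m → Fin n → Carrier) →
            ⟪ M , (λ i j → X i j + X′ i j) ⟫ ≈ ⟪ M , X ⟫ + ⟪ M , X′ ⟫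
    ⟪⟫-+ʳ M X X′ = trans
      (sum-cong λ i → sum-cong λ j → distribˡ (fromℤ (M i j)) (X i j) (X′ i j))
      (∑∑-+ (λ i j → fromℤ (M i j) * X i j) (λ i j → fromℤ (M i j) * X′ i j))

    ⟪⟫-*ˡ : (c : ℤ) (M : Fin m → Fin n → ℤ) (X : Fin m → Fin n → Carrier) →
            ⟪ (λ i j → c ℤ.* M i j) , X ⟫ ≈ fromℤ c * ⟪ M , X ⟫
    ⟪⟫-*ˡ c M X = trans
      (sum-cong λ i → sum-cong λ j →
        trans (*-congʳ (fromℤ-* c (M i j))) (*-assoc (fromℤ c) (fromℤ (M i j)) (X i j)))
      (sym (∑∑-* (fromℤ c) (λ i j → fromℤ (M i j) * X i j)))

    ⟪⟫-transpose : (M : Fin m → Fin n → ℤ) (X : Fin m → Fin n → Carrier) →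
                   ⟪ M , X ⟫ ≈ ⟪ (λ j i → M i j) , (λ j i → X i j) ⟫
    ⟪⟫-transpose M X = ∑-comm (λ i j → fromℤ (M i j) * X i j)

    ⟪⟫-nonneg : (M : Fin m → Fin n → ℤ) (X : Fin m → Fin n → Carrier) →
                (∀ i j → 0ℤ ℤ.≤ M i j) → (∀ i j → 0# ≼ X i j) → 0# ≼ ⟪ M , X ⟫
    ⟪⟫-nonneg M X M≥0 X≽0 = nonneg-sum λ i → nonneg-sum λ j → nonneg-scale (M≥0 i j) (X≽0 i j)

    ⟪⟫-integral : (M Z : Fin m → Fin n → ℤ) (c : Carrier) →
                  ⟪ M , (λ i j → c * fromℤ (Z i j)) ⟫ ≈
                  c * fromℤ (sumℤ λ i → sumℤ λ j → M i j ℤ.* Z i j)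
    ⟪⟫-integral M Z c = begin
      ⟪ M , (λ i j → c * fromℤ (Z i j)) ⟫
        ≈⟨ sum-cong (λ i → sum-cong λ j → trans
             (solve 3 (λ x c z → x :* (c :* z) := c :* (x :* z)) refl (fromℤ (M i j)) c
               (fromℤ (Z i j)))
             (*-congˡ (sym (fromℤ-* (M i j) (Z i j))))) ⟩
      sum (λ i → sum λ j → c * fromℤ (M i j ℤ.* Z i j))
        ≈⟨ ∑∑-* c (λ i j → fromℤ (M i j ℤ.* Z i j)) ⟨
      c * sum (λ i → sum λ j → fromℤ (M i j ℤ.* Z i j))
        ≈⟨ *-congˡ (sum-cong λ i → fromℤ-∑ (λ j → M i j ℤ.* Z i j)) ⟨
      c * sum (λ i → fromℤ (sumℤ λ j → M i j ℤ.* Z i j))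
        ≈⟨ *-congˡ (fromℤ-∑ (λ i → sumℤ λ j → M i j ℤ.* Z i j)) ⟨
      c * fromℤ (sumℤ λ i → sumℤ λ j → M i j ℤ.* Z i j)
        ∎

    ⟪⟫-rows : (M : Fin m → Fin n → ℤ) (x : Fin m → Carrier) →
              ⟪ M , (λ i _ → x i) ⟫ ≈ sum λ i → fromℤ (sumℤ (M i)) * x i
    ⟪⟫-rows M x = sum-cong λ i → sym
      (trans (*-congʳ (fromℤ-∑ (M i))) (*-distribʳ-sum (x i) (λ j → fromℤ (M i j))))

  ⟪⟫-diag : ∀ {n} (d : Fin n → ℤ) (X : Fin n → Fin n → Carrier) →
            ⟪ diag d , X ⟫ ≈ sum λ i → fromℤ (d i) * X i i
  ⟪⟫-diag d X = sum-cong λ i → trans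
    (sum-cong λ j → trans (*-congʳ (entry i j)) (*-assoc (δ i j) (fromℤ (d i)) (X i j)))
    (sum-δ i (λ j → fromℤ (d i) * X i j))
    where
    entry : ∀ i j → fromℤ (diag d i j) ≈ δ i j * fromℤ (d i)
    entry i j with does (i Fin.≟ j)
    ... | true  = sym (*-identityˡ (fromℤ (d i)))
    ... | false = trans fromℤ-0 (sym (zeroˡ (fromℤ (d i))))

  ∑-const : ∀ n c → sum {n} (λ _ → c) ≈ fromℤ (+ n) * c
  ∑-const zero    c = sym (trans (*-congʳ fromℤ-0) (zeroˡ c))
  ∑-const (suc n) c = begin
    c + sum {n} (λ _ → c)
      ≈⟨ +-cong (sym (trans (*-congʳ fromℤ-1) (*-identityˡ c))) (∑-const n c) ⟩
    fromℤ 1ℤ * c + fromℤ (+ n) * c   ≈⟨ distribʳ c (fromℤ 1ℤ) (fromℤ (+ n)) ⟨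
    (fromℤ 1ℤ + fromℤ (+ n)) * c     ≈⟨ *-congʳ (fromℤ-+ 1ℤ (+ n)) ⟨
    fromℤ (+ suc n) * c              ∎

  sum-single : ∀ {n} {f : Fin n → Carrier} i → (∀ j → i ≢ j → f j ≈ 0#) → sum f ≈ f i
  sum-single {f = f} i f≈0 = trans (sum-cong select) (sum-δ i f)
    where
    select : ∀ j → f j ≈ δ i j * f j
    select j with i Fin.≟ j
    ... | yes _  = sym (*-identityˡ (f j))
    ... | no i≢j = trans (f≈0 j i≢j) (sym (zeroˡ (f j)))

  ∑-swap₂ : ∀ {k l m n} (f : Fin k → Fin l → Fin m → Fin n → Carrier) →
    sum (λ a → sum λ b → sum λ c → sum λ d → f a b c d) ≈
    sum (λ c → sum λ d → sum λ a → sum λ b → f a b c d)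
  ∑-swap₂ f = begin
    sum (λ a → sum λ b → sum λ c → sum λ d → f a b c d)
      ≈⟨ sum-cong (λ a → ∑-comm (λ b c → sum λ d → f a b c d)) ⟩
    sum (λ a → sum λ c → sum λ b → sum λ d → f a b c d)
      ≈⟨ ∑-comm (λ a c → sum λ b → sum λ d → f a b c d) ⟩
    sum (λ c → sum λ a → sum λ b → sum λ d → f a b c d)
      ≈⟨ sum-cong (λ c → sum-cong λ a → ∑-comm (λ b d → f a b c d)) ⟩
    sum (λ c → sum λ a → sum λ d → sum λ b → f a b c d)
      ≈⟨ sum-cong (λ c → ∑-comm (λ a d → sum λ b → f a b c d)) ⟩
    sum (λ c → sum λ d → sum λ a → sum λ b → f a b c d)
      ∎

  -- The trace constraints in coordinates

  quotient-combine : ∀ {m n} (i : Fin m) (p : Fin n) → quotient n (combine i p) ≡ i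
  quotient-combine i p = ≡.cong proj₁ (Fin.remQuot-combine i p)

  remainder-combine : ∀ {m n} (i : Fin m) (p : Fin n) → remainder {m} n (combine i p) ≡ p
  remainder-combine i p = ≡.cong proj₂ (Fin.remQuot-combine i p)

  tr : ∀ {m} (M Y : Fin m → Fin m → Carrier) → Carrier
  tr M Y = sum λ a → sum λ b → M a b * Y b a

  kron : ∀ {n} (A B : Fin n → Fin n → Carrier) → Fin (n ℕ.* n) → Fin (n ℕ.* n) → Carrier
  kron {n} A B a b = A (quotient n a) (quotient n b) * B (remainder {n} n a) (remainder {n} n b)

  unit : ∀ {n} → Fin n → Fin n → Fin n → Carrier
  unit k i j = if does (i Fin.≟ k ×-dec j Fin.≟ k) then 1# else 0#

  unit-δ : ∀ {n} (k i j : Fin n) → unit k i j ≈ δ k i * δ k j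
  unit-δ k i j = trans (entry i j) (*-cong (δ-sym i k) (δ-sym j k))
    where
    entry : ∀ i j → unit k i j ≈ δ i k * δ j k
    entry i j with does (i Fin.≟ k) | does (j Fin.≟ k)
    ... | true  | true  = sym (*-identityˡ 1#)
    ... | true  | false = sym (zeroʳ 1#)
    ... | false | _     = sym (zeroˡ _)

  ∑∑-unit : ∀ {n} (k : Fin n) (f : Fin n → Fin n → Carrier) →
            sum (λ i → sum λ j → unit k i j * f i j) ≈ f k k
  ∑∑-unit k f = begin
    sum (λ i → sum λ j → unit k i j * f i j)
      ≈⟨ sum-cong (λ i → sum-cong λ j → trans (*-congʳ (unit-δ k i j))
        (*-assoc (δ k i) (δ k j) (f i j))) ⟩
    sum (λ i → sum λ j → δ k i * (δ k j * f i j))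
      ≈⟨ sum-cong (λ i → sym (*-distribˡ-sum (δ k i) (λ j → δ k j * f i j))) ⟩
    sum (λ i → δ k i * sum λ j → δ k j * f i j)
      ≈⟨ sum-δ k (λ i → sum λ j → δ k j * f i j) ⟩
    sum (λ j → δ k j * f k j)
      ≈⟨ sum-δ k (f k) ⟩
    f k k
      ∎

  off-diagonal : ∀ {n} → Fin (n ℕ.* n) → Fin (n ℕ.* n) → Carrier
  off-diagonal {n} a b =
    kron {n} δ (λ p q → 1# - δ p q) a b + kron {n} (λ i j → 1# - δ i j) δ a b

  record Feasible {n} (Y : Fin (n ℕ.* n) → Fin (n ℕ.* n) → Carrier) : Set where
    field
      symm   : ∀ a b → Y a b ≈ Y b a
      nonneg : ∀ a b → 0# ≼ Y a b
      psd    : ∀ (u : Fin (n ℕ.* n) → Carrier) → 0# ≼ sum λ a → sum λ b → u a * Y a b * u b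
      I⊗E    : ∀ k → tr (kron {n} δ (unit k)) Y ≈ 1#
      E⊗I    : ∀ k → tr (kron {n} (unit k) δ) Y ≈ 1#
      off    : tr (off-diagonal {n}) Y ≈ 0#
      J⊗J    : tr (kron {n} (λ _ _ → 1#) (λ _ _ → 1#)) Y ≈ fromℤ (+ (n ℕ.* n))

  module Traces {n} (Y : Fin (n ℕ.* n) → Fin (n ℕ.* n) → Carrier) (Y-sym : ∀ a b → Y a b ≈ Y b a) where

    pair : Fin n → Fin n → Fin (n ℕ.* n)
    pair = combine

    y : Fin n → Fin n → Fin n → Fin n → Carrier
    y i p j q = Y (pair i p) (pair j q)

    kron-combine : ∀ (A B : Fin n → Fin n → Carrier) i p j q →
                   kron A B (pair i p) (pair j q) ≡ A i j * B p q
    kron-combine A B i p j q = ≡.cong₂ _*_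
      (≡.cong₂ A (quotient-combine i p) (quotient-combine j q))
      (≡.cong₂ B (remainder-combine i p) (remainder-combine j q))

    tr-combine : ∀ (M : Fin (n ℕ.* n) → Fin (n ℕ.* n) → Carrier) →
      tr M Y ≈ sum {n} λ i → sum {n} λ j → sum {n} λ p → sum {n} λ q →
               M (pair i p) (pair j q) * y i p j q
    tr-combine M = begin
      tr M Y
        ≈⟨ sum-combine n (λ a → sum λ b → M a b * Y b a) ⟩
      sum {n} (λ i → sum {n} λ p → sum λ b → M (pair i p) b * Y b (pair i p))
        ≈⟨ sum-cong (λ i → sum-cong λ p → sum-combine n (λ b → M (pair i p) b * Y b (pair i p))) ⟩
      sum {n} (λ i → sum {n} λ p → sum {n} λ j → sum {n} λ q →
        M (pair i p) (pair j q) * Y (pair j q) (pair i p))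
        ≈⟨ sum-cong (λ i → ∑-comm {n} {n}
          (λ p j → sum {n} λ q → M (pair i p) (pair j q) * Y (pair j q) (pair i p))) ⟩
      sum {n} (λ i → sum {n} λ j → sum {n} λ p → sum {n} λ q →
        M (pair i p) (pair j q) * Y (pair j q) (pair i p))
        ≈⟨ sum-cong (λ i → sum-cong λ j → sum-cong λ p → sum-cong λ q →
          *-congˡ (Y-sym (pair j q) (pair i p))) ⟩
      sum {n} (λ i → sum {n} λ j → sum {n} λ p → sum {n} λ q →
        M (pair i p) (pair j q) * y i p j q)
        ∎

    tr-kron : ∀ (A B : Fin n → Fin n → Carrier) →
      tr (kron A B) Y ≈ sum λ i → sum λ j → A i j * sum λ p → sum λ q → B p q * y i p j q
    tr-kron A B = trans (tr-combine (kron A B)) (sum-cong λ i → sum-cong λ j → trans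
      (sum-cong λ p → sum-cong λ q → trans (*-congʳ (reflexive (kron-combine A B i p j q)))
                                           (*-assoc (A i j) (B p q) (y i p j q)))
      (sym (∑∑-* (A i j) (λ p q → B p q * y i p j q))))

    tr-I⊗E : ∀ k → tr (kron δ (unit k)) Y ≈ sum λ i → y i k i k
    tr-I⊗E k = trans (tr-kron δ (unit k)) (sum-cong λ i → trans
      (sum-δ i (λ j → sum λ p → sum λ q → unit k p q * y i p j q))
      (∑∑-unit k (λ p q → y i p i q)))

    tr-E⊗I : ∀ k → tr (kron (unit k) δ) Y ≈ sum λ p → y k p k p
    tr-E⊗I k = trans (tr-kron (unit k) δ) (trans
      (∑∑-unit k (λ i j → sum λ p → sum λ q → δ p q * y i p j q))
      (sum-cong λ p → sum-δ p (λ q → y k p k q)))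

    tr-J⊗J : tr (kron {n} (λ _ _ → 1#) (λ _ _ → 1#)) Y ≈
             sum λ i → sum λ j → sum λ p → sum λ q → y i p j q
    tr-J⊗J = trans (tr-kron (λ _ _ → 1#) (λ _ _ → 1#)) (sum-cong λ i → sum-cong λ j →
      trans (*-identityˡ _) (sum-cong λ p → sum-cong λ q → *-identityˡ (y i p j q)))

    off-diagonal-combine : ∀ i p j q → off-diagonal {n} (pair i p) (pair j q) ≡
                           δ i j * (1# - δ p q) + (1# - δ i j) * δ p q
    off-diagonal-combine i p j q = ≡.cong₂ _+_
      (kron-combine δ (λ p q → 1# - δ p q) i p j q) (kron-combine (λ i j → 1# - δ i j) δ i p j q)

    off-diagonal-1 : ∀ i p j q → i ≡ j × p ≢ q ⊎ i ≢ j × p ≡ q →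
                     off-diagonal {n} (pair i p) (pair j q) ≈ 1#
    off-diagonal-1 i p j q (inj₁ (≡.refl , p≢q)) = begin
      off-diagonal {n} (pair i p) (pair i q)     ≡⟨ off-diagonal-combine i p i q ⟩
      δ i i * (1# - δ p q) + (1# - δ i i) * δ p q
        ≈⟨ +-cong (*-cong (δ-refl i) (+-congˡ (trans (-‿cong (δ-≢ p≢q)) -0#≈0#)))
          (*-congˡ (δ-≢ p≢q)) ⟩
      1# * (1# + 0#) + (1# - δ i i) * 0#
        ≈⟨ +-cong (trans (*-identityˡ _) (+-identityʳ 1#)) (zeroʳ _) ⟩
      1# + 0#                                          ≈⟨ +-identityʳ 1# ⟩
      1#                                               ∎
    off-diagonal-1 i p j q (inj₂ (i≢j , ≡.refl)) = begin
      off-diagonal {n} (pair i p) (pair j p)     ≡⟨ off-diagonal-combine i p j p ⟩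
      δ i j * (1# - δ p p) + (1# - δ i j) * δ p p
        ≈⟨ +-cong (*-congʳ (δ-≢ i≢j)) (*-cong (+-congˡ (trans (-‿cong (δ-≢ i≢j)) -0#≈0#))
          (δ-refl p)) ⟩
      0# * (1# - δ p p) + (1# + 0#) * 1#
        ≈⟨ +-cong (zeroˡ _) (trans (*-identityʳ _) (+-identityʳ 1#)) ⟩
      0# + 1#                                          ≈⟨ +-identityˡ 1# ⟩
      1#                                               ∎

    off-diagonal-0 : ∀ i p j q → i ≡ j × p ≡ q ⊎ i ≢ j × p ≢ q →
                     off-diagonal {n} (pair i p) (pair j q) ≈ 0#
    off-diagonal-0 i p j q (inj₁ (≡.refl , ≡.refl)) = begin
      off-diagonal {n} (pair i p) (pair i p)     ≡⟨ off-diagonal-combine i p i p ⟩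
      δ i i * (1# - δ p p) + (1# - δ i i) * δ p p
        ≈⟨ +-cong (*-congˡ (1-δ p)) (*-congʳ (1-δ i)) ⟩
      δ i i * 0# + 0# * δ p p                          ≈⟨ +-cong (zeroʳ _) (zeroˡ _) ⟩
      0# + 0#                                          ≈⟨ +-identityʳ 0# ⟩
      0#                                               ∎
      where
      1-δ : ∀ (i : Fin n) → 1# - δ i i ≈ 0#
      1-δ i = trans (+-congˡ (-‿cong (δ-refl i))) (-‿inverseʳ 1#)
    off-diagonal-0 i p j q (inj₂ (i≢j , p≢q)) = begin
      off-diagonal {n} (pair i p) (pair j q)     ≡⟨ off-diagonal-combine i p j q ⟩
      δ i j * (1# - δ p q) + (1# - δ i j) * δ p q
        ≈⟨ +-cong (*-congʳ (δ-≢ i≢j)) (*-congˡ (δ-≢ p≢q)) ⟩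
      0# * (1# - δ p q) + (1# - δ i j) * 0#            ≈⟨ +-cong (zeroˡ _) (zeroʳ _) ⟩
      0# + 0#                                          ≈⟨ +-identityʳ 0# ⟩
      0#                                               ∎

    off-diagonal-cases : ∀ i p j q → off-diagonal {n} (pair i p) (pair j q) ≈ 0# ⊎
                                     off-diagonal {n} (pair i p) (pair j q) ≈ 1#
    off-diagonal-cases i p j q with i Fin.≟ j | p Fin.≟ q
    ... | yes i≡j | yes p≡q = inj₁ (off-diagonal-0 i p j q (inj₁ (i≡j , p≡q)))
    ... | yes i≡j | no  p≢q = inj₂ (off-diagonal-1 i p j q (inj₁ (i≡j , p≢q)))
    ... | no  i≢j | yes p≡q = inj₂ (off-diagonal-1 i p j q (inj₂ (i≢j , p≡q)))
    ... | no  i≢j | no  p≢q = inj₁ (off-diagonal-0 i p j q (inj₂ (i≢j , p≢q)))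

    tr-off-0 : (∀ i p q → p ≢ q → y i p i q ≈ 0#) → (∀ i j p → i ≢ j → y i p j p ≈ 0#) →
               tr (off-diagonal {n}) Y ≈ 0#
    tr-off-0 y-pos y-vertex = trans (tr-combine (off-diagonal {n}))
      (sum-0 λ i → sum-0 λ j → sum-0 λ p → sum-0 λ q → term i j p q)
      where
      term : ∀ i j p q → off-diagonal {n} (pair i p) (pair j q) * y i p j q ≈ 0#
      term i j p q with i Fin.≟ j | p Fin.≟ q
      ... | yes i≡j    | yes p≡q    = trans (*-congʳ (off-diagonal-0 i p j q (inj₁ (i≡j , p≡q))))
        (zeroˡ _)
      ... | yes ≡.refl | no  p≢q    = trans (*-congˡ (y-pos i p q p≢q)) (zeroʳ _)
      ... | no  i≢j    | yes ≡.refl = trans (*-congˡ (y-vertex i j p i≢j)) (zeroʳ _)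
      ... | no  i≢j    | no  p≢q    = trans (*-congʳ (off-diagonal-0 i p j q (inj₂ (i≢j , p≢q))))
        (zeroˡ _)

    -- The entries of the constraint matrix are 0 or 1. With `Y` nonnegative, the trace is a sum of
    -- nonnegative terms, and each term must vanish when the trace does.
    off-vanish : (∀ a b → 0# ≼ Y a b) → tr (off-diagonal {n}) Y ≈ 0# →
                 ∀ i p j q → i ≡ j × p ≢ q ⊎ i ≢ j × p ≡ q → y i p j q ≈ 0#
    off-vanish Y≽0 off≈0 i p j q i,p≠j,q = begin
      y i p j q                                                        ≈⟨ *-identityˡ _ ⟨
      1# * y i p j q
        ≈⟨ *-congʳ (off-diagonal-1 i p j q i,p≠j,q) ⟨
      off-diagonal {n} (pair i p) (pair j q) * y i p j q         ≈⟨ all-0 i j p q ⟩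
      0#                                                               ∎
      where
      term≽0 : ∀ i j p q → 0# ≼ off-diagonal {n} (pair i p) (pair j q) * y i p j q
      term≽0 i j p q with off-diagonal-cases i p j q
      ... | inj₁ ≈0 = ≼-reflexive (sym (trans (*-congʳ ≈0) (zeroˡ _)))
      ... | inj₂ ≈1 = ≼-respʳ (sym (trans (*-congʳ ≈1) (*-identityˡ _))) (Y≽0 _ _)

      all-0 : ∀ i j p q → off-diagonal {n} (pair i p) (pair j q) * y i p j q ≈ 0#
      all-0 i j p = nonneg-sum-0 (term≽0 i j p)
        (nonneg-sum-0 (λ p → nonneg-sum (term≽0 i j p))
        (nonneg-sum-0 (λ j → nonneg-sum λ p → nonneg-sum (term≽0 i j p))
        (nonneg-sum-0 (λ i → nonneg-sum λ j → nonneg-sum λ p → nonneg-sum (term≽0 i j p))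
          (trans (sym (tr-combine (off-diagonal {n}))) off≈0) i) j) p)

  -- Consequences of feasibility

  module Relaxation {n} {Y : Fin (n ℕ.* n) → Fin (n ℕ.* n) → Carrier} (Y-feasible : Feasible {n} Y) where

    open Feasible Y-feasible
    open Traces {n} Y symm
    open Form Y symm using (block-sums)

    vertex-sum : ∀ p → sum (λ i → y i p i p) ≈ 1#
    vertex-sum k = trans (sym (tr-I⊗E k)) (I⊗E k)

    position-sum : ∀ i → sum (λ p → y i p i p) ≈ 1#
    position-sum k = trans (sym (tr-E⊗I k)) (E⊗I k)

    y-position : ∀ i p q → p ≢ q → y i p i q ≈ 0#
    y-position i p q p≢q = off-vanish nonneg off i p i q (inj₁ (≡.refl , p≢q))

    y-vertex : ∀ i j p → i ≢ j → y i p j p ≈ 0#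
    y-vertex i j p i≢j = off-vanish nonneg off i p j p (inj₂ (i≢j , ≡.refl))

    pairs : Carrier
    pairs = sum {n} λ _ → sum {n} λ _ → 1#

    total : sum (λ i → sum λ j → sum λ p → sum λ q → y i p j q) ≈ pairs
    total = begin
      sum (λ i → sum λ j → sum λ p → sum λ q → y i p j q)    ≈⟨ tr-J⊗J ⟨
      tr (kron {n} (λ _ _ → 1#) (λ _ _ → 1#)) Y              ≈⟨ J⊗J ⟩
      fromℤ (+ (n ℕ.* n))                                    ≡⟨ ≡.cong fromℤ (ℤ.pos-* n n) ⟩
      fromℤ (+ n ℤ.* + n)                                    ≈⟨ fromℤ-* (+ n) (+ n) ⟩
      fromℤ (+ n) * fromℤ (+ n)                              ≈⟨ *-congˡ (*-identityʳ _) ⟨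
      fromℤ (+ n) * (fromℤ (+ n) * 1#)                       ≈⟨ *-congˡ (∑-const n 1#) ⟨
      fromℤ (+ n) * sum {n} (λ _ → 1#)                       ≈⟨ ∑-const n (sum {n} λ _ → 1#) ⟨
      pairs                                                  ∎

    -- By `block-sums` the sum is the same for all vertices `i`, so it can be computed for `i = j`,
    -- where only the term `p = q` survives.
    ∑-positions : ∀ i j q → sum (λ p → y i p j q) ≈ y j q j q
    ∑-positions i j q = trans
      (block-sums psd pair (λ i a → δ i (quotient n a)) select block total i j (pair j q))
      (sum-single q λ p q≢p → y-position j p q (q≢p ∘ ≡.sym))
      where
      select : ∀ i f → sum (λ a → δ i (quotient n a) * f a) ≈ sum λ p → f (pair i p)
      select i f = begin
        sum (λ a → δ i (quotient n a) * f a)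
          ≈⟨ sum-combine n (λ a → δ i (quotient n a) * f a) ⟩
        sum (λ j → sum λ p → δ i (quotient n (pair j p)) * f (pair j p))
          ≈⟨ sum-cong (λ j → sum-cong {n} λ p → *-congʳ
            (reflexive (≡.cong (δ i) (quotient-combine {n} {n} j p)))) ⟩
        sum (λ j → sum λ p → δ i j * f (pair j p))
          ≈⟨ sum-cong (λ j → *-distribˡ-sum (δ i j) (λ p → f (pair j p))) ⟨
        sum (λ j → δ i j * sum λ p → f (pair j p))
          ≈⟨ sum-δ i (λ j → sum λ p → f (pair j p)) ⟩
        sum (λ p → f (pair i p))
          ∎

      block : ∀ i → sum (λ p → sum λ q → y i p i q) ≈ 1#
      block i = trans
        (sum-cong λ p → sum-single p λ q p≢q → y-position i p q p≢q) (position-sum i)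

    -- The same argument for the partition of the indices by position; `∑-swap₂` brings the total
    -- into the order of these blocks.
    ∑-vertices : ∀ p j q → sum (λ i → y i p j q) ≈ y j q j q
    ∑-vertices p j q = trans
      (block-sums psd (λ p i → pair i p) (λ p a → δ p (remainder {n} n a)) select block
        (trans (∑-swap₂ (λ p q i j → y i p j q)) total) p q (pair j q))
      (sum-single j λ i j≢i → y-vertex i j q (j≢i ∘ ≡.sym))
      where
      select : ∀ p f → sum (λ a → δ p (remainder {n} n a) * f a) ≈ sum λ i → f (pair i p)
      select p f = begin
        sum (λ a → δ p (remainder {n} n a) * f a)
          ≈⟨ sum-combine n (λ a → δ p (remainder {n} n a) * f a) ⟩
        sum (λ i → sum λ q → δ p (remainder {n} n (pair i q)) * f (pair i q))
          ≈⟨ sum-cong {n} (λ i → sum-cong λ q → *-congʳ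
            (reflexive (≡.cong (δ p) (remainder-combine {n} {n} i q)))) ⟩
        sum (λ i → sum λ q → δ p q * f (pair i q))
          ≈⟨ sum-cong (λ i → sum-δ p (λ q → f (pair i q))) ⟩
        sum (λ i → f (pair i p))
          ∎

      block : ∀ p → sum (λ i → sum λ j → y i p j p) ≈ 1#
      block p = trans
        (sum-cong λ i → sum-single i λ j i≢j → y-vertex i j p i≢j) (vertex-sum p)

    -- If y is the lifted matrix of a tour and u, v are the indicators of two
    -- sets of vertices, then W u v p q is 1 or 0 according to whether the
    -- vertices in the positions p and q are in these sets, and x u p is the
    -- diagonal case.
    W : (u v : Fin n → ℤ) → Fin n → Fin n → Carrier
    W u v p q = ⟪ (λ i j → u i ℤ.* v j) , (λ i j → y i p j q) ⟫

    x : (u : Fin n → ℤ) → Fin n → Carrier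
    x u p = sum λ i → fromℤ (u i) * y i p i p

    W-nonneg : ∀ {u v} → (∀ i → 0ℤ ℤ.≤ u i) → (∀ i → 0ℤ ℤ.≤ v i) → ∀ p q → 0# ≼ W u v p q
    W-nonneg {u} {v} u≥0 v≥0 p q = ⟪⟫-nonneg (λ i j → u i ℤ.* v j) (λ i j → y i p j q)
      (λ i j → ℤ-nonneg-* (u≥0 i) (v≥0 j)) (λ i j → nonneg (pair i p) (pair j q))

    W-sym : ∀ u v p q → W u v p q ≈ W v u q p
    W-sym u v p q = trans (⟪⟫-transpose (λ i j → u i ℤ.* v j) (λ i j → y i p j q))
      (⟪⟫-cong (λ j i → ℤ.*-comm (u i) (v j)) (λ j i → symm (pair i p) (pair j q)))

    -- The vertex `j` loses its weight once `v` and `v′` are added, and `∑-vertices` collapses the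
    -- sum over `j`. For a tour: the vertex in position `q` lies in exactly one of two complementary
    -- sets.
    W-split : ∀ u v v′ → (∀ j → v j ℤ.+ v′ j ≡ 1ℤ) → ∀ p q → W u v p q + W u v′ p q ≈ x u p
    W-split u v v′ v+v′≡1 p q = begin
      W u v p q + W u v′ p q
        ≈⟨ ⟪⟫-+ˡ (λ i j → u i ℤ.* v j) (λ i j → u i ℤ.* v′ j) (λ i j → y i p j q) ⟨
      ⟪ (λ i j → u i ℤ.* v j ℤ.+ u i ℤ.* v′ j) , (λ i j → y i p j q) ⟫
        ≈⟨ ⟪⟫-cong (λ i j → ≡.trans (≡.sym (ℤ.*-distribˡ-+ (u i) (v j) (v′ j)))
                            (≡.trans (≡.cong (u i ℤ.*_) (v+v′≡1 j)) (ℤ.*-identityʳ (u i))))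
                   (λ i j → symm (pair i p) (pair j q)) ⟩
      ⟪ (λ i j → u i) , (λ i j → y j q i p) ⟫
        ≈⟨ sum-cong (λ i → *-distribˡ-sum (fromℤ (u i)) (λ j → y j q i p)) ⟨
      sum (λ i → fromℤ (u i) * sum λ j → y j q i p)
        ≈⟨ sum-cong (λ i → *-congˡ (∑-vertices q i p)) ⟩
      x u p
        ∎

    W-diagonal : ∀ {u} → (∀ i → u i ℤ.* u i ≡ u i) → ∀ p → W u u p p ≈ x u p
    W-diagonal {u} u²≡u p = sum-cong λ i → trans
      (sum-single i λ j i≢j → trans (*-congˡ (y-vertex i j p i≢j)) (zeroʳ _))
      (*-congʳ (reflexive (≡.cong fromℤ (u²≡u i))))

    -- Summing over `q` first, `∑-positions` and symmetry reduce `y i p j q` to `y i p i p`; then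
    -- `j` is left only in the weight `v j`.
    W-row : ∀ u v p → sum (λ q → W u v p q) ≈ fromℤ (sumℤ v) * x u p
    W-row u v p = begin
      sum (λ q → sum λ i → sum λ j → fromℤ (u i ℤ.* v j) * y i p j q)
        ≈⟨ ∑-comm (λ q i → sum λ j → fromℤ (u i ℤ.* v j) * y i p j q) ⟩
      sum (λ i → sum λ q → sum λ j → fromℤ (u i ℤ.* v j) * y i p j q)
        ≈⟨ sum-cong (λ i → ∑-comm (λ q j → fromℤ (u i ℤ.* v j) * y i p j q)) ⟩
      sum (λ i → sum λ j → sum λ q → fromℤ (u i ℤ.* v j) * y i p j q)
        ≈⟨ sum-cong (λ i → sum-cong λ j → *-distribˡ-sum (fromℤ (u i ℤ.* v j)) (λ q → y i p j q))
          ⟨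
      sum (λ i → sum λ j → fromℤ (u i ℤ.* v j) * sum λ q → y i p j q)
        ≈⟨ sum-cong (λ i → sum-cong λ j → *-congˡ
          (trans (sum-cong λ q → symm (pair i p) (pair j q)) (∑-positions j i p))) ⟩
      ⟪ (λ i j → u i ℤ.* v j) , (λ i j → y i p i p) ⟫
        ≈⟨ ⟪⟫-rows (λ i j → u i ℤ.* v j) (λ i → y i p i p) ⟩
      sum (λ i → fromℤ (sumℤ λ j → u i ℤ.* v j) * y i p i p)
        ≈⟨ sum-cong (λ i → *-congʳ (trans
             (reflexive (≡.cong fromℤ (≡.trans (≡.sym (ℤ-*-distribˡ-sum (u i) v))
               (ℤ.*-comm (u i) (sumℤ v)))))
             (fromℤ-* (sumℤ v) (u i)))) ⟩
      sum (λ i → fromℤ (sumℤ v) * fromℤ (u i) * y i p i p)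
        ≈⟨ sum-cong (λ i → *-assoc (fromℤ (sumℤ v)) (fromℤ (u i)) (y i p i p)) ⟩
      sum (λ i → fromℤ (sumℤ v) * (fromℤ (u i) * y i p i p))
        ≈⟨ *-distribˡ-sum (fromℤ (sumℤ v)) (λ i → fromℤ (u i) * y i p i p) ⟨
      fromℤ (sumℤ v) * x u p
        ∎

    ∑-x : ∀ u → sum (x u) ≈ fromℤ (sumℤ u)
    ∑-x u = begin
      sum (λ p → sum λ i → fromℤ (u i) * y i p i p)
        ≈⟨ ∑-comm (λ p i → fromℤ (u i) * y i p i p) ⟩
      sum (λ i → sum λ p → fromℤ (u i) * y i p i p)
        ≈⟨ sum-cong (λ i → *-distribˡ-sum (fromℤ (u i)) (λ p → y i p i p)) ⟨
      sum (λ i → fromℤ (u i) * sum λ p → y i p i p)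
        ≈⟨ sum-cong (λ i → trans (*-congˡ (position-sum i)) (*-identityʳ _)) ⟩
      sum (λ i → fromℤ (u i))
        ≈⟨ fromℤ-∑ u ⟨
      fromℤ (sumℤ u)
        ∎

    x-complement : ∀ u u′ → (∀ i → u i ℤ.+ u′ i ≡ 1ℤ) → ∀ p → x u p + x u′ p ≈ 1#
    x-complement u u′ u+u′≡1 p = begin
      x u p + x u′ p
        ≈⟨ ∑-distrib-+ (λ i → fromℤ (u i) * y i p i p) (λ i → fromℤ (u′ i) * y i p i p) ⟨
      sum (λ i → fromℤ (u i) * y i p i p + fromℤ (u′ i) * y i p i p)
        ≈⟨ sum-cong (λ i → trans (sym (distribʳ (y i p i p) (fromℤ (u i)) (fromℤ (u′ i))))
             (*-congʳ (trans (sym (fromℤ-+ (u i) (u′ i)))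
               (trans (reflexive (≡.cong fromℤ (u+u′≡1 i))) fromℤ-1)))) ⟩
      sum (λ i → 1# * y i p i p)
        ≈⟨ sum-cong (λ i → *-identityˡ (y i p i p)) ⟩
      sum (λ i → y i p i p)
        ≈⟨ vertex-sum p ⟩
      1#
        ∎

    W-psd : ∀ u (v : Fin n → ℤ) → 0# ≼ ⟪ (λ p q → v p ℤ.* v q) , W u u ⟫
    W-psd u v = ≼-respʳ (begin
      sum (λ a → sum λ b → z a * Y a b * z b)
        ≈⟨ sum-cong (λ a → sum-cong λ b → solve 3 (λ x y z → x :* y :* z := x :* z :* y) refl
          (z a) (Y a b) (z b)) ⟩
      sum (λ a → sum λ b → z a * z b * Y a b)
        ≈⟨ sum-cong (λ a → sum-cong λ b → *-congˡ (symm a b)) ⟩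
      tr (λ a b → z a * z b) Y
        ≈⟨ tr-combine (λ a b → z a * z b) ⟩
      sum (λ i → sum λ j → sum λ p → sum λ q → z (pair i p) * z (pair j q) * y i p j q)
        ≈⟨ sum-cong (λ i → sum-cong λ j → sum-cong λ p → sum-cong λ q → coefficient i j p q) ⟩
      sum (λ i → sum λ j → sum λ p → sum λ q →
        fromℤ (v p ℤ.* v q) * (fromℤ (u i ℤ.* u j) * y i p j q))
        ≈⟨ ∑-swap₂ (λ i j p q → fromℤ (v p ℤ.* v q) * (fromℤ (u i ℤ.* u j) * y i p j q)) ⟩
      sum (λ p → sum λ q → sum λ i → sum λ j →
        fromℤ (v p ℤ.* v q) * (fromℤ (u i ℤ.* u j) * y i p j q))
        ≈⟨ sum-cong (λ p → sum-cong λ q → ∑∑-* (fromℤ (v p ℤ.* v q))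
          (λ i j → fromℤ (u i ℤ.* u j) * y i p j q)) ⟨
      ⟪ (λ p q → v p ℤ.* v q) , W u u ⟫
        ∎)
      (psd z)
      where
      -- The test vector is the tensor product of `u` and `v`: the form of `Y` there is the form of
      -- `W u u` at `v`.
      z : Fin (n ℕ.* n) → Carrier
      z a = fromℤ (u (quotient n a)) * fromℤ (v (remainder {n} n a))

      z-pair : ∀ i p → z (pair i p) ≡ fromℤ (u i) * fromℤ (v p)
      z-pair i p = ≡.cong₂ _*_ (≡.cong (fromℤ ∘ u) (quotient-combine i p))
        (≡.cong (fromℤ ∘ v) (remainder-combine i p))

      coefficient : ∀ i j p q → z (pair i p) * z (pair j q) * y i p j q ≈
                                fromℤ (v p ℤ.* v q) * (fromℤ (u i ℤ.* u j) * y i p j q)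
      coefficient i j p q = begin
        z (pair i p) * z (pair j q) * y i p j q
          ≡⟨ ≡.cong₂ (λ c d → c * d * y i p j q) (z-pair i p) (z-pair j q) ⟩
        fromℤ (u i) * fromℤ (v p) * (fromℤ (u j) * fromℤ (v q)) * y i p j q
          ≈⟨ solve 5 (λ a b c d e → a :* b :* (c :* d) :* e := b :* d :* (a :* c :* e)) refl
               (fromℤ (u i)) (fromℤ (v p)) (fromℤ (u j)) (fromℤ (v q)) (y i p j q) ⟩
        fromℤ (v p) * fromℤ (v q) * (fromℤ (u i) * fromℤ (u j) * y i p j q)
          ≈⟨ *-cong (fromℤ-* (v p) (v q)) (*-congʳ (fromℤ-* (u i) (u j))) ⟨
        fromℤ (v p ℤ.* v q) * (fromℤ (u i ℤ.* u j) * y i p j q)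
          ∎

  -- Moments of a cluster and the objective

  record CutMoments {n} (k : ℤ) (X : Fin n → Fin n → Carrier) : Set where
    field
      symmetric : ∀ p q → X p q ≈ X q p
      nonneg    : ∀ p q → 0# ≼ X p q
      ≼diagonal : ∀ p q → X p q ≼ X p p
      covering  : ∀ p q → X p p + X q q ≼ 1# + X p q
      row       : ∀ p → sum (X p) ≈ fromℤ k * X p p
      trace     : sum (λ p → X p p) ≈ fromℤ k
      psd       : ∀ (v : Fin n → ℤ) → 0# ≼ ⟪ (λ p q → v p ℤ.* v q) , X ⟫

  x≽0⇒y≼y+x : ∀ {x y} → 0# ≼ x → y ≼ y + x
  x≽0⇒y≼y+x x≽0 = ≼-respˡ (+-identityʳ _) (+-mono-≼ ≼-refl x≽0)

  module Cut {n} {Y : Fin (n ℕ.* n) → Fin (n ℕ.* n) → Carrier} (Y-feasible : Feasible {n} Y)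
    (side : Fin n → Bool) where

    open Feasible Y-feasible using (symm)
    open Traces {n} Y symm
    open Relaxation {n} Y-feasible

    α β : Fin n → ℤ
    α i = ⟦ side i ⟧
    β i = ⟦ not (side i) ⟧

    X : Fin n → Fin n → Carrier
    X = W α α

    size : ℤ
    size = sumℤ α

    X-diagonal : ∀ p → X p p ≈ x α p
    X-diagonal = W-diagonal λ i → ⟦⟧-idem (side i)

    α+β≡1 : ∀ i → α i ℤ.+ β i ≡ 1ℤ
    α+β≡1 i = ⟦⟧-not (side i)

    -- `W α β p q` stands for "`p` in the cluster and `q` outside", which makes it the slack of
    -- `≼diagonal` and, in `objective`, the contribution of a cut edge.
    X-slack : ∀ p q → X p q + W α β p q ≈ X p p
    X-slack p q = trans (W-split α α β α+β≡1 p q) (sym (X-diagonal p))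

    X-sym : ∀ p q → X p q ≈ X q p
    X-sym = W-sym α α

    -- `W β β p q` stands for "neither position in the cluster" and is the slack of `covering`.
    -- Splitting `X q q` by the side of `p` leaves two terms with `p` outside, or `q` on either
    -- side, that add up to `x β p`.
    X-coslack : ∀ p q → X p p + X q q + W β β p q ≈ 1# + X p q
    X-coslack p q = begin
      X p p + X q q + W β β p q
        ≈⟨ +-congʳ (+-congˡ (X-slack q p)) ⟨
      X p p + (X q p + W α β q p) + W β β p q
        ≈⟨ +-congʳ (+-congˡ (+-cong (X-sym q p) (W-sym α β q p))) ⟩
      X p p + (X p q + W β α p q) + W β β p q
        ≈⟨ solve 4 (λ a b c d → a :+ (b :+ c) :+ d := a :+ (c :+ d) :+ b) refl (X p p) (X p q)
          (W β α p q) (W β β p q) ⟩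
      X p p + (W β α p q + W β β p q) + X p q
        ≈⟨ +-congʳ (+-cong (X-diagonal p) (W-split β α β α+β≡1 p q)) ⟩
      x α p + x β p + X p q
        ≈⟨ +-congʳ (x-complement α β α+β≡1 p) ⟩
      1# + X p q
        ∎

    cutMoments : CutMoments size X
    cutMoments = record
      { symmetric = X-sym
      ; nonneg    = W-nonneg α≥0 α≥0
      ; ≼diagonal = λ p q → ≼-respʳ (X-slack p q) (x≽0⇒y≼y+x (W-nonneg α≥0 β≥0 p q))
      ; covering  = λ p q → ≼-respʳ (X-coslack p q) (x≽0⇒y≼y+x (W-nonneg β≥0 β≥0 p q))
      ; row       = λ p → trans (W-row α α p) (*-congˡ (sym (X-diagonal p)))
      ; trace     = trans (sum-cong X-diagonal) (∑-x α)
      ; psd       = W-psd α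
      }
      where
      α≥0 : ∀ i → 0ℤ ℤ.≤ α i
      α≥0 i = ⟦⟧-nonneg (side i)
      β≥0 : ∀ i → 0ℤ ℤ.≤ β i
      β≥0 i = ⟦⟧-nonneg (not (side i))

    -- Every position has two neighbours on the cycle, and a pair of neighbours
    -- contributes X p p + X q q - (X p q + X q p) to the objective.
    objective : ∀ (D H : Fin n → Fin n → Carrier) (c : Fin (n ℕ.* n) → Carrier)
      (C : Fin n → Fin n → ℤ) (C₀ : Fin n → ℤ) →
      (∀ i j → D i j ≈ fromℤ (α i ℤ.* β j ℤ.+ β i ℤ.* α j)) →
      (∀ p q → H p q + H p q ≈ fromℤ (C p q)) → (∀ p q → H p q ≈ H q p) →
      (∀ i p → c (combine i p) ≈ fromℤ (C₀ p) * fromℤ (α i)) →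
      (∀ p → sumℤ (C p) ℤ.+ C₀ p ≡ + 2) →
      tr (λ a b → kron D H a b + (if does (a Fin.≟ b) then c a else 0#)) Y + ⟪ C , X ⟫ ≈
      fromℤ (size ℤ.+ size)
    objective D H c C C₀ D≈ H+H≈C H-sym c≈ degree = begin
      tr (λ a b → kron D H a b + (if does (a Fin.≟ b) then c a else 0#)) Y + ⟪ C , X ⟫
        ≈⟨ +-cong (trans (trans (sum-cong λ a → sum-cong λ b → distribʳ (Y b a) (kron D H a b) _)
                         (∑∑-+ (λ a b → kron D H a b * Y b a)
                           (λ a b → (if does (a Fin.≟ b) then c a else 0#) * Y b a)))
                         (+-cong edges root)) chords ⟩
      (sum (λ p → sum λ q → H p q * (W α β p q + W β α p q)) + sum (λ p → fromℤ (C₀ p) * X p p)) +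
      sum (λ p → sum λ q → H p q * (X p q + X p q))
        ≈⟨ solve 3 (λ a b c → a :+ b :+ c := a :+ c :+ b) refl _ _ _ ⟩
      (sum (λ p → sum λ q → H p q * (W α β p q + W β α p q)) + sum
        (λ p → sum λ q → H p q * (X p q + X p q))) +
      sum (λ p → fromℤ (C₀ p) * X p p)
        -- Adding the pairs inside the cluster completes each cut term to a diagonal entry:
        -- `X p q + W α β p q` is `X p p`, and `X p q + W β α p q` is `X q q`.
        ≈⟨ +-congʳ (trans (sym (∑∑-+ (λ p q → H p q * (W α β p q + W β α p q))
          (λ p q → H p q * (X p q + X p q))))
                          (sum-cong λ p → sum-cong λ q → edge p q)) ⟩
      sum (λ p → sum λ q → H p q * X p p + H p q * X q q) + sum (λ p → fromℤ (C₀ p) * X p p)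
        ≈⟨ +-congʳ (trans (trans (∑∑-+ (λ p q → H p q * X p p) (λ p q → H p q * X q q))
             (+-congˡ (trans (∑-comm (λ p q → H p q * X q q))
               (sum-cong λ p → sum-cong λ q → *-congʳ (H-sym q p)))))
             (sym (∑∑-+ (λ p q → H p q * X p p) (λ p q → H p q * X p p)))) ⟩
      sum (λ p → sum λ q → H p q * X p p + H p q * X p p) + sum (λ p → fromℤ (C₀ p) * X p p)
        ≈⟨ +-congʳ (sum-cong λ p → sum-cong λ q →
          trans (sym (distribʳ (X p p) (H p q) (H p q))) (*-congʳ (H+H≈C p q))) ⟩
      ⟪ C , (λ p _ → X p p) ⟫ + sum (λ p → fromℤ (C₀ p) * X p p)
        ≈⟨ +-congʳ (⟪⟫-rows C (λ p → X p p)) ⟩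
      sum (λ p → fromℤ (sumℤ (C p)) * X p p) + sum (λ p → fromℤ (C₀ p) * X p p)
        ≈⟨ ∑-distrib-+ (λ p → fromℤ (sumℤ (C p)) * X p p) (λ p → fromℤ (C₀ p) * X p p) ⟨
      sum (λ p → fromℤ (sumℤ (C p)) * X p p + fromℤ (C₀ p) * X p p)
        ≈⟨ sum-cong (λ p → trans (sym (distribʳ (X p p) _ _)) (trans
             (*-congʳ (trans (sym (fromℤ-+ (sumℤ (C p)) (C₀ p)))
               (trans (reflexive (≡.cong fromℤ (degree p))) two)))
             (trans (distribʳ (X p p) 1# 1#) (+-cong (*-identityˡ _) (*-identityˡ _))))) ⟩
      sum (λ p → X p p + X p p)
        ≈⟨ ∑-distrib-+ (λ p → X p p) (λ p → X p p) ⟩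
      sum (λ p → X p p) + sum (λ p → X p p)
        ≈⟨ +-cong (CutMoments.trace cutMoments) (CutMoments.trace cutMoments) ⟩
      fromℤ size + fromℤ size
        ≈⟨ fromℤ-+ size size ⟨
      fromℤ (size ℤ.+ size)
        ∎
      where
      two : fromℤ (+ 2) ≈ 1# + 1#
      two = trans (fromℤ-+ 1ℤ 1ℤ) (+-cong fromℤ-1 fromℤ-1)

      edges : tr (kron D H) Y ≈ sum λ p → sum λ q → H p q * (W α β p q + W β α p q)
      edges = begin
        tr (kron D H) Y
          ≈⟨ tr-kron D H ⟩
        sum (λ i → sum λ j → D i j * sum λ p → sum λ q → H p q * y i p j q)
          ≈⟨ sum-cong (λ i → sum-cong λ j → ∑∑-* (D i j) (λ p q → H p q * y i p j q)) ⟩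
        sum (λ i → sum λ j → sum λ p → sum λ q → D i j * (H p q * y i p j q))
          ≈⟨ ∑-swap₂ (λ i j p q → D i j * (H p q * y i p j q)) ⟩
        sum (λ p → sum λ q → sum λ i → sum λ j → D i j * (H p q * y i p j q))
          ≈⟨ sum-cong (λ p → sum-cong λ q → sum-cong λ i → sum-cong λ j → trans
               (solve 3 (λ a b c → a :* (b :* c) := b :* (a :* c)) refl (D i j) (H p q)
                 (y i p j q))
               (*-congˡ (*-congʳ (D≈ i j)))) ⟩
        sum (λ p → sum λ q → sum λ i → sum λ j →
          H p q * (fromℤ (α i ℤ.* β j ℤ.+ β i ℤ.* α j) * y i p j q))
          ≈⟨ sum-cong (λ p → sum-cong λ q → ∑∑-* (H p q)
            (λ i j → fromℤ (α i ℤ.* β j ℤ.+ β i ℤ.* α j) * y i p j q)) ⟨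
        sum (λ p → sum λ q → H p q * ⟪ (λ i j → α i ℤ.* β j ℤ.+ β i ℤ.* α j) , (λ i j → y i p j q)
          ⟫)
          ≈⟨ sum-cong (λ p → sum-cong λ q → *-congˡ
               (⟪⟫-+ˡ (λ i j → α i ℤ.* β j) (λ i j → β i ℤ.* α j) (λ i j → y i p j q))) ⟩
        sum (λ p → sum λ q → H p q * (W α β p q + W β α p q))
          ∎

      -- The vertex `s` occupies position `r` and lies outside the cluster, so an edge at `r` is cut
      -- exactly when its other end is in the cluster; hence a linear term in the diagonal of `X`.
      root : tr (λ a b → if does (a Fin.≟ b) then c a else 0#) Y ≈ sum λ p → fromℤ (C₀ p) * X p p
      root = begin
        tr (λ a b → if does (a Fin.≟ b) then c a else 0#) Y
          ≈⟨ sum-cong (λ a → sum-cong λ b → select a b) ⟩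
        sum (λ a → sum λ b → δ a b * (c a * Y b a))
          ≈⟨ sum-cong (λ a → sum-δ a (λ b → c a * Y b a)) ⟩
        sum (λ a → c a * Y a a)
          ≈⟨ sum-combine n (λ a → c a * Y a a) ⟩
        sum (λ i → sum λ p → c (pair i p) * y i p i p)
          ≈⟨ ∑-comm (λ i p → c (pair i p) * y i p i p) ⟩
        sum (λ p → sum λ i → c (pair i p) * y i p i p)
          ≈⟨ sum-cong (λ p → sum-cong λ i → trans (*-congʳ (c≈ i p)) (*-assoc _ _ _)) ⟩
        sum (λ p → sum λ i → fromℤ (C₀ p) * (fromℤ (α i) * y i p i p))
          ≈⟨ sum-cong (λ p → *-distribˡ-sum (fromℤ (C₀ p)) (λ i → fromℤ (α i) * y i p i p)) ⟨
        sum (λ p → fromℤ (C₀ p) * x α p)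
          ≈⟨ sum-cong (λ p → *-congˡ (X-diagonal p)) ⟨
        sum (λ p → fromℤ (C₀ p) * X p p)
          ∎
        where
        select : ∀ a b → (if does (a Fin.≟ b) then c a else 0#) * Y b a ≈ δ a b * (c a * Y b a)
        select a b with does (a Fin.≟ b)
        ... | true  = sym (*-identityˡ _)
        ... | false = trans (zeroˡ _) (sym (zeroˡ _))

      chords : ⟪ C , X ⟫ ≈ sum λ p → sum λ q → H p q * (X p q + X p q)
      chords = sum-cong λ p → sum-cong λ q → trans (*-congʳ (sym (H+H≈C p q)))
        (solve 2 (λ h x → (h :+ h) :* x := h :* (x :+ x)) refl (H p q) (X p q))

      edge : ∀ p q → H p q * (W α β p q + W β α p q) + H p q * (X p q + X p q)
        ≈ H p q * X p p + H p q * X q q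
      edge p q = begin
        H p q * (W α β p q + W β α p q) + H p q * (X p q + X p q)
          ≈⟨ solve 4 (λ h a b x → h :* (a :+ b) :+ h :* (x :+ x) := h :* (x :+ a) :+ h :*
            (x :+ b)) refl
               (H p q) (W α β p q) (W β α p q) (X p q) ⟩
        H p q * (X p q + W α β p q) + H p q * (X p q + W β α p q)
          ≈⟨ +-cong (*-congˡ (X-slack p q))
                    (*-congˡ (trans (+-cong (X-sym p q) (W-sym β α p q)) (X-slack q p))) ⟩
        H p q * X p p + H p q * X q q
          ∎

  -- Dual certificates

  module Certificate {n k} {X : Fin n → Fin n → Carrier} (X-moments : CutMoments k X) where

    open CutMoments X-moments

    -- The linear inequalities with integral data that hold for `X`. A dual certificate is a sum of
    -- them, and weak duality is `valid-+`.
    Valid : (Fin n → Fin n → ℤ) → ℤ → Set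
    Valid M b = fromℤ b ≼ ⟪ M , X ⟫

    valid-+ : ∀ {M M′ b b′} → Valid M b → Valid M′ b′ →
      Valid (λ p q → M p q ℤ.+ M′ p q) (b ℤ.+ b′)
    valid-+ {M} {M′} {b} {b′} V V′ =
      ≼-respˡ (sym (fromℤ-+ b b′)) (≼-respʳ (sym (⟪⟫-+ˡ M M′ X)) (+-mono-≼ V V′))

    valid-transpose : ∀ {M b} → Valid M b → Valid (λ p q → M q p) b
    valid-transpose {M} = ≼-respʳ (trans (⟪⟫-transpose M X)
      (⟪⟫-cong {M = λ p q → M q p} (λ _ _ → ≡.refl) (λ p q → symmetric q p)))

    valid-diff : ∀ {P Q : Fin n → Fin n → ℤ} {b} → fromℤ b + ⟪ P , X ⟫ ≼ ⟪ Q , X ⟫ →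
                 Valid (λ p q → Q p q ℤ.- P p q) b
    valid-diff {P} {Q} {b} le = ≼-respˡ
      (trans (+-assoc _ _ _) (trans (+-congˡ P-P≈0) (+-identityʳ _)))
      (≼-respʳ (sym (⟪⟫-+ˡ Q (λ p q → ℤ.- P p q) X)) (+-mono-≼ le ≼-refl))
      where
      P-P≈0 : ⟪ P , X ⟫ + ⟪ (λ p q → ℤ.- P p q) , X ⟫ ≈ 0#
      P-P≈0 = trans (sym (⟪⟫-+ˡ P (λ p q → ℤ.- P p q) X))
        (sum-0 λ p → sum-0 λ q → trans
          (*-congʳ (trans (reflexive (≡.cong fromℤ (ℤ.+-inverseʳ (P p q)))) fromℤ-0)) (zeroˡ _))

    valid-nonneg : ∀ {Λ} → (∀ p q → 0ℤ ℤ.≤ Λ p q) → Valid Λ 0ℤ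
    valid-nonneg {Λ} Λ≥0 = ≼-respˡ (sym fromℤ-0) (⟪⟫-nonneg Λ X Λ≥0 nonneg)

    valid-square : ∀ v → Valid (λ p q → v p ℤ.* v q) 0ℤ
    valid-square v = ≼-respˡ (sym fromℤ-0) (psd v)

    ⟪⟫-mono : ∀ {Λ : Fin n → Fin n → ℤ} {X X′ : Fin n → Fin n → Carrier} →
      (∀ p q → 0ℤ ℤ.≤ Λ p q) →
              (∀ p q → X p q ≼ X′ p q) → ⟪ Λ , X ⟫ ≼ ⟪ Λ , X′ ⟫
    ⟪⟫-mono {Λ} {X} {X′} Λ≥0 X≼X′ = ≼-respˡ (+-identityˡ _) (≼-respʳ (begin
      ⟪ Λ , (λ p q → X′ p q - X p q) ⟫ + ⟪ Λ , X ⟫         ≈⟨ ⟪⟫-+ʳ Λ (λ p q → X′ p q - X p q) X ⟨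
      ⟪ Λ , (λ p q → X′ p q - X p q + X p q) ⟫
        ≈⟨ ⟪⟫-cong {M = Λ} (λ _ _ → ≡.refl)
          (λ p q → trans (+-assoc _ _ _) (trans (+-congˡ (-‿inverseˡ _)) (+-identityʳ _))) ⟩
      ⟪ Λ , X′ ⟫                                           ∎)
      (+-mono-≼ (⟪⟫-nonneg Λ (λ p q → X′ p q - X p q) Λ≥0 λ p q →
        ≼-respˡ (-‿inverseʳ (X p q)) (+-mono-≼ (X≼X′ p q) ≼-refl)) ≼-refl))

    ⟪rowSums⟫ : ∀ Λ → ⟪ rowSums Λ , X ⟫ ≈ ⟪ Λ , (λ p _ → X p p) ⟫
    ⟪rowSums⟫ Λ = trans (⟪⟫-diag (λ p → sumℤ (Λ p)) X) (sym (⟪⟫-rows Λ (λ p → X p p)))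

    valid-≼diagonal : ∀ {Λ} → (∀ p q → 0ℤ ℤ.≤ Λ p q) → Valid (λ p q → rowSums Λ p q ℤ.- Λ p q) 0ℤ
    valid-≼diagonal {Λ} Λ≥0 = valid-diff {Λ} {rowSums Λ}
      (≼-respˡ (sym (trans (+-congʳ fromℤ-0) (+-identityˡ _)))
      (≼-respʳ (sym (⟪rowSums⟫ Λ)) (⟪⟫-mono Λ≥0 ≼diagonal)))

    -- Each inequality `covering p q` is multiplied by `Λ p q` and all are added: `X p p` collects
    -- row sums of `Λ`, `X q q` column sums, and the constant 1 the total.
    valid-covering : ∀ {Λ} → (∀ p q → 0ℤ ℤ.≤ Λ p q) → Valid
      (λ p q → Λ p q ℤ.- (rowSums Λ p q ℤ.+ rowSums (λ p q → Λ q p) p q))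
        (ℤ.- sumℤ λ p → sumℤ (Λ p))
    valid-covering {Λ} Λ≥0 = valid-diff {λ p q → rowSums Λ p q ℤ.+ rowSums (λ p q → Λ q p) p q}
      {Λ}
      (≼-respʳ (begin
         fromℤ (ℤ.- s) + ⟪ Λ , (λ p q → 1# + X p q) ⟫
           ≈⟨ +-congˡ (⟪⟫-+ʳ Λ (λ _ _ → 1#) X) ⟩
         fromℤ (ℤ.- s) + (⟪ Λ , (λ _ _ → 1#) ⟫ + ⟪ Λ , X ⟫)
           ≈⟨ +-congˡ (+-congʳ (trans (⟪⟫-rows Λ (λ _ → 1#))
             (trans (sum-cong {n} λ p → *-identityʳ _) (sym (fromℤ-∑ (λ p → sumℤ (Λ p))))))) ⟩
         fromℤ (ℤ.- s) + (fromℤ s + ⟪ Λ , X ⟫)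
           ≈⟨ +-assoc _ _ _ ⟨
         fromℤ (ℤ.- s) + fromℤ s + ⟪ Λ , X ⟫
           ≈⟨ +-congʳ (trans (sym (fromℤ-+ (ℤ.- s) s))
             (trans (reflexive (≡.cong fromℤ (ℤ.+-inverseˡ s))) fromℤ-0)) ⟩
         0# + ⟪ Λ , X ⟫
           ≈⟨ +-identityˡ _ ⟩
         ⟪ Λ , X ⟫
           ∎)
      (+-mono-≼ ≼-refl (≼-respˡ (begin
         ⟪ Λ , (λ p q → X p p + X q q) ⟫
           ≈⟨ ⟪⟫-+ʳ Λ (λ p _ → X p p) (λ _ q → X q q) ⟩
         ⟪ Λ , (λ p _ → X p p) ⟫ + ⟪ Λ , (λ _ q → X q q) ⟫
           ≈⟨ +-congˡ (⟪⟫-transpose Λ (λ _ q → X q q)) ⟩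
         ⟪ Λ , (λ p _ → X p p) ⟫ + ⟪ (λ p q → Λ q p) , (λ p _ → X p p) ⟫
           ≈⟨ +-cong (⟪rowSums⟫ Λ) (⟪rowSums⟫ (λ p q → Λ q p)) ⟨
         ⟪ rowSums Λ , X ⟫ + ⟪ rowSums (λ p q → Λ q p) , X ⟫
           ≈⟨ ⟪⟫-+ˡ (rowSums Λ) (rowSums (λ p q → Λ q p)) X ⟨
         ⟪ (λ p q → rowSums Λ p q ℤ.+ rowSums (λ p q → Λ q p) p q) , X ⟫
           ∎)
       (⟪⟫-mono Λ≥0 covering))))
      where
      s : ℤ
      s = sumℤ λ p → sumℤ (Λ p)

    valid-row : ∀ (μ : Fin n → ℤ) → Valid (λ p q → μ p ℤ.- diag (λ p → μ p ℤ.* k) p q) 0ℤ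
    valid-row μ = valid-diff {diag (λ p → μ p ℤ.* k)} {λ p _ → μ p}
      (≼-reflexive (begin
        fromℤ 0ℤ + ⟪ diag (λ p → μ p ℤ.* k) , X ⟫     ≈⟨ trans (+-congʳ fromℤ-0) (+-identityˡ _) ⟩
        ⟪ diag (λ p → μ p ℤ.* k) , X ⟫                ≈⟨ ⟪⟫-diag (λ p → μ p ℤ.* k) X ⟩
        sum (λ p → fromℤ (μ p ℤ.* k) * X p p)
          ≈⟨ sum-cong (λ p → trans (*-congʳ (fromℤ-* (μ p) k)) (*-assoc _ _ _)) ⟩
        sum (λ p → fromℤ (μ p) * (fromℤ k * X p p))   ≈⟨ sum-cong (λ p → *-congˡ (row p)) ⟨
        sum (λ p → fromℤ (μ p) * sum (X p))
          ≈⟨ sum-cong (λ p → *-distribˡ-sum (fromℤ (μ p)) (X p)) ⟩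
        ⟪ (λ p _ → μ p) , X ⟫                         ∎))

    valid-trace : ∀ t → Valid (diag λ _ → t) (t ℤ.* k)
    valid-trace t = ≼-reflexive (begin
      fromℤ (t ℤ.* k)                   ≈⟨ fromℤ-* t k ⟩
      fromℤ t * fromℤ k                 ≈⟨ *-congˡ trace ⟨
      fromℤ t * sum (λ p → X p p)       ≈⟨ *-distribˡ-sum (fromℤ t) (λ p → X p p) ⟩
      sum (λ p → fromℤ t * X p p)       ≈⟨ ⟪⟫-diag (λ _ → t) X ⟨
      ⟪ diag (λ _ → t) , X ⟫            ∎)

    valid-cong : ∀ {M M′ b b′} → (∀ p q → M p q ≡ M′ p q) → b ≡ b′ → Valid M b → Valid M′ b′
    valid-cong M≡M′ b≡b′ V = ≼-respˡ (reflexive (≡.cong fromℤ b≡b′))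
      (≼-respʳ (⟪⟫-cong M≡M′ λ _ _ → refl) V)

    -- An upper bound on `⟪ C , X ⟫` is a lower bound on the objective `f`. The factor `c` keeps the
    -- multipliers integral; it is divided out only in the reals, by `unscale`.
    length-bound : ∀ c {C b f} → Valid (λ p q → ℤ.- c ℤ.* C p q) b →
                   f + ⟪ C , X ⟫ ≈ fromℤ (k ℤ.+ k) →
                   fromℤ (b ℤ.+ c ℤ.* (k ℤ.+ k)) ≼ fromℤ c * f
    length-bound c {C} {b} {f} V f+C = ≼-respˡ
      (begin
        fromℤ b + (fromℤ c * ⟪ C , X ⟫ + fromℤ c * f)
          ≈⟨ +-congˡ (trans (sym (distribˡ _ _ _)) (*-congˡ (trans (+-comm _ _) f+C))) ⟩
        fromℤ b + fromℤ c * fromℤ (k ℤ.+ k)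
          ≈⟨ trans (fromℤ-+ b (c ℤ.* (k ℤ.+ k))) (+-congˡ (fromℤ-* c (k ℤ.+ k))) ⟨
        fromℤ (b ℤ.+ c ℤ.* (k ℤ.+ k))
          ∎)
      (≼-respʳ (begin
        fromℤ (ℤ.- c) * ⟪ C , X ⟫ + (fromℤ c * ⟪ C , X ⟫ + fromℤ c * f)
          ≈⟨ solve 4 (λ c c′ x y → c′ :* x :+ (c :* x :+ y) := (c′ :+ c) :* x :+ y) refl (fromℤ c)
            (fromℤ (ℤ.- c)) ⟪ C , X ⟫ (fromℤ c * f) ⟩
        (fromℤ (ℤ.- c) + fromℤ c) * ⟪ C , X ⟫ + fromℤ c * f
          ≈⟨ +-congʳ (trans (*-congʳ (trans (sym (fromℤ-+ (ℤ.- c) c))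
            (trans (reflexive (≡.cong fromℤ (ℤ.+-inverseˡ c))) fromℤ-0))) (zeroˡ _)) ⟩
        0# + fromℤ c * f
          ≈⟨ +-identityˡ _ ⟩
        fromℤ c * f
          ∎)
      (+-mono-≼ (≼-respʳ (⟪⟫-*ˡ (ℤ.- c) C X) V) ≼-refl))

    -- The pairing with `J` is the sum of all entries, which `row` and `trace` fix to be the square
    -- of `k`, and the pairing with `I` is the trace. Hence the objective is the constant 3 `k` -
    -- `k`².
    ⟪complete⟫ : ∀ {C} → (∀ p q → C p q ℤ.+ diag (λ _ → 1ℤ) p q ≡ 1ℤ) →
                   ⟪ C , X ⟫ + fromℤ k ≈ fromℤ (k ℤ.* k)
    ⟪complete⟫ {C} C+I≡J = begin
      ⟪ C , X ⟫ + fromℤ k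
        ≈⟨ +-congˡ (trans (sum-cong λ p → trans (*-congʳ fromℤ-1) (*-identityˡ (X p p))) trace) ⟨
      ⟪ C , X ⟫ + sum (λ p → fromℤ 1ℤ * X p p)
        ≈⟨ +-congˡ (⟪⟫-diag (λ _ → 1ℤ) X) ⟨
      ⟪ C , X ⟫ + ⟪ diag (λ _ → 1ℤ) , X ⟫
        ≈⟨ ⟪⟫-+ˡ C (diag λ _ → 1ℤ) X ⟨
      ⟪ (λ p q → C p q ℤ.+ diag (λ _ → 1ℤ) p q) , X ⟫
        ≈⟨ ⟪⟫-cong C+I≡J (λ _ _ → refl) ⟩
      ⟪ (λ _ _ → 1ℤ) , X ⟫
        ≈⟨ sum-cong (λ p → sum-cong λ q → trans (*-congʳ fromℤ-1) (*-identityˡ (X p q))) ⟩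
      sum (λ p → sum (X p))
        ≈⟨ sum-cong row ⟩
      sum (λ p → fromℤ k * X p p)
        ≈⟨ *-distribˡ-sum (fromℤ k) (λ p → X p p) ⟨
      fromℤ k * sum (λ p → X p p)
        ≈⟨ *-congˡ trace ⟩
      fromℤ k * fromℤ k
        ≈⟨ fromℤ-* k k ⟨
      fromℤ (k ℤ.* k)
        ∎

  -- Feasibility from an integral matrix

  module Witness {n K Z} (Z-witness : IntegralWitness n K Z) (ρ : Carrier) (ρ²K≈1 : ρ * ρ * fromℤ K ≈ 1#) where

    open IntegralWitness Z-witness

    index : Fin (n ℕ.* n) → Fin n × Fin n
    index a = quotient n a , remainder {n} n a

    Y : Fin (n ℕ.* n) → Fin (n ℕ.* n) → Carrier
    Y a b = ρ * ρ * fromℤ (Z (index a) (index b))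

    Y-sym : ∀ a b → Y a b ≈ Y b a
    Y-sym a b = *-congˡ (reflexive (≡.cong fromℤ (≡.trans (sos (index a) (index b))
      (≡.trans (sumOfSquares-sym squares (index a) (index b))
        (≡.sym (sos (index b) (index a)))))))

    open Traces {n} Y Y-sym

    y-Z : ∀ i p j q → y i p j q ≈ ρ * ρ * fromℤ (Z (i , p) (j , q))
    y-Z i p j q = *-congˡ (reflexive (≡.cong₂ (λ v w → fromℤ (Z v w))
      (≡.cong₂ _,_ (quotient-combine i p) (remainder-combine i p))
      (≡.cong₂ _,_ (quotient-combine j q) (remainder-combine j q))))

    ρ²-nonneg : ∀ {z} → 0ℤ ℤ.≤ z → 0# ≼ ρ * ρ * fromℤ z
    ρ²-nonneg {z} z≥0 = ≼-respʳ (*-comm (fromℤ z) (ρ * ρ)) (nonneg-scale z≥0 (nonneg-² ρ))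

    -- Nonnegativity comes from squares, so the factor 1 / `K` is written as `ρ * ρ` and absorbed
    -- into each square. This wants a `K` that is a perfect square, as 1 and 144 are.
    sos-psd : ∀ (L : List (ℕ × (Fin n × Fin n → ℤ))) (u : Fin (n ℕ.* n) → Carrier) →
      0# ≼ sum λ a → sum λ b → u a * (ρ * ρ * fromℤ (sumOfSquares L (index a) (index b))) * u b
    sos-psd []            u = ≼-reflexive (sym (sum-0 {n ℕ.* n} λ a → sum-0 {n ℕ.* n} λ b →
      trans (*-congʳ (trans (*-congˡ (trans (*-congˡ fromℤ-0) (zeroʳ _))) (zeroʳ _))) (zeroˡ _)))
    sos-psd ((c , w) ∷ L) u = ≼-respʳ (begin
      fromℤ (+ c) * (sum t * sum t) + Q L
        ≈⟨ +-congʳ (trans (*-congˡ (trans (*-distribʳ-sum (sum t) t)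
          (sum-cong λ a → *-distribˡ-sum (t a) t)))
                          (∑∑-* (fromℤ (+ c)) (λ a b → t a * t b))) ⟩
      sum (λ a → sum λ b → fromℤ (+ c) * (t a * t b)) + Q L
        ≈⟨ ∑∑-+ (λ a b → fromℤ (+ c) * (t a * t b))
          (λ a b → u a * (ρ * ρ * fromℤ (sumOfSquares L (index a) (index b))) * u b) ⟨
      sum (λ a → sum λ b → fromℤ (+ c) * (t a * t b) + u a *
        (ρ * ρ * fromℤ (sumOfSquares L (index a) (index b))) * u b)
        ≈⟨ sum-cong (λ a → sum-cong λ b → sym (term a b)) ⟩
      Q ((c , w) ∷ L)
        ∎)
      (nonneg-+ (nonneg-scale (ℤ.+≤+ ℕ.z≤n) (nonneg-² (sum t))) (sos-psd L u))
      where
      Q : List (ℕ × (Fin n × Fin n → ℤ)) → Carrier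
      Q L = sum λ a → sum λ b → u a * (ρ * ρ * fromℤ (sumOfSquares L (index a) (index b))) * u b

      t : Fin (n ℕ.* n) → Carrier
      t a = u a * (ρ * fromℤ (w (index a)))

      term : ∀ a b → u a * (ρ * ρ * fromℤ (sumOfSquares ((c , w) ∷ L) (index a) (index b))) * u b
        ≈
        fromℤ (+ c) * (t a * t b) + u a * (ρ * ρ * fromℤ (sumOfSquares L (index a) (index b))) * u
          b
      term a b = trans
        (*-congʳ (*-congˡ (*-congˡ (trans (fromℤ-+ (+ c ℤ.* (wa ℤ.* wb)) r) (+-congʳ
          (trans (fromℤ-* (+ c) (wa ℤ.* wb)) (*-congˡ (fromℤ-* wa wb))))))))
        (solve 7 (λ u ρ c wa wb r u′ →
           u :* (ρ :* ρ :* (c :* (wa :* wb) :+ r)) :* u′ :=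
           c :* (u :* (ρ :* wa) :* (u′ :* (ρ :* wb))) :+ u :* (ρ :* ρ :* r) :* u′) refl
           (u a) ρ (fromℤ (+ c)) (fromℤ wa) (fromℤ wb) (fromℤ r) (u b))
        where
        wa wb r : ℤ
        wa = w (index a)
        wb = w (index b)
        r  = sumOfSquares L (index a) (index b)

    ∑-ρ² : ∀ {m} (f : Fin m → ℤ) → sum (λ i → ρ * ρ * fromℤ (f i)) ≈ ρ * ρ * fromℤ (sumℤ f)
    ∑-ρ² f = trans (sym (*-distribˡ-sum (ρ * ρ) (λ i → fromℤ (f i)))) (*-congˡ (sym (fromℤ-∑ f)))

    ρ²-0 : ∀ {z} → z ≡ 0ℤ → ρ * ρ * fromℤ z ≈ 0#
    ρ²-0 ≡.refl = trans (*-congˡ fromℤ-0) (zeroʳ _)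

    feasible : Feasible {n} Y
    feasible = record
      { symm   = Y-sym
      ; nonneg = λ a b → ρ²-nonneg (nonneg (index a) (index b))
      ; psd    = λ u → ≼-respʳ
          (sum-cong λ a → sum-cong λ b → *-congʳ
            (*-congˡ (*-congˡ (reflexive (≡.cong fromℤ (≡.sym (sos (index a) (index b))))))))
          (sos-psd squares u)
      ; I⊗E    = λ k → trans (tr-I⊗E k) (trans (sum-cong λ i → y-Z i k i k)
          (trans (∑-ρ² (λ i → Z (i , k) (i , k)))
            (trans (*-congˡ (reflexive (≡.cong fromℤ (vertex k)))) ρ²K≈1)))
      ; E⊗I    = λ k → trans (tr-E⊗I k) (trans (sum-cong λ p → y-Z k p k p)
          (trans (∑-ρ² (λ p → Z (k , p) (k , p)))
            (trans (*-congˡ (reflexive (≡.cong fromℤ (position k)))) ρ²K≈1)))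
      ; off    = tr-off-0 (λ i p q p≢q → trans (y-Z i p i q) (ρ²-0 (same-vertex i p q p≢q)))
                          (λ i j p i≢j → trans (y-Z i p j p) (ρ²-0 (same-position i j p i≢j)))
      ; J⊗J    = begin
          tr (kron {n} (λ _ _ → 1#) (λ _ _ → 1#)) Y
            ≈⟨ tr-J⊗J ⟩
          sum (λ i → sum λ j → sum λ p → sum λ q → y i p j q)
            ≈⟨ sum-cong (λ i → sum-cong λ j → sum-cong λ p → trans (sum-cong λ q → y-Z i p j q)
                 (∑-ρ² (λ q → Z (i , p) (j , q)))) ⟩
          sum (λ i → sum λ j → sum λ p → ρ * ρ * fromℤ (sumℤ λ q → Z (i , p) (j , q)))
            ≈⟨ sum-cong (λ i → sum-cong λ j → ∑-ρ² (λ p → sumℤ λ q → Z (i , p) (j , q))) ⟩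
          sum (λ i → sum λ j → ρ * ρ * fromℤ (sumℤ λ p → sumℤ λ q → Z (i , p) (j , q)))
            ≈⟨ sum-cong (λ i → ∑-ρ² (λ j → sumℤ λ p → sumℤ λ q → Z (i , p) (j , q))) ⟩
          sum (λ i → ρ * ρ * fromℤ (sumℤ λ j → sumℤ λ p → sumℤ λ q → Z (i , p) (j , q)))
            ≈⟨ ∑-ρ² (λ i → sumℤ λ j → sumℤ λ p → sumℤ λ q → Z (i , p) (j , q)) ⟩
          ρ * ρ * fromℤ (sumℤ λ i → sumℤ λ j → sumℤ λ p → sumℤ λ q → Z (i , p) (j , q))
            ≈⟨ *-congˡ (trans (reflexive (≡.cong fromℤ total)) (fromℤ-* (+ (n ℕ.* n)) K)) ⟩
          ρ * ρ * (fromℤ (+ (n ℕ.* n)) * fromℤ K)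
            ≈⟨ solve 3 (λ r n k → r :* r :* (n :* k) := n :* (r :* r :* k)) refl ρ
              (fromℤ (+ (n ℕ.* n))) (fromℤ K) ⟩
          fromℤ (+ (n ℕ.* n)) * (ρ * ρ * fromℤ K)
            ≈⟨ trans (*-congˡ ρ²K≈1) (*-identityʳ _) ⟩
          fromℤ (+ (n ℕ.* n))
            ∎
      }

    ⟪⟫-moments : ∀ side (C : Fin n → Fin n → ℤ) → let open Cut {n} feasible side in
      ⟪ C , X ⟫ ≈ ρ * ρ * fromℤ (sumℤ λ p → sumℤ λ q →
        C p q ℤ.* sumℤ λ i → sumℤ λ j → α i ℤ.* α j ℤ.* Z (i , p) (j , q))
    ⟪⟫-moments side C = trans
      (⟪⟫-cong {M = C} (λ _ _ → ≡.refl) (λ p q → trans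
        (⟪⟫-cong {M = λ i j → α i ℤ.* α j} (λ _ _ → ≡.refl) (λ i j → y-Z i p j q))
        (⟪⟫-integral (λ i j → α i ℤ.* α j) (λ i j → Z (i , p) (j , q)) (ρ * ρ))))
      (⟪⟫-integral C (λ p q → sumℤ λ i → sumℤ λ j → α i ℤ.* α j ℤ.* Z (i , p) (j , q)) (ρ * ρ))
      where open Cut {n} feasible side

-- The ordered ring of the real numbers

open import Defs
open +-*-Solver using (solve; con; _:+_; _:*_; _:-_; _:=_) renaming (:-_ to ⊖_)

½*-pos : ∀ {ε} → 0ℚ ℚ.< ε → 0ℚ ℚ.< ½ ℚ.* ε
½*-pos {ε} ε>0 = ≡.subst (ℚ._< ½ ℚ.* ε) (ℚ.*-zeroʳ ½) (ℚ.*-monoʳ-<-pos ½ ε>0)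

pos*pos : ∀ {p q} → 0ℚ ℚ.< p → 0ℚ ℚ.< q → 0ℚ ℚ.< p ℚ.* q
pos*pos {p} {q} p>0 q>0 =
  ≡.subst (ℚ._< p ℚ.* q) (ℚ.*-zeroʳ p) (ℚ.*-monoʳ-<-pos p {{ℚ.positive p>0}} q>0)

nonneg*nonneg : ∀ {p q} → 0ℚ ℚ.≤ p → 0ℚ ℚ.≤ q → 0ℚ ℚ.≤ p ℚ.* q
nonneg*nonneg {p} {q} p≥0 q≥0 =
  ≡.subst (ℚ._≤ p ℚ.* q) (ℚ.*-zeroʳ p) (ℚ.*-monoˡ-≤-nonNeg p {{ℚ.nonNegative p≥0}} q≥0)

p≤∣p∣ : ∀ p → p ℚ.≤ ∣ p ∣
p≤∣p∣ p with ℚ.≤-total 0ℚ p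
... | inj₁ 0≤p = ℚ.≤-reflexive (≡.sym (ℚ.0≤p⇒∣p∣≡p 0≤p))
... | inj₂ p≤0 = ℚ.≤-trans p≤0 (ℚ.0≤∣p∣ p)

∣p-q∣≡∣q-p∣ : ∀ p q → ∣ p ℚ.- q ∣ ≡ ∣ q ℚ.- p ∣
∣p-q∣≡∣q-p∣ p q = ≡.trans (≡.sym (ℚ.∣-p∣≡∣p∣ (p ℚ.- q)))
  (≡.cong ∣_∣ (solve 2 (λ p q → ⊖ (p :- q) := q :- p) ≡.refl p q))

∣p-q∣≤r⇒p≤q+r : ∀ p q {r} → ∣ p ℚ.- q ∣ ℚ.≤ r → p ℚ.≤ q ℚ.+ r
∣p-q∣≤r⇒p≤q+r p q {r} le = begin
  p                    ≡⟨ solve 2 (λ p q → p := q :+ (p :- q)) ≡.refl p q ⟩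
  q ℚ.+ (p ℚ.- q)      ≤⟨ ℚ.+-monoʳ-≤ q (ℚ.≤-trans (p≤∣p∣ (p ℚ.- q)) le) ⟩
  q ℚ.+ r              ∎
  where open ℚ.≤-Reasoning

p≤q+r⇒p-q≤r : ∀ p q {r} → p ℚ.≤ q ℚ.+ r → p ℚ.- q ℚ.≤ r
p≤q+r⇒p-q≤r p q {r} le = begin
  p ℚ.- q              ≤⟨ ℚ.+-monoˡ-≤ (ℚ.- q) le ⟩
  q ℚ.+ r ℚ.- q        ≡⟨ solve 2 (λ q r → q :+ r :- q := r) ≡.refl q r ⟩
  r                    ∎
  where open ℚ.≤-Reasoning

∣p-q∣≤r : ∀ p q {r} → p ℚ.≤ q ℚ.+ r → q ℚ.≤ p ℚ.+ r → ∣ p ℚ.- q ∣ ℚ.≤ r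
∣p-q∣≤r p q p≤q+r q≤p+r with ℚ.∣p∣≡p∨∣p∣≡-p (p ℚ.- q)
... | inj₁ eq = ≡.subst (ℚ._≤ _) (≡.sym eq) (p≤q+r⇒p-q≤r p q p≤q+r)
... | inj₂ eq = ≡.subst (ℚ._≤ _)
  (≡.sym (≡.trans eq (solve 2 (λ p q → ⊖ (p :- q) := q :- p) ≡.refl p q))) (p≤q+r⇒p-q≤r q p q≤p+r)

divide : ∀ {p q} → 0ℚ ℚ.< p → 0ℚ ℚ.< q → ∃[ r ] 0ℚ ℚ.< r × r ℚ.* q ≡ p
divide {p} {q} p>0 q>0 =
  p ℚ.* 1/ q , pos*pos p>0 (ℚ.positive⁻¹ (1/ q) {{ℚ.1/pos⇒pos q}}) ,
  ≡.trans (ℚ.*-assoc p (1/ q) q) (≡.trans (≡.cong (p ℚ.*_) (ℚ.*-inverseˡ q)) (ℚ.*-identityʳ p))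
  where
  instance
    q-positive : ℚ.Positive q
    q-positive = ℚ.positive q>0
    q-nonZero : ℚ.NonZero q
    q-nonZero = ℚ.pos⇒nonZero q

infix 4 _≐_ _≼_

-- _≈_ and _≤_ as record types, from which Agda can infer the two numbers
-- compared.
record _≐_ (x y : ℝ) : Set where
  constructor ≐⟨_⟩
  field ≐⇒≈ : x ≈ y

record _≼_ (x y : ℝ) : Set where
  constructor ≼⟨_⟩
  field ≼⇒≤ : x ≤ y

open _≐_ public
open _≼_ public

≼-pointwise : ∀ {x y} → (∀ n → seq x n ℚ.≤ seq y n) → x ≼ y
≼-pointwise {x} {y} x≤y = ≼⟨ (λ ε ε>0 → 0 , λ n _ → begin
  seq x n              ≤⟨ x≤y n ⟩
  seq y n              ≡⟨ ≡.sym (ℚ.+-identityʳ (seq y n)) ⟩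
  seq y n ℚ.+ 0ℚ       ≤⟨ ℚ.+-monoʳ-≤ (seq y n) (ℚ.<⇒≤ ε>0) ⟩
  seq y n ℚ.+ ε        ∎) ⟩
  where open ℚ.≤-Reasoning

≼-trans : ∀ {x y z} → x ≼ y → y ≼ z → x ≼ z
≼-trans {x} {y} {z} ≼⟨ x≤y ⟩ ≼⟨ y≤z ⟩ = ≼⟨ (λ ε ε>0 →
  let M , x≤ = x≤y (½ ℚ.* ε) (½*-pos ε>0)
      N , y≤ = y≤z (½ ℚ.* ε) (½*-pos ε>0)
  in M ℕ.⊔ N , λ n MN≤n → begin
  seq x n                              ≤⟨ x≤ n (ℕ.m⊔n≤o⇒m≤o M N MN≤n) ⟩
  seq y n ℚ.+ ½ ℚ.* ε                  ≤⟨ ℚ.+-monoˡ-≤ (½ ℚ.* ε) (y≤ n (ℕ.m⊔n≤o⇒n≤o M N MN≤n)) ⟩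
  seq z n ℚ.+ ½ ℚ.* ε ℚ.+ ½ ℚ.* ε
    ≡⟨ solve 2 (λ z ε → z :+ con ½ :* ε :+ con ½ :* ε := z :+ ε) ≡.refl (seq z n) ε ⟩
  seq z n ℚ.+ ε                        ∎) ⟩
  where open ℚ.≤-Reasoning

≼-antisym : ∀ {x y} → x ≼ y → y ≼ x → x ≐ y
≼-antisym {x} {y} ≼⟨ x≤y ⟩ ≼⟨ y≤x ⟩ = ≐⟨ (λ ε ε>0 →
  let M , x≤ = x≤y ε ε>0
      N , y≤ = y≤x ε ε>0
  in M ℕ.⊔ N , λ n MN≤n →
     ∣p-q∣≤r (seq x n) (seq y n) (x≤ n (ℕ.m⊔n≤o⇒m≤o M N MN≤n)) (y≤ n (ℕ.m⊔n≤o⇒n≤o M N MN≤n))) ⟩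

≼-reflexive : ∀ {x y} → x ≐ y → x ≼ y
≼-reflexive {x} {y} ≐⟨ x≈y ⟩ = ≼⟨ (λ ε ε>0 →
  let N , close = x≈y ε ε>0 in N , λ n N≤n → ∣p-q∣≤r⇒p≤q+r (seq x n) (seq y n) (close n N≤n)) ⟩

≐-sym : ∀ {x y} → x ≐ y → y ≐ x
≐-sym {x} {y} ≐⟨ x≈y ⟩ = ≐⟨ (λ ε ε>0 →
  let N , close = x≈y ε ε>0 in
  N , λ n N≤n → ≡.subst (ℚ._≤ ε) (∣p-q∣≡∣q-p∣ (seq x n) (seq y n)) (close n N≤n)) ⟩

≐-pointwise : ∀ {x y} → (∀ n → seq x n ≡ seq y n) → x ≐ y
≐-pointwise x≡y = ≼-antisym
  (≼-pointwise λ n → ℚ.≤-reflexive (x≡y n))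
  (≼-pointwise λ n → ℚ.≤-reflexive (≡.sym (x≡y n)))

≐-refl : ∀ {x} → x ≐ x
≐-refl = ≐-pointwise λ _ → ≡.refl

≐-reflexive : ∀ {x y} → x ≡ y → x ≐ y
≐-reflexive ≡.refl = ≐-refl

≐-trans : ∀ {x y z} → x ≐ y → y ≐ z → x ≐ z
≐-trans x≐y y≐z = ≼-antisym
  (≼-trans (≼-reflexive x≐y) (≼-reflexive y≐z))
  (≼-trans (≼-reflexive (≐-sym y≐z)) (≼-reflexive (≐-sym x≐y)))

≐-isEquivalence : IsEquivalence _≐_
≐-isEquivalence = record { refl = ≐-refl ; sym = ≐-sym ; trans = ≐-trans }

≐-setoid : Setoid 0ℓ 0ℓ
≐-setoid = record { isEquivalence = ≐-isEquivalence }

open Consequences ≐-setoid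
  using (comm∧idˡ⇒id; comm∧invˡ⇒inv; comm∧distrʳ⇒distr)

bounded : ∀ x → ∃[ B ] 0ℚ ℚ.< B × (∃[ N ] ∀ n → N ℕ.≤ n → ∣ seq x n ∣ ℚ.≤ B)
bounded x with cauchy x 1ℚ (ℚ.positive⁻¹ 1ℚ)
... | N , close =
  ∣ seq x N ∣ ℚ.+ 1ℚ , ℚ.+-mono-≤-< (ℚ.0≤∣p∣ (seq x N)) (ℚ.positive⁻¹ 1ℚ) , N , λ n N≤n → begin
  ∣ seq x n ∣
    ≡⟨ ≡.cong ∣_∣ (solve 2 (λ a b → a := b :+ (a :- b)) ≡.refl (seq x n) (seq x N)) ⟩
  ∣ seq x N ℚ.+ (seq x n ℚ.- seq x N) ∣
    ≤⟨ ℚ.∣p+q∣≤∣p∣+∣q∣ (seq x N) (seq x n ℚ.- seq x N) ⟩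
  ∣ seq x N ∣ ℚ.+ ∣ seq x n ℚ.- seq x N ∣
    ≤⟨ ℚ.+-monoʳ-≤ ∣ seq x N ∣ (close n N N≤n ℕ.≤-refl) ⟩
  ∣ seq x N ∣ ℚ.+ 1ℚ
    ∎
  where open ℚ.≤-Reasoning

fromℤℚ-+ : ∀ a b → (a ℤ.+ b) ℚ./ 1 ≡ a ℚ./ 1 ℚ.+ b ℚ./ 1
fromℤℚ-+ a b = ℚ.toℚᵘ-injective (begin
  ℚ.toℚᵘ ((a ℤ.+ b) ℚ./ 1)                          ≈⟨ ℚ.toℚᵘ-fromℚᵘ (ℚᵘ.mkℚᵘ (a ℤ.+ b) 0) ⟩
  ℚᵘ.mkℚᵘ (a ℤ.+ b) 0
    ≡⟨ ≡.cong (λ c → ℚᵘ.mkℚᵘ c 0) (≡.sym (≡.cong₂ ℤ._+_ (ℤ.*-identityʳ a) (ℤ.*-identityʳ b))) ⟩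
  ℚᵘ.mkℚᵘ a 0 ℚᵘ.+ ℚᵘ.mkℚᵘ b 0
    ≈⟨ ℚᵘ.+-cong (ℚ.toℚᵘ-fromℚᵘ (ℚᵘ.mkℚᵘ a 0)) (ℚ.toℚᵘ-fromℚᵘ (ℚᵘ.mkℚᵘ b 0)) ⟨
  ℚ.toℚᵘ (a ℚ./ 1) ℚᵘ.+ ℚ.toℚᵘ (b ℚ./ 1)            ≈⟨ ℚ.toℚᵘ-homo-+ (a ℚ./ 1) (b ℚ./ 1) ⟨
  ℚ.toℚᵘ (a ℚ./ 1 ℚ.+ b ℚ./ 1)                      ∎)
  where open ℚᵘ.≃-Reasoning

fromℤℚ-* : ∀ a b → (a ℤ.* b) ℚ./ 1 ≡ (a ℚ./ 1) ℚ.* (b ℚ./ 1)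
fromℤℚ-* a b = ℚ.toℚᵘ-injective (begin
  ℚ.toℚᵘ ((a ℤ.* b) ℚ./ 1)                          ≈⟨ ℚ.toℚᵘ-fromℚᵘ (ℚᵘ.mkℚᵘ (a ℤ.* b) 0) ⟩
  ℚᵘ.mkℚᵘ a 0 ℚᵘ.* ℚᵘ.mkℚᵘ b 0
    ≈⟨ ℚᵘ.*-cong (ℚ.toℚᵘ-fromℚᵘ (ℚᵘ.mkℚᵘ a 0)) (ℚ.toℚᵘ-fromℚᵘ (ℚᵘ.mkℚᵘ b 0)) ⟨
  ℚ.toℚᵘ (a ℚ./ 1) ℚᵘ.* ℚ.toℚᵘ (b ℚ./ 1)            ≈⟨ ℚ.toℚᵘ-homo-* (a ℚ./ 1) (b ℚ./ 1) ⟨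
  ℚ.toℚᵘ ((a ℚ./ 1) ℚ.* (b ℚ./ 1))                  ∎)
  where open ℚᵘ.≃-Reasoning

fromℤℚ-≤ : ∀ {a b} → a ℤ.≤ b → a ℚ./ 1 ℚ.≤ b ℚ./ 1
fromℤℚ-≤ {a} {b} a≤b = ℚ.toℚᵘ-cancel-≤
  (ℚᵘ.≤-respˡ-≃ (ℚᵘ.≃-sym (ℚ.toℚᵘ-fromℚᵘ (ℚᵘ.mkℚᵘ a 0)))
  (ℚᵘ.≤-respʳ-≃ (ℚᵘ.≃-sym (ℚ.toℚᵘ-fromℚᵘ (ℚᵘ.mkℚᵘ b 0)))
    (ℚᵘ.*≤* (ℤ.*-monoʳ-≤-nonNeg (+ 1) a≤b))))

nonneg-square : ∀ p → 0ℚ ℚ.≤ p ℚ.* p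
nonneg-square p with ℚ.≤-total 0ℚ p
... | inj₁ p≥0 = nonneg*nonneg p≥0 p≥0
... | inj₂ p≤0 = ≡.subst (0ℚ ℚ.≤_) (solve 1 (λ p → ⊖ p :* ⊖ p := p :* p) ≡.refl p)
                   (nonneg*nonneg (ℚ.neg-antimono-≤ p≤0) (ℚ.neg-antimono-≤ p≤0))


infixl 6 _⊕_
infixl 7 _⊛_

-- Opaque copies of the operations: unfolding them would make Agda compare
-- the proofs of the Cauchy property.
abstract

  _⊕_ _⊛_ : ℝ → ℝ → ℝ
  _⊕_ = _+_
  _⊛_ = _*_

  negate : ℝ → ℝ
  negate = -_

  ι : ℤ → ℝ
  ι a = fromℚ (a ℚ./ 1)

  +≐⊕ : ∀ x y → x + y ≐ x ⊕ y
  +≐⊕ x y = ≐-pointwise λ _ → ≡.refl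

  *≐⊛ : ∀ x y → x * y ≐ x ⊛ y
  *≐⊛ x y = ≐-pointwise λ _ → ≡.refl

  -≐negate : ∀ x → - x ≐ negate x
  -≐negate x = ≐-pointwise λ _ → ≡.refl

  fromℚ≐ι : ∀ a → fromℚ (a ℚ./ 1) ≐ ι a
  fromℚ≐ι a = ≐-pointwise λ _ → ≡.refl

  ⊕-mono-≼ : ∀ {x y u v} → x ≼ y → u ≼ v → x ⊕ u ≼ y ⊕ v
  ⊕-mono-≼ {x} {y} {u} {v} ≼⟨ x≤y ⟩ ≼⟨ u≤v ⟩ = ≼⟨ (λ ε ε>0 →
    let M , x≤ = x≤y (½ ℚ.* ε) (½*-pos ε>0)
        N , u≤ = u≤v (½ ℚ.* ε) (½*-pos ε>0)
    in M ℕ.⊔ N , λ n MN≤n → begin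
    seq x n ℚ.+ seq u n
      ≤⟨ ℚ.+-mono-≤ (x≤ n (ℕ.m⊔n≤o⇒m≤o M N MN≤n)) (u≤ n (ℕ.m⊔n≤o⇒n≤o M N MN≤n)) ⟩
    (seq y n ℚ.+ ½ ℚ.* ε) ℚ.+ (seq v n ℚ.+ ½ ℚ.* ε)
      ≡⟨ solve 3 (λ y v ε → (y :+ con ½ :* ε) :+ (v :+ con ½ :* ε) := y :+ v :+ ε) ≡.refl
        (seq y n) (seq v n) ε ⟩
    seq y n ℚ.+ seq v n ℚ.+ ε
      ∎) ⟩
    where open ℚ.≤-Reasoning

  ⊕-cong : ∀ {x y u v} → x ≐ y → u ≐ v → x ⊕ u ≐ y ⊕ v
  ⊕-cong {x} {y} {u} {v} x≐y u≐v = ≼-antisym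
    (⊕-mono-≼ {x} {y} {u} {v} (≼-reflexive x≐y) (≼-reflexive u≐v))
    (⊕-mono-≼ {y} {x} {v} {u} (≼-reflexive (≐-sym x≐y)) (≼-reflexive (≐-sym u≐v)))

  negate-cong : ∀ {x y} → x ≐ y → negate x ≐ negate y
  negate-cong {x} {y} ≐⟨ x≈y ⟩ = ≐⟨ (λ ε ε>0 →
    let N , close = x≈y ε ε>0 in
    N , λ n N≤n → ≡.subst (ℚ._≤ ε)
      (≡.trans (∣p-q∣≡∣q-p∣ (seq x n) (seq y n))
             (≡.cong ∣_∣ (solve 2 (λ a b → b :- a := ⊖ a :- ⊖ b) ≡.refl (seq x n) (seq y n))))
      (close n N≤n)) ⟩

  ⊛-congʳ : ∀ {x y} z → x ≐ y → x ⊛ z ≐ y ⊛ z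
  ⊛-congʳ {x} {y} z ≐⟨ x≈y ⟩ = ≐⟨ (λ ε ε>0 →
    let B , B>0 , M , z≤B = bounded z
        δ , δ>0 , δB≡ε = divide ε>0 B>0
        N , close = x≈y δ δ>0
    in M ℕ.⊔ N , λ n MN≤n → begin
    ∣ seq x n ℚ.* seq z n ℚ.- seq y n ℚ.* seq z n ∣
      ≡⟨ ≡.cong ∣_∣ (solve 3 (λ a b c → a :* c :- b :* c := (a :- b) :* c) ≡.refl (seq x n)
        (seq y n) (seq z n)) ⟩
    ∣ (seq x n ℚ.- seq y n) ℚ.* seq z n ∣
      ≡⟨ ℚ.∣p*q∣≡∣p∣*∣q∣ (seq x n ℚ.- seq y n) (seq z n) ⟩
    ∣ seq x n ℚ.- seq y n ∣ ℚ.* ∣ seq z n ∣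
      ≤⟨ ℚ.*-monoʳ-≤-nonNeg ∣ seq z n ∣ {{ℚ.nonNegative (ℚ.0≤∣p∣ (seq z n))}}
        (close n (ℕ.m⊔n≤o⇒n≤o M N MN≤n)) ⟩
    δ ℚ.* ∣ seq z n ∣
      ≤⟨ ℚ.*-monoˡ-≤-nonNeg δ {{ℚ.nonNegative (ℚ.<⇒≤ δ>0)}} (z≤B n (ℕ.m⊔n≤o⇒m≤o M N MN≤n)) ⟩
    δ ℚ.* B
      ≡⟨ δB≡ε ⟩
    ε ∎) ⟩
    where open ℚ.≤-Reasoning

  ⊛-comm : ∀ x y → x ⊛ y ≐ y ⊛ x
  ⊛-comm x y = ≐-pointwise λ n → ℚ.*-comm (seq x n) (seq y n)

  ⊛-cong : ∀ {x y u v} → x ≐ y → u ≐ v → x ⊛ u ≐ y ⊛ v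
  ⊛-cong {x} {y} {u} {v} x≐y u≐v =
    ≐-trans {y = y ⊛ u} (⊛-congʳ {x} {y} u x≐y)
    (≐-trans {y = u ⊛ y} (⊛-comm y u)
    (≐-trans {y = v ⊛ y} (⊛-congʳ {u} {v} y u≐v) (⊛-comm v y)))

  arch : ∀ {x c} → (∀ t → ι 0ℤ ≼ fromℚ t ⊛ x ⊕ c) → ι 0ℤ ≼ x
  arch {x} {c} nonneg = ≼⟨ (λ ε ε>0 →
    let B , B>0 , M , c≤B = bounded c
        -- `t` is so large that `t ε` absorbs both the bound `B` on `c` and the tolerance 1 with
        -- which the hypothesis is read.
        t , t>0 , tε≡B+1 = divide (ℚ.+-mono-< B>0 (ℚ.positive⁻¹ 1ℚ)) ε>0
        N , tx+c≥ = ≼⇒≤ (nonneg t) 1ℚ (ℚ.positive⁻¹ 1ℚ)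
    in M ℕ.⊔ N , λ n MN≤n →
    ℚ.*-cancelˡ-≤-pos t {{ℚ.positive t>0}} (begin
      t ℚ.* 0ℚ                                       ≡⟨ ℚ.*-zeroʳ t ⟩
      0ℚ                                             ≤⟨ tx+c≥ n (ℕ.m⊔n≤o⇒n≤o M N MN≤n) ⟩
      t ℚ.* seq x n ℚ.+ seq c n ℚ.+ 1ℚ
        ≤⟨ ℚ.+-monoˡ-≤ 1ℚ (ℚ.+-monoʳ-≤ (t ℚ.* seq x n)
             (ℚ.≤-trans (p≤∣p∣ (seq c n)) (c≤B n (ℕ.m⊔n≤o⇒m≤o M N MN≤n)))) ⟩
      t ℚ.* seq x n ℚ.+ B ℚ.+ 1ℚ                     ≡⟨ ℚ.+-assoc (t ℚ.* seq x n) B 1ℚ ⟩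
      t ℚ.* seq x n ℚ.+ (B ℚ.+ 1ℚ)
        ≡⟨ ≡.cong (t ℚ.* seq x n ℚ.+_) (≡.sym tε≡B+1) ⟩
      t ℚ.* seq x n ℚ.+ t ℚ.* ε                      ≡⟨ ≡.sym (ℚ.*-distribˡ-+ t (seq x n) ε) ⟩
      t ℚ.* (seq x n ℚ.+ ε)                          ∎)) ⟩
    where open ℚ.≤-Reasoning

  ℝ-vanishing : ∀ {x c} → (∀ t → ι 0ℤ ≼ t ⊛ (x ⊕ x) ⊕ c) → x ≐ ι 0ℤ
  -- `arch` is applied to `x` and to `negate x`; the parameters t/2 and -t/2 undo the doubling in
  -- `x ⊕ x` and provide the two signs.
  ℝ-vanishing {x} {c} nonneg = ≼-antisym
    (≼-trans {y = negate (negate x)}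
      (≼-reflexive (≐-pointwise λ n → solve 1 (λ a → a := ⊖ ⊖ a) ≡.refl (seq x n)))
      (≼-neg (arch {c = c} λ t → ≼-trans {y = fromℚ (½ ℚ.* ℚ.- t) ⊛ (x ⊕ x) ⊕ c}
        (nonneg (fromℚ (½ ℚ.* ℚ.- t)))
        (≼-reflexive (≐-pointwise λ n → solve 3
          (λ t a c → con ½ :* ⊖ t :* (a :+ a) :+ c := t :* ⊖ a :+ c) ≡.refl t (seq x n)
            (seq c n))))))
    (arch {c = c} λ t → ≼-trans {y = fromℚ (½ ℚ.* t) ⊛ (x ⊕ x) ⊕ c} (nonneg (fromℚ (½ ℚ.* t)))
      (≼-reflexive (≐-pointwise λ n → solve 3
        (λ t a c → con ½ :* t :* (a :+ a) :+ c := t :* a :+ c) ≡.refl t (seq x n) (seq c n))))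
    where
    ≼-neg : ∀ {x} → ι 0ℤ ≼ x → negate x ≼ ι 0ℤ
    ≼-neg {x} x≽0 = ≼-trans {y = negate x ⊕ ι 0ℤ}
      (≼-reflexive (≐-pointwise λ n → ≡.sym (ℚ.+-identityʳ (ℚ.- seq x n))))
      (≼-trans {y = negate x ⊕ x} (⊕-mono-≼ {negate x} {negate x} {ι 0ℤ} {x} (≼-reflexive ≐-refl)
        x≽0)
        (≼-reflexive (≐-pointwise λ n → ℚ.+-inverseˡ (seq x n))))


  ⊕-assoc : ∀ x y z → (x ⊕ y) ⊕ z ≐ x ⊕ (y ⊕ z)
  ⊕-assoc x y z = ≐-pointwise λ n → ℚ.+-assoc (seq x n) (seq y n) (seq z n)

  ⊕-comm : ∀ x y → x ⊕ y ≐ y ⊕ x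
  ⊕-comm x y = ≐-pointwise λ n → ℚ.+-comm (seq x n) (seq y n)

  ⊕-identityˡ : ∀ x → ι 0ℤ ⊕ x ≐ x
  ⊕-identityˡ x = ≐-pointwise λ n → ℚ.+-identityˡ (seq x n)

  ⊕-inverseˡ : ∀ x → negate x ⊕ x ≐ ι 0ℤ
  ⊕-inverseˡ x = ≐-pointwise λ n → ℚ.+-inverseˡ (seq x n)

  ⊛-assoc : ∀ x y z → (x ⊛ y) ⊛ z ≐ x ⊛ (y ⊛ z)
  ⊛-assoc x y z = ≐-pointwise λ n → ℚ.*-assoc (seq x n) (seq y n) (seq z n)

  ⊛-identityˡ : ∀ x → ι 1ℤ ⊛ x ≐ x
  ⊛-identityˡ x = ≐-pointwise λ n → ℚ.*-identityˡ (seq x n)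

  ⊛-distribʳ-⊕ : ∀ x y z → (y ⊕ z) ⊛ x ≐ y ⊛ x ⊕ z ⊛ x
  ⊛-distribʳ-⊕ x y z = ≐-pointwise λ n → ℚ.*-distribʳ-+ (seq x n) (seq y n) (seq z n)

  nonneg-⊛-square : ∀ x → ι 0ℤ ≼ x ⊛ x
  nonneg-⊛-square x = ≼-pointwise λ n → nonneg-square (seq x n)

  ι-+ : ∀ a b → ι (a ℤ.+ b) ≐ ι a ⊕ ι b
  ι-+ a b = ≐-pointwise λ _ → fromℤℚ-+ a b

  ι-* : ∀ a b → ι (a ℤ.* b) ≐ ι a ⊛ ι b
  ι-* a b = ≐-pointwise λ _ → fromℤℚ-* a b

  ι-≼ : ∀ {a b} → a ℤ.≤ b → ι a ≼ ι b
  ι-≼ a≤b = ≼-pointwise λ _ → fromℤℚ-≤ a≤b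

ℝ-commutativeRing : CommutativeRing 0ℓ 0ℓ
ℝ-commutativeRing = record
  { Carrier = ℝ
  ; _≈_ = _≐_
  ; _+_ = _⊕_
  ; _*_ = _⊛_
  ; -_ = negate
  ; 0# = ι 0ℤ
  ; 1# = ι 1ℤ
  ; isCommutativeRing = record
    { isRing = record
      { +-isAbelianGroup = record
        { isGroup = record
          { isMonoid = record
            { isSemigroup = record
              { isMagma = record
                { isEquivalence = ≐-isEquivalence
                ; ∙-cong = ⊕-cong
                }
              ; assoc = ⊕-assoc
              }
            ; identity = comm∧idˡ⇒id ⊕-comm ⊕-identityˡ
            }
          ; inverse = comm∧invˡ⇒inv ⊕-comm ⊕-inverseˡ
          ; ⁻¹-cong = negate-cong
          }
        ; comm = ⊕-comm
        }
      ; *-cong = ⊛-cong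
      ; *-assoc = ⊛-assoc
      ; *-identity = comm∧idˡ⇒id ⊛-comm ⊛-identityˡ
      ; distrib = comm∧distrʳ⇒distr ⊕-cong ⊛-comm ⊛-distribʳ-⊕
      }
    ; *-comm = ⊛-comm
    }
  }

ℝ-orderedRing : OrderedRing
ℝ-orderedRing = record
  { commutativeRing = ℝ-commutativeRing
  ; _≼_             = _≼_
  ; ≼-reflexive     = ≼-reflexive
  ; ≼-trans         = ≼-trans
  ; ≼-antisym       = ≼-antisym
  ; +-mono-≼        = ⊕-mono-≼
  ; nonneg-²        = nonneg-⊛-square
  ; vanishing       = ℝ-vanishing
  ; fromℤ           = ι
  ; fromℤ-1         = ≐-refl
  ; fromℤ-0         = ≐-refl
  ; fromℤ-+         = ι-+
  ; fromℤ-*         = ι-*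
  ; fromℤ-≼         = ι-≼
  }

-- Translation of the program into the ordered ring

module 𝕋 = Theory ℝ-orderedRing
open Algebra.Properties.Semiring.Sum (OrderedRing.semiring ℝ-orderedRing) using () renaming
  (sum to ∑)
open Relation.Binary.Reasoning.Setoid ≐-setoid

sum≐∑ : ∀ {n} (f g : Vector ℝ n) → (∀ i → f i ≐ g i) → sum f ≐ ∑ g
sum≐∑ {zero}  f g f≐g = fromℚ≐ι 0ℤ
sum≐∑ {suc n} f g f≐g = ≐-trans {y = f zero ⊕ sum (λ i → f (suc i))}
  (+≐⊕ (f zero) (sum λ i → f (suc i)))
  (⊕-cong (f≐g zero) (sum≐∑ (λ i → f (suc i)) (λ i → g (suc i)) (λ i → f≐g (suc i))))

*≐⊛-cong : ∀ x y {x′ y′} → x ≐ x′ → y ≐ y′ → x * y ≐ x′ ⊛ y′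
*≐⊛-cong x y x≐x′ y≐y′ = ≐-trans {y = x ⊛ y} (*≐⊛ x y) (⊛-cong x≐x′ y≐y′)

+≐⊕-cong : ∀ x y {x′ y′} → x ≐ x′ → y ≐ y′ → x + y ≐ x′ ⊕ y′
+≐⊕-cong x y x≐x′ y≐y′ = ≐-trans {y = x ⊕ y} (+≐⊕ x y) (⊕-cong x≐x′ y≐y′)

-≐negate-cong : ∀ x {x′} → x ≐ x′ → - x ≐ negate x′
-≐negate-cong x x≐x′ = ≐-trans {y = negate x} (-≐negate x) (negate-cong x≐x′)

trace≐tr : ∀ {m} (A A′ Y : Matrix m m) → (∀ a b → A a b ≐ A′ a b) → trace (A ∙ₘ Y) ≐ 𝕋.tr A′ Y
trace≐tr A A′ Y A≐A′ = sum≐∑ (λ a → sum λ b → A a b * Y b a) (λ a → ∑ λ b → A′ a b ⊛ Y b a) λ a →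
  sum≐∑ (λ b → A a b * Y b a) (λ b → A′ a b ⊛ Y b a) λ b →
    *≐⊛-cong (A a b) (Y b a) (A≐A′ a b) (≐-refl {Y b a})

I≐δ : ∀ {n} (i j : Fin n) → I n i j ≐ 𝕋.δ i j
I≐δ i j with does (i Fin.≟ j)
... | true  = fromℚ≐ι 1ℤ
... | false = fromℚ≐ι 0ℤ

E≐unit : ∀ {n} (k i j : Fin n) → E n k i j ≐ 𝕋.unit k i j
E≐unit k i j with does (i Fin.≟ k ×-dec j Fin.≟ k)
... | true  = fromℚ≐ι 1ℤ
... | false = fromℚ≐ι 0ℤ

J-I≐ : ∀ {n} (i j : Fin n) → (J n ⊟ I n) i j ≐ ι 1ℤ ⊕ negate (𝕋.δ i j)
J-I≐ {n} i j = +≐⊕-cong (J n i j) (- I n i j) (fromℚ≐ι 1ℤ) (-≐negate-cong (I n i j) (I≐δ i j))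

⊗≐kron : ∀ {n} (A A′ B B′ : Matrix n n) → (∀ i j → A i j ≐ A′ i j) → (∀ i j → B i j ≐ B′ i j) →
         ∀ a b → (A ⊗ B) a b ≐ 𝕋.kron A′ B′ a b
⊗≐kron {n} A A′ B B′ A≐A′ B≐B′ a b =
  *≐⊛-cong (A (quotient n a) (quotient n b)) (B (remainder {n} n a) (remainder {n} n b))
    (A≐A′ (quotient n a) (quotient n b)) (B≐B′ (remainder {n} n a) (remainder {n} n b))

module Bridge {n} (r s : Fin (suc n)) (D : Matrix (suc n) (suc n)) (Y : Matrix (n ℕ.* n) (n ℕ.* n)) where

  open SDP₂ r s D

  I⊗E≐ : ∀ k → trace ((I n ⊗ E n k) ∙ₘ Y) ≐ 𝕋.tr (𝕋.kron {n} 𝕋.δ (𝕋.unit k)) Y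
  I⊗E≐ k = trace≐tr (I n ⊗ E n k) (𝕋.kron {n} 𝕋.δ (𝕋.unit k)) Y
    (⊗≐kron (I n) 𝕋.δ (E n k) (𝕋.unit k) I≐δ (E≐unit k))

  E⊗I≐ : ∀ k → trace ((E n k ⊗ I n) ∙ₘ Y) ≐ 𝕋.tr (𝕋.kron {n} (𝕋.unit k) 𝕋.δ) Y
  E⊗I≐ k = trace≐tr (E n k ⊗ I n) (𝕋.kron {n} (𝕋.unit k) 𝕋.δ) Y
    (⊗≐kron (E n k) (𝕋.unit k) (I n) 𝕋.δ (E≐unit k) I≐δ)

  off≐ : trace ((I n ⊗ (J n ⊟ I n) ⊞ (J n ⊟ I n) ⊗ I n) ∙ₘ Y) ≐ 𝕋.tr (𝕋.off-diagonal {n}) Y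
  off≐ = trace≐tr (I n ⊗ (J n ⊟ I n) ⊞ (J n ⊟ I n) ⊗ I n) (𝕋.off-diagonal {n}) Y λ a b →
    +≐⊕-cong ((I n ⊗ (J n ⊟ I n)) a b) (((J n ⊟ I n) ⊗ I n) a b)
      (⊗≐kron (I n) 𝕋.δ (J n ⊟ I n) (λ i j → ι 1ℤ ⊕ negate (𝕋.δ i j)) I≐δ J-I≐ a b)
      (⊗≐kron (J n ⊟ I n) (λ i j → ι 1ℤ ⊕ negate (𝕋.δ i j)) (I n) 𝕋.δ J-I≐ I≐δ a b)

  J⊗J≐ : trace ((J n ⊗ J n) ∙ₘ Y) ≐ 𝕋.tr (𝕋.kron {n} (λ _ _ → ι 1ℤ) (λ _ _ → ι 1ℤ)) Y
  J⊗J≐ = trace≐tr (J n ⊗ J n) (𝕋.kron {n} (λ _ _ → ι 1ℤ) (λ _ _ → ι 1ℤ)) Y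
    (⊗≐kron (J n) (λ _ _ → ι 1ℤ) (J n) (λ _ _ → ι 1ℤ) (λ _ _ → fromℚ≐ι 1ℤ) (λ _ _ → fromℚ≐ι 1ℤ))

  form≐ : ∀ (u : Vector ℝ (n ℕ.* n)) →
          sum (λ a → sum λ b → u a * Y a b * u b) ≐ ∑ (λ a → ∑ λ b → u a ⊛ Y a b ⊛ u b)
  form≐ u = sum≐∑ (λ a → sum λ b → u a * Y a b * u b) (λ a → ∑ λ b → u a ⊛ Y a b ⊛ u b) λ a →
    sum≐∑ (λ b → u a * Y a b * u b) (λ b → u a ⊛ Y a b ⊛ u b) λ b →
    *≐⊛-cong (u a * Y a b) (u b) (*≐⊛ (u a) (Y a b)) (≐-refl {u b})

  fromFeasible : Feasible Y → 𝕋.Feasible {n} Y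
  fromFeasible F = record
    { symm   = λ a b → ≐⟨ Feasible.symm F a b ⟩
    ; nonneg = λ a b → ≼-trans (≼-reflexive (≐-sym (fromℚ≐ι 0ℤ))) ≼⟨ Feasible.nonneg F a b ⟩
    ; psd    = λ u → ≼-trans (≼-reflexive (≐-sym (fromℚ≐ι 0ℤ)))
                    (≼-trans ≼⟨ Feasible.psd F u ⟩ (≼-reflexive (form≐ u)))
    ; I⊗E    = λ k → ≐-trans (≐-sym (I⊗E≐ k)) (≐-trans ≐⟨ Feasible.I⊗E F k ⟩ (fromℚ≐ι 1ℤ))
    ; E⊗I    = λ k → ≐-trans (≐-sym (E⊗I≐ k)) (≐-trans ≐⟨ Feasible.E⊗I F k ⟩ (fromℚ≐ι 1ℤ))
    ; off    = ≐-trans (≐-sym off≐) (≐-trans ≐⟨ Feasible.off-diagonal F ⟩ (fromℚ≐ι 0ℤ))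
    ; J⊗J    = ≐-trans (≐-sym J⊗J≐) (≐-trans ≐⟨ Feasible.J⊗J F ⟩ (fromℚ≐ι (+ (n ℕ.* n))))
    }

  toFeasible : 𝕋.Feasible {n} Y → Feasible Y
  toFeasible F = record
    { symm   = λ a b → ≐⇒≈ (𝕋.Feasible.symm F a b)
    ; nonneg = λ a b → ≼⇒≤ (≼-trans (≼-reflexive (fromℚ≐ι 0ℤ)) (𝕋.Feasible.nonneg F a b))
    ; psd    = λ u → ≼⇒≤ (≼-trans (≼-reflexive (fromℚ≐ι 0ℤ))
                    (≼-trans (𝕋.Feasible.psd F u) (≼-reflexive (≐-sym (form≐ u)))))
    ; I⊗E    = λ k → ≐⇒≈ (≐-trans (I⊗E≐ k) (≐-trans (𝕋.Feasible.I⊗E F k) (≐-sym (fromℚ≐ι 1ℤ))))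
    ; E⊗I    = λ k → ≐⇒≈ (≐-trans (E⊗I≐ k) (≐-trans (𝕋.Feasible.E⊗I F k) (≐-sym (fromℚ≐ι 1ℤ))))
    ; off-diagonal = ≐⇒≈ (≐-trans off≐ (≐-trans (𝕋.Feasible.off F) (≐-sym (fromℚ≐ι 0ℤ))))
    ; J⊗J    = ≐⇒≈ (≐-trans J⊗J≐ (≐-trans (𝕋.Feasible.J⊗J F) (≐-sym (fromℚ≐ι (+ (n ℕ.* n))))))
    }

-- The optimal matrix and the dual certificate for seven vertices

-- The index of a position on the path that remains of the 7-cycle after the
-- removal of r.
pathIndex : Fin 7 → Fin 6 → Fin 6
-- `punchIn r` sends r, ..., 5 to r + 1, ..., 6 and fixes the smaller indices, so the path starts at
-- index r and, past index 5, continues at 0.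
pathIndex r p = (toℕ p ℕ.+ (6 ℕ.∸ toℕ r)) mod 6

table : Vec (Vec ℤ 6) 6 → Fin 6 → Fin 6 → ℤ
table T p q = lookup (lookup T p) q

side : Fin 6 → Bool
side i = toℕ i ℕ.<ᵇ 3

-- 8 times the optimal X, with the positions in the order of the path.
X₈ : Fin 6 → Fin 6 → ℤ
X₈ = table
  ( (+ 2 ∷ + 2 ∷ + 1 ∷ + 0 ∷ + 0 ∷ + 1 ∷ [])
  ∷ (+ 2 ∷ + 4 ∷ + 4 ∷ + 2 ∷ + 0 ∷ + 0 ∷ [])
  ∷ (+ 1 ∷ + 4 ∷ + 6 ∷ + 5 ∷ + 2 ∷ + 0 ∷ [])
  ∷ (+ 0 ∷ + 2 ∷ + 5 ∷ + 6 ∷ + 4 ∷ + 1 ∷ [])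
  ∷ (+ 0 ∷ + 0 ∷ + 2 ∷ + 4 ∷ + 4 ∷ + 2 ∷ [])
  ∷ (+ 1 ∷ + 0 ∷ + 0 ∷ + 1 ∷ + 2 ∷ + 2 ∷ [])
  ∷ [])

-- The same moments for the complementary set of positions, from the expansion of (1 - x p)(1 - x q)
-- with x p = x p · x p.
X̄₈ : Fin 6 → Fin 6 → ℤ
X̄₈ p q = + 8 ℤ.- X₈ p p ℤ.- X₈ q q ℤ.+ X₈ p q

-- 144 times the lift of X₈ / 8 that is invariant under the permutations of the
-- vertices of each cluster.
Z₀ : Fin 6 × Fin 6 → Fin 6 × Fin 6 → ℤ
Z₀ (i , p) (j , q) with does (i Fin.≟ j) | does (p Fin.≟ q)
-- Since 144 / 8 = 18, the factors 6, 3 and 2 are 18 divided by the number of vertex choices over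
-- which an entry is spread: 3 vertices of a cluster, 6 ordered pairs of distinct ones, 9 pairs
-- across. The denominators 24, 48 and 72 have least common multiple 144.
... | true  | true  = if side i then + 6 ℤ.* X₈ p p else + 6 ℤ.* X̄₈ p p
... | true  | false = 0ℤ
... | false | true  = 0ℤ
... | false | false with side i | side j
...   | true  | true  = + 3 ℤ.* X₈ p q
...   | true  | false = + 2 ℤ.* (X₈ p p ℤ.- X₈ p q)
...   | false | true  = + 2 ℤ.* (X₈ q q ℤ.- X₈ p q)
...   | false | false = + 3 ℤ.* X̄₈ p q

pairs : List (Fin 6) → List (Fin 6 × Fin 6)
pairs []       = []
pairs (i ∷ is) = map (i ,_) is ++ pairs is

e- : Fin 6 → Fin 6 → Fin 6 → ℤ
e- i j k = ⟦ does (k Fin.≟ i) ⟧ ℤ.- ⟦ does (k Fin.≟ j) ⟧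

-- The first three squares come from X₈ = v₁v₁ᵀ + ½ v₂v₂ᵀ + ½ v₃v₃ᵀ.  On vectors
-- that sum to 0 over the vertices of each cluster, Z₀ is a multiple of the graph
-- Laplacian with edge weights X₈ or X̄₈, because the off-diagonal row sums of these
-- matrices are twice the diagonal; this gives the squares of differences.
squares₀ : List (ℕ × (Fin 6 × Fin 6 → ℤ))
squares₀ =
    (2 , λ (i , p) → sign i ℤ.* lookup v₁ p)
  -- The diagonal of `X₈` is 2 `v₂`, and that of `X̄₈` is 2 (4 - `v₂`). Passing to the other cluster
  -- thus replaces `v₂` by 4 - `v₂` and reverses the sign of `v₁` and `v₃`.
  ∷ (1 , λ (i , p) → if side i then lookup v₂ p else + 4 ℤ.- lookup v₂ p)
  ∷ (1 , λ (i , p) → sign i ℤ.* lookup v₃ p)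
  ∷ differences X₈ (0F ∷ 1F ∷ 2F ∷ []) ++ differences X̄₈ (3F ∷ 4F ∷ 5F ∷ [])
  where
  sign : Fin 6 → ℤ
  sign i = if side i then 1ℤ else -[1+ 0 ]

  v₁ v₂ v₃ : Vec ℤ 6
  v₁ = + 1 ∷ + 0 ∷ -[1+ 0 ] ∷ -[1+ 0 ] ∷ + 0 ∷ + 1 ∷ []
  v₂ = + 1 ∷ + 2 ∷ + 3 ∷ + 3 ∷ + 2 ∷ + 1 ∷ []
  v₃ = + 1 ∷ + 2 ∷ + 1 ∷ -[1+ 0 ] ∷ -[1+ 1 ] ∷ -[1+ 0 ] ∷ []

  differences : (Fin 6 → Fin 6 → ℤ) → List (Fin 6) → List (ℕ × (Fin 6 × Fin 6 → ℤ))
  differences X vertices = concatMap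
    -- The weights are nonnegative, so `ℤ.∣_∣` merely reads them as natural numbers.
    (λ (i , j) → map (λ (p , q) → ℤ.∣ X p q ∣ , λ (k , l) → e- i j k ℤ.* e- p q l)
                     (pairs (0F ∷ 1F ∷ 2F ∷ 3F ∷ 4F ∷ 5F ∷ [])))
    (pairs vertices)

sos₀ : ∀ i p j q → Z₀ (i , p) (j , q) ≡ sumOfSquares squares₀ (i , p) (j , q)
sos₀ = toWitness {a? = Fin.all? λ i → Fin.all? λ p → Fin.all? λ j → Fin.all? λ q →
  Z₀ (i , p) (j , q) ℤ.≟ sumOfSquares squares₀ (i , p) (j , q)} _

-- The decomposition is checked once, in path order, and pulled back along `onPath r` for each `r`.
sumOfSquares-map : ∀ {A B : Set} (f : A → B) (L : List (ℕ × (B → ℤ))) v w →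
  sumOfSquares (map (map₂ (_∘ f)) L) v w ≡ sumOfSquares L (f v) (f w)
sumOfSquares-map f []            v w = ≡.refl
sumOfSquares-map f ((c , u) ∷ L) v w = ≡.cong (λ z → + c ℤ.* (u (f v) ℤ.* u (f w)) ℤ.+ z)
  (sumOfSquares-map f L v w)

onPath : Fin 7 → Fin 6 × Fin 6 → Fin 6 × Fin 6
onPath r (i , p) = i , pathIndex r p

Z : Fin 7 → Fin 6 × Fin 6 → Fin 6 × Fin 6 → ℤ
Z r v w = Z₀ (onPath r v) (onPath r w)

nonneg₀ : ∀ i p j q → 0ℤ ℤ.≤ Z₀ (i , p) (j , q)
nonneg₀ = toWitness {a? = Fin.all? λ i → Fin.all? λ p → Fin.all? λ j → Fin.all? λ q →
  0ℤ ℤ.≤? Z₀ (i , p) (j , q)} _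

Z-witness : ∀ r → IntegralWitness 6 (+ 144) (Z r)
Z-witness r = record
  { squares       = map (map₂ (_∘ onPath r)) squares₀
  ; sos           = λ (i , p) (j , q) → ≡.trans (sos₀ i (pathIndex r p) j (pathIndex r q))
      (≡.sym (sumOfSquares-map (onPath r) squares₀ (i , p) (j , q)))
  ; nonneg        = λ (i , p) (j , q) → nonneg₀ i (pathIndex r p) j (pathIndex r q)
  ; vertex        = toWitness {a? = Fin.all? λ r → Fin.all? λ p →
      (sumℤ λ i → Z r (i , p) (i , p)) ℤ.≟ + 144} _ r
  ; position      = toWitness {a? = Fin.all? λ r → Fin.all? λ i →
      (sumℤ λ p → Z r (i , p) (i , p)) ℤ.≟ + 144} _ r
  ; same-vertex   = toWitness {a? = Fin.all? λ r → Fin.all? λ i → Fin.all? λ p → Fin.all? λ q →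
      ¬? (p Fin.≟ q) →-dec (Z r (i , p) (i , q) ℤ.≟ 0ℤ)} _ r
  ; same-position = toWitness {a? = Fin.all? λ r → Fin.all? λ i → Fin.all? λ j → Fin.all? λ p →
      ¬? (i Fin.≟ j) →-dec (Z r (i , p) (j , p) ℤ.≟ 0ℤ)} _ r
  ; total         = toWitness {a? = Fin.all? λ r →
      (sumℤ λ i → sumℤ λ j → sumℤ λ p → sumℤ λ q → Z r (i , p) (j , q)) ℤ.≟ + 36 ℤ.* + 144} _ r
  }

module _ {n : ℕ} (r : Fin (suc n)) where

  C : Fin n → Fin n → ℤ
  C p q = ⟦ does (adjacent? (punchIn r p) (punchIn r q)) ⟧

  C₀ : Fin n → ℤ
  C₀ p = ⟦ does (adjacent? (punchIn r p) r) ⟧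

degree₇ : ∀ r p → sumℤ (C {6} r p) ℤ.+ C₀ r p ≡ + 2
degree₇ = toWitness {a? = Fin.all? λ r → Fin.all? λ p → sumℤ (C {6} r p) ℤ.+ C₀ r p ℤ.≟ + 2} _

-- 612 / 144 = 17/4, which is twice the sum 2 + 4 + 5 + 4 + 2 of the entries of `X₈` next to the
-- diagonal, divided by 8. The objective is therefore 6 - 17/4 = 7/4.
Z-value : ∀ r → (sumℤ λ p → sumℤ λ q → C r p q ℤ.* sumℤ λ i → sumℤ λ j →
  ⟦ side i ⟧ ℤ.* ⟦ side j ⟧ ℤ.* Z r (i , p) (j , q)) ≡ + 612
Z-value = toWitness {a? = Fin.all? λ r → (sumℤ λ p → sumℤ λ q → C r p q ℤ.* sumℤ λ i → sumℤ λ j →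
  ⟦ side i ⟧ ℤ.* ⟦ side j ⟧ ℤ.* Z r (i , p) (j , q)) ℤ.≟ + 612} _

module _ (r : Fin 7) where

  -- The multipliers solve the dual problem scaled by 16.  By complementary
  -- slackness they are supported on the inequalities that are tight for X₈, and
  -- v, v′ lie in the kernel of X₈.
  μ : Fin 6 → ℤ
  μ p = lookup (+ 0 ∷ -[1+ 3 ] ∷ -[1+ 3 ] ∷ -[1+ 3 ] ∷ -[1+ 3 ] ∷ + 0 ∷ []) (pathIndex r p)

  v v′ : Fin 6 → ℤ
  v  p = lookup (+ 0 ∷ + 0 ∷ + 1 ∷ -[1+ 1 ] ∷ + 2 ∷ -[1+ 0 ] ∷ []) (pathIndex r p)
  v′ p = lookup (-[1+ 0 ] ∷ + 2 ∷ -[1+ 1 ] ∷ + 1 ∷ + 0 ∷ + 0 ∷ []) (pathIndex r p)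

  Λ-nonneg Λ-diagonal Λ-covering : Fin 6 → Fin 6 → ℤ
  Λ-nonneg p q = table
    ( (+ 0 ∷ + 0 ∷ + 0 ∷ + 5 ∷ + 4 ∷ + 0 ∷ [])
    ∷ (+ 0 ∷ + 0 ∷ + 0 ∷ + 0 ∷ + 8 ∷ + 4 ∷ [])
    ∷ (+ 0 ∷ + 0 ∷ + 0 ∷ + 0 ∷ + 0 ∷ + 5 ∷ [])
    ∷ (+ 5 ∷ + 0 ∷ + 0 ∷ + 0 ∷ + 0 ∷ + 0 ∷ [])
    ∷ (+ 4 ∷ + 8 ∷ + 0 ∷ + 0 ∷ + 0 ∷ + 0 ∷ [])
    ∷ (+ 0 ∷ + 4 ∷ + 5 ∷ + 0 ∷ + 0 ∷ + 0 ∷ [])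
    ∷ []) (pathIndex r p) (pathIndex r q)
  Λ-diagonal p q = table
    ( (+ 0 ∷ + 8 ∷ + 0 ∷ + 0 ∷ + 0 ∷ + 0 ∷ [])
    ∷ (+ 0 ∷ + 0 ∷ + 0 ∷ + 0 ∷ + 0 ∷ + 0 ∷ [])
    ∷ (+ 0 ∷ + 0 ∷ + 0 ∷ + 0 ∷ + 0 ∷ + 0 ∷ [])
    ∷ (+ 0 ∷ + 0 ∷ + 0 ∷ + 0 ∷ + 0 ∷ + 0 ∷ [])
    ∷ (+ 0 ∷ + 0 ∷ + 0 ∷ + 0 ∷ + 0 ∷ + 0 ∷ [])
    ∷ (+ 0 ∷ + 0 ∷ + 0 ∷ + 0 ∷ + 8 ∷ + 0 ∷ [])
    ∷ []) (pathIndex r p) (pathIndex r q)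
  Λ-covering p q = table
    ( (+ 0 ∷ + 0 ∷ + 0 ∷ + 1 ∷ + 0 ∷ + 0 ∷ [])
    ∷ (+ 0 ∷ + 0 ∷ + 0 ∷ + 4 ∷ + 0 ∷ + 0 ∷ [])
    ∷ (+ 0 ∷ + 0 ∷ + 0 ∷ + 0 ∷ + 4 ∷ + 1 ∷ [])
    ∷ (+ 1 ∷ + 4 ∷ + 0 ∷ + 0 ∷ + 0 ∷ + 0 ∷ [])
    ∷ (+ 0 ∷ + 0 ∷ + 4 ∷ + 0 ∷ + 0 ∷ + 0 ∷ [])
    ∷ (+ 0 ∷ + 0 ∷ + 1 ∷ + 0 ∷ + 0 ∷ + 0 ∷ [])
    ∷ []) (pathIndex r p) (pathIndex r q)

  row-part diagonal-part square-part square-part′ half trace-part covering-part rest :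
    Fin 6 → Fin 6 → ℤ
  row-part p q      = μ p ℤ.- diag (λ p → μ p ℤ.* + 3) p q
  diagonal-part p q = rowSums Λ-diagonal p q ℤ.- Λ-diagonal p q
  square-part p q   = v p ℤ.* v q
  square-part′ p q  = v′ p ℤ.* v′ q
  half p q          = row-part p q ℤ.+ diagonal-part p q ℤ.+
    (square-part p q ℤ.+ square-part′ p q)
  trace-part        = diag λ _ → -[1+ 15 ]
  covering-part p q = Λ-covering p q ℤ.-
    (rowSums Λ-covering p q ℤ.+ rowSums (λ p q → Λ-covering q p) p q)
  rest p q          = trace-part p q ℤ.+ Λ-nonneg p q ℤ.+ covering-part p q

-- The identity has to hold entry by entry and `C` is symmetric, while the row and diagonal parts
-- are not; so `half` enters together with its transpose, which is valid because `X` is symmetric.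
-- The squares of `v` and `v′` are thereby counted twice.
certificate : ∀ r p q → -[1+ 15 ] ℤ.* C r p q ≡ half r p q ℤ.+ half r q p ℤ.+ rest r p q
certificate = toWitness {a? = Fin.all? λ r → Fin.all? λ p → Fin.all? λ q →
  -[1+ 15 ] ℤ.* C r p q ℤ.≟ half r p q ℤ.+ half r q p ℤ.+ rest r p q} _

Λ≥0 : ∀ r p q → 0ℤ ℤ.≤ Λ-nonneg r p q × 0ℤ ℤ.≤ Λ-diagonal r p q × 0ℤ ℤ.≤ Λ-covering r p q
Λ≥0 = toWitness {a? = Fin.all? λ r → Fin.all? λ p → Fin.all? λ q →
  (0ℤ ℤ.≤? Λ-nonneg r p q) ×-dec (0ℤ ℤ.≤? Λ-diagonal r p q) ×-dec (0ℤ ℤ.≤? Λ-covering r p q)} _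

Λ-covering-total : ∀ r → (sumℤ λ p → sumℤ (Λ-covering r p)) ≡ + 20
Λ-covering-total = toWitness {a? = Fin.all? λ r → (sumℤ λ p → sumℤ (Λ-covering r p)) ℤ.≟ + 20} _

-- A tour on three vertices

Z₂ : Fin 2 × Fin 2 → Fin 2 × Fin 2 → ℤ
Z₂ (i , p) (j , q) = ⟦ does (i Fin.≟ p) ⟧ ℤ.* ⟦ does (j Fin.≟ q) ⟧

-- `Z₂` is the lift of the identity assignment, so it has rank one and a single square suffices.
Z₂-witness : IntegralWitness 2 1ℤ Z₂
Z₂-witness = record
  { squares       = (1 , λ (i , p) → ⟦ does (i Fin.≟ p) ⟧) ∷ []
  ; sos           = λ (i , p) (j , q) → ≡.sym (≡.trans (ℤ.+-identityʳ _) (ℤ.*-identityˡ _))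
  ; nonneg        = λ (i , p) (j , q) → ℤ-nonneg-* (⟦⟧-nonneg (does (i Fin.≟ p)))
    (⟦⟧-nonneg (does (j Fin.≟ q)))
  ; vertex        = toWitness {a? = Fin.all? λ p → (sumℤ λ i → Z₂ (i , p) (i , p)) ℤ.≟ 1ℤ} _
  ; position      = toWitness {a? = Fin.all? λ i → (sumℤ λ p → Z₂ (i , p) (i , p)) ℤ.≟ 1ℤ} _
  ; same-vertex   = toWitness {a? = Fin.all? λ i → Fin.all? λ p → Fin.all? λ q →
      ¬? (p Fin.≟ q) →-dec (Z₂ (i , p) (i , q) ℤ.≟ 0ℤ)} _
  ; same-position = toWitness {a? = Fin.all? λ i → Fin.all? λ j → Fin.all? λ p →
      ¬? (i Fin.≟ j) →-dec (Z₂ (i , p) (j , p) ℤ.≟ 0ℤ)} _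
  ; total         = ≡.refl
  }

degree₃ : ∀ r p → sumℤ (C {2} r p) ℤ.+ C₀ r p ≡ + 2
degree₃ = toWitness {a? = Fin.all? λ r → Fin.all? λ p → sumℤ (C {2} r p) ℤ.+ C₀ r p ℤ.≟ + 2} _

complete₃ : ∀ r p q → C {2} r p q ℤ.+ diag (λ _ → 1ℤ) p q ≡ 1ℤ
complete₃ = toWitness {a? = Fin.all? λ r → Fin.all? λ p → Fin.all? λ q →
  C {2} r p q ℤ.+ diag (λ _ → 1ℤ) p q ℤ.≟ 1ℤ} _

-- Cut metrics

distance : Bool → Bool → ℝ
distance a b = if a xor b then 1ℝ else 0ℝ

cutInstance : ∀ {N} → 3 ℕ.≤ N → (Fin N → Bool) → TSPInstance N
cutInstance 3≤N side = record
  { size        = 3≤N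
  ; d           = λ i j → distance (side i) (side j)
  ; symmetric   = λ i j → ≐⇒≈ (≐-reflexive (≡.cong (λ b → if b then 1ℝ else 0ℝ)
    (Bool.xor-comm (side i) (side j))))
  ; nonnegative = λ i j → ≼⇒≤ (distance-nonneg (side i) (side j))
  ; diagonal    = λ i → ≐⇒≈ (≐-reflexive (≡.cong (λ b → if b then 1ℝ else 0ℝ)
    (Bool.xor-same (side i))))
  ; triangle    = λ i j k → ≼⇒≤ (distance-triangle (side i) (side j) (side k))
  }
  where
  distance-nonneg : ∀ a b → 0ℝ ≼ distance a b
  distance-nonneg a b with a xor b
  ... | true  = ≼-pointwise λ _ → toWitness {a? = _ ℚ.≤? _} _
  ... | false = ≼-pointwise λ _ → ℚ.≤-refl

  distance-triangle : ∀ a b c → distance a b ≼ distance a c + distance c b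
  distance-triangle false false false = ≼-pointwise λ _ → toWitness {a? = _ ℚ.≤? _} _
  distance-triangle false false true  = ≼-pointwise λ _ → toWitness {a? = _ ℚ.≤? _} _
  distance-triangle false true  false = ≼-pointwise λ _ → toWitness {a? = _ ℚ.≤? _} _
  distance-triangle false true  true  = ≼-pointwise λ _ → toWitness {a? = _ ℚ.≤? _} _
  distance-triangle true  false false = ≼-pointwise λ _ → toWitness {a? = _ ℚ.≤? _} _
  distance-triangle true  false true  = ≼-pointwise λ _ → toWitness {a? = _ ℚ.≤? _} _
  distance-triangle true  true  false = ≼-pointwise λ _ → toWitness {a? = _ ℚ.≤? _} _
  distance-triangle true  true  true  = ≼-pointwise λ _ → toWitness {a? = _ ℚ.≤? _} _

Diag≐ : ∀ {n} (c : Vector ℝ n) a b → Diag c a b ≐ (if does (a Fin.≟ b) then c a else ι 0ℤ)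
Diag≐ c a b with does (a Fin.≟ b)
... | true  = ≐-refl {c a}
... | false = fromℚ≐ι 0ℤ

⊗⊞Diag≐ : ∀ {n} (A B : Matrix n n) c a b →
  (A ⊗ B ⊞ Diag c) a b ≐ 𝕋.kron A B a b ⊕ (if does (a Fin.≟ b) then c a else ι 0ℤ)
⊗⊞Diag≐ A B c a b = +≐⊕-cong ((A ⊗ B) a b) (Diag c a b)
  (⊗≐kron A A B B (λ i j → ≐-refl {A i j}) (λ i j → ≐-refl {B i j}) a b) (Diag≐ c a b)

indicator≐ : ∀ b → (if b then 1ℝ else 0ℝ) ≐ ι ⟦ b ⟧
indicator≐ true  = fromℚ≐ι 1ℤ
indicator≐ false = fromℚ≐ι 0ℤ

C₁≐ : ∀ {N} (i j : Fin N) → C₁ N i j ≐ ι ⟦ does (adjacent? i j) ⟧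
C₁≐ i j = indicator≐ (does (adjacent? i j))

C₁-sym : ∀ {N} (i j : Fin N) → C₁ N i j ≡ C₁ N j i
C₁-sym i j = ≡.cong (λ b → if b then 1ℝ else 0ℝ)
  (Bool.∨-comm (does (next? i j)) (does (next? j i)))

½·-double : ∀ {m n} (A : Matrix m n) i j → (fromℚ ½ · A) i j ⊕ (fromℚ ½ · A) i j ≐ A i j
½·-double A i j = ≐-trans {y = fromℚ ½ * A i j + fromℚ ½ * A i j}
  (≐-sym (+≐⊕ (fromℚ ½ * A i j) (fromℚ ½ * A i j)))
  (≐-pointwise λ n → ≡.trans (≡.sym (ℚ.*-distribʳ-+ (seq (A i j) n) ½ ½))
    (ℚ.*-identityˡ (seq (A i j) n)))

½·-sym : ∀ {n} (A : Matrix n n) → (∀ i j → A i j ≡ A j i) →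
  ∀ i j → (fromℚ ½ · A) i j ≐ (fromℚ ½ · A) j i
½·-sym A A-sym i j = ≐-pointwise λ n → ≡.cong (λ x → ½ ℚ.* seq x n) (A-sym i j)

vec-combine : ∀ {m n} (M : Matrix m n) i p → vec M (combine i p) ≡ M p i
vec-combine M i p = ≡.cong₂ M (𝕋.remainder-combine i p) (𝕋.quotient-combine i p)

∙ₘ-singleton : ∀ {m n} (A : Matrix m 1) (B : Matrix 1 n) i j → (A ∙ₘ B) i j ≐ A i 0F ⊛ B 0F j
∙ₘ-singleton A B i j = ≐-trans {y = A i 0F * B 0F j}
  (≐-pointwise λ n → ℚ.+-identityʳ (seq (A i 0F) n ℚ.* seq (B 0F j) n)) (*≐⊛ (A i 0F) (B 0F j))

-- With `a` the side of `s`, the bits `a xor b` and `a xor c` tell which vertices are separated from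
-- `s`. Relative to `s` the metric is unchanged, and `s` always falls outside the cluster.
xor≐ : ∀ a b c {b′ c′} → a xor b ≡ b′ → a xor c ≡ c′ →
       distance b c ≐ ι (⟦ b′ ⟧ ℤ.* ⟦ not c′ ⟧ ℤ.+ ⟦ not b′ ⟧ ℤ.* ⟦ c′ ⟧)
xor≐ false false false ≡.refl ≡.refl = fromℚ≐ι 0ℤ
xor≐ false false true  ≡.refl ≡.refl = fromℚ≐ι 1ℤ
xor≐ false true  false ≡.refl ≡.refl = fromℚ≐ι 1ℤ
xor≐ false true  true  ≡.refl ≡.refl = fromℚ≐ι 0ℤ
xor≐ true  false false ≡.refl ≡.refl = fromℚ≐ι 0ℤ
xor≐ true  false true  ≡.refl ≡.refl = fromℚ≐ι 1ℤ
xor≐ true  true  false ≡.refl ≡.refl = fromℚ≐ι 1ℤ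
xor≐ true  true  true  ≡.refl ≡.refl = fromℚ≐ι 0ℤ

solve-for : ∀ {x y} p q → x ⊕ y ≐ fromℚ p → y ≐ fromℚ q → x ≐ fromℚ (p ℚ.- q)
solve-for {x} {y} p q x+y≐p y≐q = begin
  x                                  ≈⟨ ≐-pointwise (λ n → ≡.sym (x+y-y (seq x n) (seq y n))) ⟩
  x + y + - y                        ≈⟨ +≐⊕-cong (x + y) (- y) (+≐⊕ x y) (-≐negate y) ⟩
  (x ⊕ y) ⊕ negate y                 ≈⟨ ⊕-cong x+y≐p (negate-cong y≐q) ⟩
  fromℚ p ⊕ negate (fromℚ q)
    ≈⟨ +≐⊕-cong (fromℚ p) (- fromℚ q) (≐-refl {fromℚ p}) (-≐negate (fromℚ q)) ⟨
  fromℚ p + - fromℚ q                ≈⟨ ≐-pointwise (λ _ → ≡.refl) ⟩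
  fromℚ (p ℚ.- q)                    ∎
  where
  x+y-y : ∀ a b → a ℚ.+ b ℚ.+ ℚ.- b ≡ a
  x+y-y a b = ≡.trans (ℚ.+-assoc a b (ℚ.- b))
    (≡.trans (≡.cong (a ℚ.+_) (ℚ.+-inverseʳ b)) (ℚ.+-identityʳ a))

-- The program of a cut metric

module CutSDP {n} (r s : Fin (suc n)) (T : TSPInstance (suc n)) (side′ : Fin n → Bool)
  (distance≐ : ∀ i j → d T (punchIn s i) (punchIn s j) ≐
               ι (⟦ side′ i ⟧ ℤ.* ⟦ not (side′ j) ⟧ ℤ.+ ⟦ not (side′ i) ⟧ ℤ.* ⟦ side′ j ⟧))
  (root≐ : ∀ i → d T s (punchIn s i) ≐ ι ⟦ side′ i ⟧)
  (degree : ∀ p → sumℤ (C r p) ℤ.+ C₀ r p ≡ + 2) where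

  -- The names of SDP₂ are qualified because Agda would not recognise the copies
  -- made by opening it as syntactically equal to the originals.
  H : Matrix n n
  H = fromℚ ½ · (C₁ (suc n) [ SDP₂.α r s (d T) , SDP₂.α r s (d T) ])

  objective≐ : ∀ Y → SDP₂.objective r s (d T) Y ≐ 𝕋.tr (λ a b →
    𝕋.kron (d T [ SDP₂.β r s (d T) , SDP₂.β r s (d T) ]) H a b ⊕
    (if does (a Fin.≟ b) then SDP₂.c̄ r s (d T) a else ι 0ℤ)) Y
  objective≐ Y = trace≐tr (SDP₂.cost r s (d T)) (λ a b →
    𝕋.kron (d T [ SDP₂.β r s (d T) , SDP₂.β r s (d T) ]) H a b ⊕
    (if does (a Fin.≟ b) then SDP₂.c̄ r s (d T) a else ι 0ℤ)) Y
    (⊗⊞Diag≐ (d T [ SDP₂.β r s (d T) , SDP₂.β r s (d T) ])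
      (fromℚ ½ · (C₁ (suc n) [ SDP₂.α r s (d T) , SDP₂.α r s (d T) ])) (SDP₂.c̄ r s (d T)))

  H+H≐C : ∀ p q → H p q ⊕ H p q ≐ ι (C r p q)
  H+H≐C p q = ≐-trans {y = C₁ (suc n) (punchIn r p) (punchIn r q)}
    (½·-double (C₁ (suc n) [ SDP₂.α r s (d T) , SDP₂.α r s (d T) ]) p q)
      (C₁≐ (punchIn r p) (punchIn r q))

  H-sym : ∀ p q → H p q ≐ H q p
  H-sym = ½·-sym (C₁ (suc n) [ SDP₂.α r s (d T) , SDP₂.α r s (d T) ]) λ p q →
    C₁-sym (punchIn r p) (punchIn r q)

  c̄≐ : ∀ i p → SDP₂.c̄ r s (d T) (combine i p) ≐ ι (C₀ r p) ⊛ ι ⟦ side′ i ⟧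
  c̄≐ i p = ≐-trans
    (≐-reflexive (vec-combine (C₁ (suc n) [ SDP₂.α r s (d T) , SDP₂.⟨r⟩ r s (d T) ] ∙ₘ
                               d T [ SDP₂.⟨s⟩ r s (d T) , SDP₂.β r s (d T) ]) i p))
    (≐-trans (∙ₘ-singleton (C₁ (suc n) [ SDP₂.α r s (d T) , SDP₂.⟨r⟩ r s (d T) ])
                           (d T [ SDP₂.⟨s⟩ r s (d T) , SDP₂.β r s (d T) ]) p i)
             (⊛-cong (C₁≐ (punchIn r p) r) (root≐ i)))

  cut-objective : ∀ {Y} (F : 𝕋.Feasible {n} Y) →
    SDP₂.objective r s (d T) Y ⊕ 𝕋.⟪ C r , 𝕋.Cut.X {n} F side′ ⟫
      ≐ ι (𝕋.Cut.size {n} F side′ ℤ.+ 𝕋.Cut.size {n} F side′)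
  cut-objective {Y} F = ≐-trans (⊕-cong (objective≐ Y) (≐-refl {𝕋.⟪ C r , 𝕋.Cut.X {n} F side′ ⟫}))
    (𝕋.Cut.objective {n} F side′ (d T [ SDP₂.β r s (d T) , SDP₂.β r s (d T) ]) H
      (SDP₂.c̄ r s (d T)) (C r) (C₀ r) distance≐ H+H≐C H-sym c̄≐ degree)

  isOPT : ∀ {Y v} → 𝕋.Feasible {n} Y → SDP₂.objective r s (d T) Y ≐ v →
          (∀ {Y} → 𝕋.Feasible {n} Y → v ≼ SDP₂.objective r s (d T) Y) → SDP₂.IsOPT r s (d T) v
  isOPT {Y} {v} F Y≐v v≼ =
    (Y , Bridge.toFeasible r s (d T) Y F , ≐⇒≈ {SDP₂.objective r s (d T) Y} {v} Y≐v) ,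
    λ Y F → ≼⇒≤ {v} {SDP₂.objective r s (d T) Y} (v≼ {Y} (Bridge.fromFeasible r s (d T) Y F))

  module _ (C+I≡J : ∀ p q → C r p q ℤ.+ diag (λ _ → 1ℤ) p q ≡ 1ℤ)
    (k : ℤ) (size≡k : (sumℤ λ i → ⟦ side′ i ⟧) ≡ k) where

    complete-objective : ∀ {Y} → 𝕋.Feasible {n} Y →
      SDP₂.objective r s (d T) Y ⊕ ι (k ℤ.* k) ≐ ι (k ℤ.+ k ℤ.+ k)
    complete-objective {Y} F = ≡.subst
      (λ k → SDP₂.objective r s (d T) Y ⊕ ι (k ℤ.* k) ≐ ι (k ℤ.+ k ℤ.+ k)) size≡k (begin
      SDP₂.objective r s (d T) Y ⊕ ι (∣A∣ ℤ.* ∣A∣)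
        ≈⟨ ⊕-cong (≐-refl {SDP₂.objective r s (d T) Y})
          (𝕋.Certificate.⟪complete⟫ (𝕋.Cut.cutMoments {n} F side′) {C r} C+I≡J) ⟨
      SDP₂.objective r s (d T) Y ⊕ (⟪C,X⟫ ⊕ ι ∣A∣)
        ≈⟨ ⊕-assoc (SDP₂.objective r s (d T) Y) ⟪C,X⟫ (ι ∣A∣) ⟨
      SDP₂.objective r s (d T) Y ⊕ ⟪C,X⟫ ⊕ ι ∣A∣
        ≈⟨ ⊕-cong (cut-objective F) (≐-refl {ι ∣A∣}) ⟩
      ι (∣A∣ ℤ.+ ∣A∣) ⊕ ι ∣A∣
        ≈⟨ ι-+ (∣A∣ ℤ.+ ∣A∣) ∣A∣ ⟨
      ι (∣A∣ ℤ.+ ∣A∣ ℤ.+ ∣A∣)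
        ∎)
      where
      ∣A∣ : ℤ
      ∣A∣ = 𝕋.Cut.size {n} F side′

      ⟪C,X⟫ : ℝ
      ⟪C,X⟫ = 𝕋.⟪ C r , 𝕋.Cut.X {n} F side′ ⟫

    -- The objective is the same for all feasible matrices, so any one of them attains the minimum;
    -- `solve` carries out the subtraction of `k`² for the value of `k` at hand.
    isOPT-complete : ∀ {Y v} → 𝕋.Feasible {n} Y →
      (∀ {x} → x ⊕ ι (k ℤ.* k) ≐ ι (k ℤ.+ k ℤ.+ k) → x ≐ v) →
                     SDP₂.IsOPT r s (d T) v
    isOPT-complete {Y} {v} F solve = isOPT {Y} {v} F
      (solve {SDP₂.objective r s (d T) Y} (complete-objective {Y} F))
      λ {Y} F → ≼-reflexive {v} {SDP₂.objective r s (d T) Y}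
        (≐-sym (solve {SDP₂.objective r s (d T) Y} (complete-objective {Y} F)))

-- The value on three vertices

corner : Fin 3 → Bool
corner i = does (i Fin.≟ 0F)

opposite : Fin 3 → Fin 2 → Bool
opposite s i = corner s xor corner (punchIn s i)

-- The size depends on whether `s` is the corner itself. Both sizes give the same value: 3 `k` -
-- `k`² is 3 - 1 for `k` = 1 and 6 - 4 for `k` = 2.
opposite-size : ∀ s → (sumℤ λ i → ⟦ opposite s i ⟧) ≡ + 1 ⊎ (sumℤ λ i → ⟦ opposite s i ⟧) ≡ + 2
opposite-size 0F = inj₂ ≡.refl
opposite-size 1F = inj₁ ≡.refl
opposite-size 2F = inj₁ ≡.refl

𝕂₃ : TSPInstance 3
𝕂₃ = cutInstance (ℕ.s≤s (ℕ.s≤s (ℕ.s≤s ℕ.z≤n))) corner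

ρ²≐1 : ι 1ℤ ⊛ ι 1ℤ ⊛ ι 1ℤ ≐ ι 1ℤ
ρ²≐1 = ≐-trans (⊛-assoc (ι 1ℤ) (ι 1ℤ) (ι 1ℤ))
  (≐-trans (⊛-identityˡ (ι 1ℤ ⊛ ι 1ℤ)) (⊛-identityˡ (ι 1ℤ)))

Y₂ : Matrix 4 4
Y₂ = 𝕋.Witness.Y Z₂-witness (ι 1ℤ) ρ²≐1

Y₂-feasible : 𝕋.Feasible {2} Y₂
Y₂-feasible = 𝕋.Witness.feasible Z₂-witness (ι 1ℤ) ρ²≐1

module Sides (r s : Fin 3) where

  open CutSDP {2} r s 𝕂₃ (opposite s)
    (λ i j → xor≐ (corner s) (corner (punchIn s i)) (corner (punchIn s j)) ≡.refl ≡.refl)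
    (λ i → indicator≐ (opposite s i)) (degree₃ r) using (isOPT-complete) public

𝕂₃-isOPT : ∀ r s → SDP₂.IsOPT r s (d 𝕂₃) (fromℚ (+ 2 ℚ./ 1))
𝕂₃-isOPT r s with opposite-size s
... | inj₁ k≡1 = isOPT-complete (complete₃ r) (+ 1) k≡1 {Y₂} {fromℚ (+ 2 ℚ./ 1)} Y₂-feasible
  λ {x} eq →
  ≐-trans {y = fromℚ (+ 3 ℚ./ 1 ℚ.- + 1 ℚ./ 1)}
    (solve-for {x} {ι (+ 1)} (+ 3 ℚ./ 1) (+ 1 ℚ./ 1)
      (≐-trans eq (≐-sym (fromℚ≐ι (+ 3)))) (≐-sym (fromℚ≐ι (+ 1))))
    (≐-pointwise λ _ → ≡.refl)
  where open Sides r s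
... | inj₂ k≡2 = isOPT-complete (complete₃ r) (+ 2) k≡2 {Y₂} {fromℚ (+ 2 ℚ./ 1)} Y₂-feasible
  λ {x} eq →
  ≐-trans {y = fromℚ (+ 6 ℚ./ 1 ℚ.- + 4 ℚ./ 1)}
    (solve-for {x} {ι (+ 4)} (+ 6 ℚ./ 1) (+ 4 ℚ./ 1)
      (≐-trans eq (≐-sym (fromℚ≐ι (+ 6)))) (≐-sym (fromℚ≐ι (+ 4))))
    (≐-pointwise λ _ → ≡.refl)
  where open Sides r s

-- The value on seven vertices

clusters : Fin 7 → Fin 7 → Bool
clusters s = insertAt side s false

-- The instance depends on `s`, which joins the larger cluster; the other six vertices, as
-- enumerated by `punchIn s`, then have the sides `side` whatever `s` is.
twoClusters : Fin 7 → TSPInstance 7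
twoClusters s = cutInstance (ℕ.s≤s (ℕ.s≤s (ℕ.s≤s ℕ.z≤n))) (clusters s)

module _ {X : Fin 6 → Fin 6 → ℝ} (X-moments : 𝕋.CutMoments (+ 3) X) (r : Fin 7) where

  open 𝕋.Certificate X-moments

  valid-half : Valid (half r) 0ℤ
  valid-half = valid-+ {λ p q → row-part r p q ℤ.+ diagonal-part r p q}
    {λ p q → square-part r p q ℤ.+ square-part′ r p q} {0ℤ} {0ℤ}
    (valid-+ {row-part r} {diagonal-part r} {0ℤ} {0ℤ} (valid-row (μ r))
      (valid-≼diagonal {Λ-diagonal r} λ p q → proj₁ (proj₂ (Λ≥0 r p q))))
    (valid-+ {square-part r} {square-part′ r} {0ℤ} {0ℤ} (valid-square (v r))
      (valid-square (v′ r)))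

  valid-rest : Valid (rest r) (-[1+ 47 ] ℤ.+ ℤ.- (sumℤ λ p → sumℤ (Λ-covering r p)))
  valid-rest = valid-+ {λ p q → trace-part r p q ℤ.+ Λ-nonneg r p q} {covering-part r}
    { -[1+ 47 ]} {ℤ.- (sumℤ λ p → sumℤ (Λ-covering r p))}
    (valid-+ {trace-part r} {Λ-nonneg r} { -[1+ 47 ]} {0ℤ} (valid-trace -[1+ 15 ])
      (valid-nonneg {Λ-nonneg r} λ p q → proj₁ (Λ≥0 r p q)))
    (valid-covering {Λ-covering r} λ p q → proj₂ (proj₂ (Λ≥0 r p q)))

  -- The constant -68 is made up of -48, from the trace multiplier -16 and the trace 3, and -20,
  -- from the total of the covering multipliers.
  valid : Valid (λ p q → -[1+ 15 ] ℤ.* C r p q) -[1+ 67 ]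
  valid = valid-cong {λ p q → half r p q ℤ.+ half r q p ℤ.+ rest r p q}
    {λ p q → -[1+ 15 ] ℤ.* C r p q}
    {0ℤ ℤ.+ 0ℤ ℤ.+ (-[1+ 47 ] ℤ.+ ℤ.- (sumℤ λ p → sumℤ (Λ-covering r p)))} { -[1+ 67 ]}
    (λ p q → ≡.sym (certificate r p q))
      (≡.cong (λ t → 0ℤ ℤ.+ 0ℤ ℤ.+ (-[1+ 47 ] ℤ.+ ℤ.- t)) (Λ-covering-total r))
    (valid-+ {λ p q → half r p q ℤ.+ half r q p} {rest r} {0ℤ}
      { -[1+ 47 ] ℤ.+ ℤ.- (sumℤ λ p → sumℤ (Λ-covering r p))}
      (valid-+ {half r} {λ p q → half r q p} {0ℤ} {0ℤ} valid-half
        (valid-transpose {half r} {0ℤ} valid-half)) valid-rest)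

  -- 28 = 16 · 6 - 68, and 28 / 16 = 7/4 is the value of the feasible matrix.
  clusters-bound : ∀ {f} → f ⊕ 𝕋.⟪ C r , X ⟫ ≐ ι (+ 6) → ι (+ 28) ≼ ι (+ 16) ⊛ f
  clusters-bound {f} = length-bound (+ 16) {C r} {f = f} valid

unscale : ∀ {a c v x} → 0ℚ ℚ.< c ℚ./ 1 → a ℚ./ 1 ≡ (c ℚ./ 1) ℚ.* v → ι a ≼ ι c ⊛ x → fromℚ v ≼ x
unscale {a} {c} {v} {x} c>0 a≡cv a≼cx = ≼⟨ (λ ε ε>0 →
  -- The tolerance `c ε` becomes `ε` when the inequality between rationals is divided by `c`.
  let N , a≤cx = ≼⇒≤ fromℚ-a≼cx (c ℚ./ 1 ℚ.* ε) (pos*pos c>0 ε>0)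
  in N , λ n N≤n → ℚ.*-cancelˡ-≤-pos (c ℚ./ 1) {{ℚ.positive c>0}}
       (≡.subst₂ ℚ._≤_ a≡cv (≡.sym (ℚ.*-distribˡ-+ (c ℚ./ 1) (seq x n) ε)) (a≤cx n N≤n))) ⟩
  where
  fromℚ-a≼cx : fromℚ (a ℚ./ 1) ≼ fromℚ (c ℚ./ 1) * x
  fromℚ-a≼cx = ≼-trans (≼-reflexive (fromℚ≐ι a))
    (≼-trans a≼cx (≼-reflexive (≐-sym (*≐⊛-cong (fromℚ (c ℚ./ 1)) x (fromℚ≐ι c) (≐-refl {x})))))

1/12 : ℝ
1/12 = fromℚ (+ 1 ℚ./ 12)

square-scale : ∀ p a {q} → p ℚ.* p ℚ.* (a ℚ./ 1) ≡ q → fromℚ p ⊛ fromℚ p ⊛ ι a ≐ fromℚ q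
square-scale p a {q} eq = ≐-trans
  (≐-sym (*≐⊛-cong (fromℚ p * fromℚ p) (fromℚ (a ℚ./ 1)) (*≐⊛ (fromℚ p) (fromℚ p)) (fromℚ≐ι a)))
  (≐-pointwise λ _ → eq)

ρ²K≐1 : 1/12 ⊛ 1/12 ⊛ ι (+ 144) ≐ ι 1ℤ
ρ²K≐1 = ≐-trans (square-scale (+ 1 ℚ./ 12) (+ 144) ≡.refl) (fromℚ≐ι 1ℤ)

module _ (r : Fin 7) where

  Y₆ : Matrix 36 36
  Y₆ = 𝕋.Witness.Y (Z-witness r) 1/12 ρ²K≐1

  Y₆-feasible : 𝕋.Feasible {6} Y₆
  Y₆-feasible = 𝕋.Witness.feasible (Z-witness r) 1/12 ρ²K≐1

  Y₆-moments : 𝕋.⟪ C r , 𝕋.Cut.X {6} Y₆-feasible side ⟫ ≐ fromℚ (+ 17 ℚ./ 4)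
  Y₆-moments = ≐-trans (𝕋.Witness.⟪⟫-moments (Z-witness r) 1/12 ρ²K≐1 side (C r))
    (≐-trans (≐-reflexive (≡.cong (λ z → 1/12 ⊛ 1/12 ⊛ ι z) (Z-value r)))
      (square-scale (+ 1 ℚ./ 12) (+ 612) ≡.refl))

  Y₆-solve : ∀ {x} → x ⊕ 𝕋.⟪ C r , 𝕋.Cut.X {6} Y₆-feasible side ⟫ ≐ ι (+ 6) →
             x ≐ fromℚ (+ 7 ℚ./ 4)
  Y₆-solve {x} eq = ≐-trans {y = fromℚ (+ 6 ℚ./ 1 ℚ.- + 17 ℚ./ 4)}
    (solve-for {x} {𝕋.⟪ C r , 𝕋.Cut.X {6} Y₆-feasible side ⟫} (+ 6 ℚ./ 1) (+ 17 ℚ./ 4)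
      (≐-trans eq (≐-sym (fromℚ≐ι (+ 6)))) Y₆-moments)
    (≐-pointwise λ _ → ≡.refl)

clusters-isOPT : ∀ r s → SDP₂.IsOPT r s (d (twoClusters s)) (fromℚ (+ 7 ℚ./ 4))
clusters-isOPT r s = isOPT {Y₆ r} {fromℚ (+ 7 ℚ./ 4)} (Y₆-feasible r)
  (Y₆-solve r {SDP₂.objective r s (d (twoClusters s)) (Y₆ r)}
    (cut-objective {Y₆ r} (Y₆-feasible r)))
  λ {Y} F → unscale { + 28} { + 16} { + 7 ℚ./ 4} {SDP₂.objective r s (d (twoClusters s)) Y}
    (ℚ.positive⁻¹ (+ 16 ℚ./ 1)) ≡.refl
      (clusters-bound (𝕋.Cut.cutMoments {6} F side) r {SDP₂.objective r s (d (twoClusters s)) Y}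
        (cut-objective {Y} F))
  where
  clusters-side : ∀ i → clusters s s xor clusters s (punchIn s i) ≡ side i
  clusters-side i = ≡.cong₂ _xor_ (insertAt-lookup side s false) (insertAt-punchIn side s false i)

  open CutSDP {6} r s (twoClusters s) side
    (λ i j → xor≐ (clusters s s) (clusters s (punchIn s i)) (clusters s (punchIn s j))
      (clusters-side i) (clusters-side j))
    (λ i → ≐-trans (indicator≐ (clusters s s xor clusters s (punchIn s i)))
                   (≐-reflexive (≡.cong (λ b → ι ⟦ b ⟧) (clusters-side i))))
    (degree₇ r) using (isOPT; cut-objective)

corollary4p22 : (r s : ∀ n → Fin (suc n)) →
    ∃[ n ] ∃[ n' ] suc n ℕ.< suc n' ×
    (Σ[ D ∈ TSPInstance (suc n) ] Σ[ D' ∈ TSPInstance (suc n') ]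
    (Σ[ f ∈ (Fin (suc n) → Fin (suc n')) ]
    Injective _≡_ _≡_ f × (∀ i j → d D i j ≈ d D' (f i) (f j))) ×
    (Σ[ v ∈ ℝ ] Σ[ v' ∈ ℝ ]
    SDP₂.IsOPT (r n) (s n) (d D) v ×
    SDP₂.IsOPT (r n') (s n') (d D') v' ×
    v' < v))
corollary4p22 r s =
  2 , 6 , ℕ.s≤s (ℕ.s≤s (ℕ.s≤s (ℕ.s≤s ℕ.z≤n))) ,
  𝕂₃ ,
  twoClusters (s 6) ,
  (f , f-injective , λ i j → ≐⇒≈ (≐-reflexive (≡.cong₂ distance (f-side i) (f-side j)))) ,
  fromℚ (+ 2 ℚ./ 1) , fromℚ (+ 7 ℚ./ 4) ,
  𝕂₃-isOPT (r 2) (s 2) , clusters-isOPT (r 6) (s 6) ,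
  -- The gap is 2 - 7/4, and both sequences are constant.
  (+ 1 ℚ./ 4 , ℚ.positive⁻¹ (+ 1 ℚ./ 4) , 0 , λ _ _ → ℚ.≤-refl)
  where
  -- One vertex of the cluster of three and two of the other cluster, in agreement with `corner`;
  -- `punchIn` then keeps all of them away from `s`.
  g : Fin 3 → Fin 6
  g 0F = 0F
  g 1F = 3F
  g 2F = 4F

  f : Fin 3 → Fin 7
  f i = punchIn (s 6) (g i)

  f-injective : Injective _≡_ _≡_ f
  f-injective {i} {j} eq = toWitness
    {a? = Fin.all? λ i → Fin.all? λ j → (g i Fin.≟ g j) →-dec (i Fin.≟ j)} _ i j
    (Fin.punchIn-injective (s 6) (g i) (g j) eq)

  f-side : ∀ i → corner i ≡ clusters (s 6) (f i)
  f-side i = ≡.trans (g-side i) (≡.sym (insertAt-punchIn side (s 6) false (g i)))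
    where
    g-side : ∀ i → corner i ≡ side (g i)
    g-side 0F = ≡.refl
    g-side 1F = ≡.refl
    g-side 2F = ≡.refl
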